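{- $\mathrm{MC}(\cup,\cap,\overline{\phantom{c}},+,/) \in \mathrm{PSPACE}$.
   Context: Natural numbers include $0$. For $A,B\subseteq\mathbb N$: $A\cup B$, $A\cap B$ are the usual operations, $\overline{A}=\mathbb N\setminus A$, $A+B=\{a+b: a\in A, b\in B\}$, $A\times B=\{a\cdot b: a\in A, b\in B\}$, and $A/B=\{c\in\mathbb N:\exists a\in A\ \exists b\in B\setminus\{0\}: a=c\cdot b\}$ (exact integer division without remainder or rounding). For $\emptyset\ne\mathcal O\subseteq\{\cup,\cap,\overline{\phantom{c}},+,\times,/\}$, an $\mathcal O$-circuit $C=(V,E,g_C,\alpha)$ is a finite acyclic directed multigraph with gate set $V\subseteq\mathbb N$, every gate having indegree $0$, $1$ or $2$, a designated output gate $g_C\in V$, and a labeling $\alpha$: gates of indegree $0$ (input gates) are labeled by natural numbers, gates of indegree $1$ are labeled $\overline{\phantom{c}}$ (allowed only if $\overline{\phantom{c}}\in\mathcal O$), and gates of indegree $2$ are labeled by an operation in $\mathcal O\setminus\{\overline{\phantom{c}}\}$. The result set $I(g)\subseteq\mathbb N$ is defined inductively: $I(g)=\{\alpha(g)\}$ for an input gate; $I(g)=\mathbb N\setminus I(p)$ for a complement gate with predecessor $p$; $I(g)=I(g_1)\,\sigma\,I(g_2)$ for a gate labeled $\sigma$ with predecessors $g_1\le g_2$ (a double edge from one gate gives $g_1=g_2$). $I(C)=I(g_C)$. A circuit is encoded as a bit string listing its gates in reverse topological order, each gate as the triple (gate name, label, list of predecessors), with all numbers (including input labels) in binary; $|C|$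 denotes the length of this encoding. The membership problem is $\mathrm{MC}(\mathcal O)=\{(C,b): C \text{ is an } \mathcal O\text{ -circuit},\ b\in\mathbb N,\ b\in I(C)\}$, with $b$ given in binary; $\mathrm{MC}(\sigma_1,\dots,\sigma_n)$ abbreviates $\mathrm{MC}(\{\sigma_1,\dots,\sigma_n\})$. -}

module Defs where

open import Data.Bool.Base using (Bool; true; false; T)
open import Data.Fin.Base using (Fin) renaming (_<_ to _<ᶠ_)
open import Data.Fin.Induction using (spo-wellFounded)
open import Data.List.Base using (List; []; _∷_; _++_; length; map; foldr; concatMap; allFin)
open import Data.List.Membership.Propositional using () renaming (_∈_ to _∈ˡ_)
open import Data.List.Relation.Unary.Any using (here; there)
open import Data.List.Relation.Unary.Linked using (Linked)
open import Data.Maybe.Base using (Maybe; just; nothing) renaming (map to mapMaybe)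
open import Data.Nat.Base using (ℕ; zero; suc; _+_; _*_; _≤_)
open import Data.Product.Base using (_×_; _,_; ∃-syntax)
open import Data.Vec.Base as Vec using (Vec)
open import Function.Bundles using (_↔_; _⇔_)
open import Function.Definitions using (Injective)
open import Induction.WellFounded using (Acc; acc; WellFounded)
open import Level using (0ℓ) renaming (suc to lsuc)
open import Relation.Binary.Construct.Closure.ReflexiveTransitive using (Star)
open import Relation.Binary.Construct.Closure.Transitive as ⁺ using (TransClosure)
open import Relation.Binary.PropositionalEquality
  using (_≡_; _≢_; refl; isEquivalence; resp₂)
open import Relation.Nullary.Negation.Core using (¬_)
open import Relation.Unary using (Pred; _∈_; _∪_; _∩_; ∁; ｛_｝)

------------------------------------------------------------------------
-- Deterministic multitape Turing machines and PSPACE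

Language : Set₁
Language = Pred (List Bool) 0ℓ

Finite : Set → Set
Finite A = ∃[ n ] (A ↔ Fin n)

data Direction : Set where
  left stay right : Direction

-- A two-way infinite tape, stored as the finite segment consisting of the
-- initially written cells and all cells visited so far; every other cell is
-- blank.  The segment left of the head is stored nearest cell first.
record Tape (Γ : Set) : Set where
  constructor tape
  field
    before : List Γ
    head   : Γ
    after  : List Γ

open Tape public using (head)

cells : {Γ : Set} → Tape Γ → ℕ
cells (tape xs _ ys) = length xs + suc (length ys)

-- Tape contents with the head on the first symbol; the first argument is
-- the blank symbol.
load : {Γ : Set} → Γ → List Γ → Tape Γ
load □ []       = tape [] □ []
load □ (x ∷ xs) = tape [] x xs

move : {Γ : Set} → Γ → Direction → Tape Γ → Tape Γ
move □ left  (tape []       x ys)       = tape [] □ (x ∷ ys)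
move □ left  (tape (z ∷ xs) x ys)       = tape xs z (x ∷ ys)
move □ stay  t                          = t
move □ right (tape xs       x [])       = tape (x ∷ xs) □ []
move □ right (tape xs       x (z ∷ ys)) = tape (x ∷ xs) z ys

write : {Γ : Set} → Γ → Tape Γ → Tape Γ
write x (tape xs _ ys) = tape xs x ys

record TuringMachine : Set₁ where
  field
    extraTapes       : ℕ
    State            : Set
    State-finite     : Finite State
    Symbol           : Set
    Symbol-finite    : Finite Symbol
    blank            : Symbol
    bit              : Bool → Symbol
    bit-injective    : Injective _≡_ _≡_ bit
    bit≢blank        : ∀ b → bit b ≢ blank
    start            : State
    accepting        : State → Bool

  tapes : ℕ
  tapes = suc extraTapes

  field
    -- nothing means that the machine halts
    δ : State → Vec Symbol tapes →
        Maybe (State × Vec (Symbol × Direction) tapes)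

module Run (M : TuringMachine) where
  open TuringMachine M

  record Config : Set where
    constructor config
    field
      state    : State
      contents : Vec (Tape Symbol) tapes

  initial : List Bool → Config
  initial w = config start
    (load blank (map bit w) Vec.∷ Vec.replicate extraTapes (load blank []))

  act : Symbol × Direction → Tape Symbol → Tape Symbol
  act (x , d) t = move blank d (write x t)

  next : Config → Maybe Config
  next (config q ts) =
    mapMaybe (λ (q′ , as) → config q′ (Vec.zipWith act as ts))
             (δ q (Vec.map head ts))

  _⊢_ : Config → Config → Set
  c ⊢ c′ = next c ≡ just c′

  _⊢*_ : Config → Config → Set
  _⊢*_ = Star _⊢_

  Halted : Config → Set
  Halted c = next c ≡ nothing

  space : Config → ℕ
  space c = Vec.sum (Vec.map cells (Config.contents c))

  HaltsOn : List Bool → Set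
  HaltsOn w = ∃[ c ] (initial w ⊢* c × Halted c)

  Accepts : Language
  Accepts w = ∃[ c ] (initial w ⊢* c × Halted c × T (accepting (Config.state c)))

-- Polynomials with natural coefficients, constant term first.
evalPoly : List ℕ → ℕ → ℕ
evalPoly p x = foldr (λ a r → a + x * r) 0 p

record DecidesInPolySpace (M : TuringMachine) (L : Language) : Set where
  open Run M
  field
    halts   : ∀ w → HaltsOn w
    correct : ∀ w → w ∈ L ⇔ w ∈ Accepts
    poly    : List ℕ
    bounded : ∀ w c → initial w ⊢* c → space c ≤ evalPoly poly (length w)

PSPACE : Pred Language (lsuc 0ℓ)
PSPACE L = ∃[ M ] DecidesInPolySpace M L

------------------------------------------------------------------------
-- Circuits

data BinOp : Set where
  cup cap plus times div : BinOp

data Op : Set where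
  compl : Op
  bin   : BinOp → Op

-- The label of a gate together with its incoming edges, given by their
-- sources in the type G of gates.
data Gate (O : List Op) (G : Set) : Set where
  input      : ℕ → Gate O G
  complement : compl ∈ˡ O → G → Gate O G
  binary     : (σ : BinOp) → bin σ ∈ˡ O → G → G → Gate O G

preds : {O : List Op} {G : Set} → Gate O G → List G
preds (input _)        = []
preds (complement _ p) = p ∷ []
preds (binary _ _ p q) = p ∷ q ∷ []

-- The gate set V ⊆ ℕ is the image of name.  The numbering of the gates by
-- Fin size carries no meaning in itself.  Since gate names fix the order of
-- the operands, sorted matters for the non-commutative operation div.
record Circuit (O : List Op) : Set where
  field
    size           : ℕ
    name           : Fin size → ℕ
    name-injective : Injective _≡_ _≡_ name
    gate           : Fin size → Gate O (Fin size)
    sorted         : ∀ g → Linked _≤_ (map name (preds (gate g)))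
    output         : Fin size

  _⟶_ : Fin size → Fin size → Set
  p ⟶ g = p ∈ˡ preds (gate g)

  field
    acyclic : ∀ g → ¬ TransClosure _⟶_ g g

  ⟶-wellFounded : WellFounded _⟶_
  ⟶-wellFounded = ⁺.wellFounded⁻ _⟶_ (spo-wellFounded record
    { isEquivalence = isEquivalence
    ; irrefl        = λ { {g} refl → acyclic g }
    ; trans         = ⁺.transitive _⟶_
    ; <-resp-≈      = resp₂ (TransClosure _⟶_)
    })

applyOp : BinOp → Pred ℕ 0ℓ → Pred ℕ 0ℓ → Pred ℕ 0ℓ
applyOp cup   A B = A ∪ B
applyOp cap   A B = A ∩ B
applyOp plus  A B c = ∃[ a ] ∃[ b ] (a ∈ A × b ∈ B × c ≡ a + b)
applyOp times A B c = ∃[ a ] ∃[ b ] (a ∈ A × b ∈ B × c ≡ a * b)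
applyOp div   A B c = ∃[ a ] ∃[ b ] (a ∈ A × b ∈ B × b ≢ 0 × a ≡ c * b)

evalGate : {O : List Op} {G : Set} (x : Gate O G) →
           (∀ {p} → p ∈ˡ preds x → Pred ℕ 0ℓ) → Pred ℕ 0ℓ
evalGate (input n)        I = ｛ n ｝
evalGate (complement _ _) I = ∁ (I (here refl))
evalGate (binary σ _ _ _) I = applyOp σ (I (here refl)) (I (there (here refl)))

module _ {O : List Op} (C : Circuit O) where
  open Circuit C

  resultAcc : (g : Fin size) → Acc _⟶_ g → Pred ℕ 0ℓ
  resultAcc g (acc rs) = evalGate (gate g) (λ {p} e → resultAcc p (rs e))

  resultAt : Fin size → Pred ℕ 0ℓ
  resultAt g = resultAcc g (⟶-wellFounded g)

  result : Pred ℕ 0ℓ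
  result = resultAt output

  -- The numbering by Fin size lists every gate before its predecessors.
  ReverseTopological : Set
  ReverseTopological = ∀ {p g} → p ⟶ g → g <ᶠ p

------------------------------------------------------------------------
-- Encoding and the membership problem

-- Self-delimiting encoding of lists: true announces a further element,
-- false ends the list.
encodeList : {A : Set} → (A → List Bool) → List A → List Bool
encodeList f xs = concatMap (λ x → true ∷ f x) xs ++ (false ∷ [])

increment : List Bool → List Bool
increment []           = true ∷ []
increment (false ∷ bs) = true ∷ bs
increment (true  ∷ bs) = false ∷ increment bs

-- Binary digits, least significant first, without leading zeros (so that 0
-- has no digits).
binaryDigits : ℕ → List Bool
binaryDigits zero      = []
binaryDigits (suc n) = increment (binaryDigits n)

encodeℕ : ℕ → List Bool
encodeℕ n = encodeList (λ b → b ∷ []) (binaryDigits n)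

encodeBinOp : BinOp → List Bool
encodeBinOp cup   = false ∷ true  ∷ false ∷ []
encodeBinOp cap   = false ∷ true  ∷ true  ∷ []
encodeBinOp plus  = true  ∷ false ∷ false ∷ []
encodeBinOp times = true  ∷ false ∷ true  ∷ []
encodeBinOp div   = true  ∷ true  ∷ false ∷ []

encodeLabel : {O : List Op} {G : Set} → Gate O G → List Bool
encodeLabel (input n)        = false ∷ false ∷ false ∷ encodeℕ n
encodeLabel (complement _ _) = false ∷ false ∷ true ∷ []
encodeLabel (binary σ _ _ _) = encodeBinOp σ

-- The gates are listed in the order of their numbering; the list is preceded
-- by the name of the output gate.
encodeCircuit : {O : List Op} → Circuit O → List Bool
encodeCircuit C = encodeℕ (name output) ++ encodeList encodeGate (allFin size)
  where
  open Circuit C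
  encodeGate : Fin size → List Bool
  encodeGate g = encodeℕ (name g) ++ encodeLabel (gate g)
                 ++ encodeList (λ p → encodeℕ (name p)) (preds (gate g))

-- A circuit has an encoding for each reverse topological order of its gates:
-- C ranges over all numberings, and those that are such orders are encoded.
MC : List Op → Language
MC O w = ∃[ C ] ∃[ b ] (ReverseTopological {O} C
                        × w ≡ encodeCircuit C ++ encodeℕ b
                        × b ∈ result C)

{-# OPTIONS --safe #-}
-- All results of gates are constant above a threshold: + at most doubles the
-- threshold, / does not increase it (the quotients of x arise from the
-- multiples of x), and an input n contributes at most the factor n + 1.  Hence
-- the number whose bijective binary representation is the input word bounds the
-- thresholds of all gates, and it may stand for all larger numbers; then only
-- summands and divisors up to this bound have to be tried, and a recursion
-- along the gates decides membership with stacks of polynomial size.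
module Submission where

open import Data.Bool.Base using (Bool; true; false; T; if_then_else_; not; _∧_; _∨_)
open import Data.Bool.Properties using (∨-identityʳ; ∨-assoc; ∨-comm; ∧-identityʳ; ∧-assoc)
open import Data.Empty using (⊥; ⊥-elim)
open import Data.Fin.Base using (Fin; zero; suc; toℕ; punchIn; join; splitAt) renaming (_<_ to _<ᶠ_)
import Data.Fin.Properties as F
open import Data.List.Base as List
  using (List; []; _∷_; _++_; length; map; reverse; _ʳ++_; concatMap; concat; allFin; tabulate)
open import Data.List.Membership.Propositional using () renaming (_∈_ to _∈ˡ_)
open import Data.List.Properties
  using (length-map; length-++; length-ʳ++; length-reverse; map-cong; map-∘; map-tabulate;
         ++-assoc; ++-identityʳ; reverse-involutive; reverse-++; unfold-reverse; ∷-injectiveʳ; tabulate-cong; tabulate-lookup)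
open import Data.List.Relation.Unary.Any using (here; there)
open import Data.List.Relation.Unary.Linked using (Linked; []; [-]; _∷_)
open import Data.Maybe.Base using (Maybe; just; nothing; _>>=_)
open import Data.Maybe.Properties using (just-injective)
open import Data.Nat.Base
open import Data.Nat.Properties
open import Data.Nat.Tactic.RingSolver using (solve-∀)
open import Data.Product.Base using (_×_; _,_; ∃-syntax; proj₁; proj₂)
open import Data.Sum.Base as Sum using (_⊎_; inj₁; inj₂)
open import Data.Unit.Base using (⊤; tt)
open import Data.Vec.Base as Vec using (Vec; []; _∷_; lookup; _[_]≔_) renaming (_++_ to _++ᵛ_)
import Data.Vec.Properties as V
open import Data.Vec.Relation.Unary.All using (All; []; _∷_)
import Data.Vec.Relation.Unary.All.Properties as AllP
open import Function.Base using (_∘_; _∋_; id)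
open import Function.Bundles using (_⇔_; mk⇔; mk↔ₛ′; Inverse; Equivalence)
open import Function.Definitions using (Injective)
open import Induction.WellFounded using (Acc) renaming (acc to accessible)
open import Level using (0ℓ)
open import Relation.Binary.Construct.Closure.ReflexiveTransitive using (Star; ε; _◅_; _◅◅_)
open import Relation.Binary.Construct.Closure.Transitive using (TransClosure; [_]; _∷_)
open import Relation.Binary.PropositionalEquality
open import Relation.Nullary using (¬_; yes; no; contradiction)
open import Relation.Unary using (Pred; _∈_)
open import Defs

-- Stack programs and their execution by Turing machines

-- Two intermediate languages separate the algorithm from the machine: terms with loops and one
-- recursive procedure compile to programs on three stacks, and these to machines with one further
-- tape for return addresses. Only space is limited, so arithmetic may count by ones and gates may
-- be decoded anew whenever they are needed. Every word in use has at most `length w + 1` digits, an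
-- activation of the procedure holds a constant number of words, and nested calls receive ever
-- shorter lists of gates; this makes the space quadratic. `PSPACE` asks for halting and for the
-- space bound on every input, so decoding has to be followed on malformed words too. As the machine
-- is deterministic, a bound along the one run to a halting configuration covers all reachable
-- configurations. The thresholds stay below the cap because the factors contributed by the gates
-- multiply while the lengths of their encodings add up: each gate pays for its factor with its own
-- bits.

Sym : Set
Sym = Maybe Bool

data Cmd (k : ℕ) : Set where
  skip call : Cmd k
  push      : Fin k → Sym → Cmd k
  pop       : Fin k → Cmd k
  _⨾_       : Cmd k → Cmd k → Cmd k
  branch    : Fin k → (Maybe Sym → Bool) → Cmd k → Cmd k → Cmd k
  while     : Fin k → (Maybe Sym → Bool) → Cmd k → Cmd k

infixr 5 _⨾_

Stacks : ℕ → Set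
Stacks = Vec (List Sym)

top : {A : Set} → List A → Maybe A
top []      = nothing
top (a ∷ _) = just a

-- S bounds the height of every stack, d the depth of nested calls.
data Exec {k} (S : ℕ) (body : Cmd k) : ℕ → Cmd k → Stacks k → Stacks k → Set where
  skip : ∀ {d σ} → Exec S body d skip σ σ
  call : ∀ {d σ σ′} → Exec S body d body σ σ′ → Exec S body (suc d) call σ σ′
  push : ∀ {d i a σ} → length (lookup σ i) < S →
         Exec S body d (push i a) σ (σ [ i ]≔ (a ∷ lookup σ i))
  pop  : ∀ {d i a s σ} → lookup σ i ≡ a ∷ s → Exec S body d (pop i) σ (σ [ i ]≔ s)
  _⨾_  : ∀ {d c c′ σ σ′ σ″} → Exec S body d c σ σ′ → Exec S body d c′ σ′ σ″ →
         Exec S body d (c ⨾ c′) σ σ″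
  ifT  : ∀ {d i f c c′ σ σ′} → f (top (lookup σ i)) ≡ true → Exec S body d c σ σ′ →
         Exec S body d (branch i f c c′) σ σ′
  ifF  : ∀ {d i f c c′ σ σ′} → f (top (lookup σ i)) ≡ false → Exec S body d c′ σ σ′ →
         Exec S body d (branch i f c c′) σ σ′
  more : ∀ {d i f c σ σ′ σ″} → f (top (lookup σ i)) ≡ true → Exec S body d c σ σ′ →
         Exec S body d (while i f c) σ′ σ″ → Exec S body d (while i f c) σ σ″
  done : ∀ {d i f c σ} → f (top (lookup σ i)) ≡ false → Exec S body d (while i f c) σ σ

-- The program counters inside a command. A machine step writes before it moves, so `push` and
-- `call` take two positions: one to go to the cell on the left, one to fill it. The extra position
-- of `branch` and `while` is the test.
Pos : ∀ {k} → Cmd k → Set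
Pos skip             = ⊤
Pos call             = Bool
Pos (push _ _)       = Bool
Pos (pop _)          = ⊤
Pos (c ⨾ c′)         = Pos c ⊎ Pos c′
Pos (branch _ _ c c′) = ⊤ ⊎ (Pos c ⊎ Pos c′)
Pos (while _ _ c)    = ⊤ ⊎ Pos c

first : ∀ {k} (c : Cmd k) → Pos c
first skip             = tt
first call             = false
first (push _ _)       = false
first (pop _)          = tt
first (c ⨾ _)          = inj₁ (first c)
first (branch _ _ _ _) = inj₁ tt
first (while _ _ _)    = inj₁ tt

finite-⊤ : Finite ⊤
finite-⊤ = 1 , mk↔ₛ′ (λ _ → zero) (λ _ → tt) (λ { zero → refl }) (λ _ → refl)

finite-Bool : Finite Bool
finite-Bool = 2 , mk↔ₛ′ (λ { false → zero ; true → suc zero })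
                        (λ { zero → false ; (suc zero) → true })
                        (λ { zero → refl ; (suc zero) → refl })
                        (λ { false → refl ; true → refl })

finite-⊎ : {A B : Set} → Finite A → Finite B → Finite (A ⊎ B)
finite-⊎ {A} {B} (m , f) (n , g) = m + n , mk↔ₛ′ to from to∘from from∘to
  where
  module f = Inverse f
  module g = Inverse g
  to : A ⊎ B → Fin (m + n)
  to (inj₁ a) = join m n (inj₁ (f.to a))
  to (inj₂ b) = join m n (inj₂ (g.to b))
  from′ : Fin m ⊎ Fin n → A ⊎ B
  from′ (inj₁ i) = inj₁ (f.from i)
  from′ (inj₂ j) = inj₂ (g.from j)
  from : Fin (m + n) → A ⊎ B
  from i = from′ (splitAt m i)
  to-from′ : ∀ s → to (from′ s) ≡ join m n s
  to-from′ (inj₁ i) = cong (join m n ∘ inj₁) (f.strictlyInverseˡ i)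
  to-from′ (inj₂ j) = cong (join m n ∘ inj₂) (g.strictlyInverseˡ j)
  to∘from : ∀ i → to (from i) ≡ i
  to∘from i = trans (to-from′ (splitAt m i)) (F.join-splitAt m n i)
  from∘to : ∀ x → from (to x) ≡ x
  from∘to (inj₁ a) = trans (cong from′ (F.splitAt-join m n (inj₁ (f.to a))))
                           (cong inj₁ (f.strictlyInverseʳ a))
  from∘to (inj₂ b) = trans (cong from′ (F.splitAt-join m n (inj₂ (g.to b))))
                           (cong inj₂ (g.strictlyInverseʳ b))

finite-Maybe : {A : Set} → Finite A → Finite (Maybe A)
finite-Maybe (n , f) = suc n , mk↔ₛ′
  (λ { nothing → zero ; (just a) → suc (f.to a) })
  (λ { zero → nothing ; (suc i) → just (f.from i) })
  (λ { zero → refl ; (suc i) → cong suc (f.strictlyInverseˡ i) })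
  (λ { nothing → refl ; (just a) → cong just (f.strictlyInverseʳ a) })
  where module f = Inverse f

finite-Pos : ∀ {k} (c : Cmd k) → Finite (Pos c)
finite-Pos skip              = finite-⊤
finite-Pos call              = finite-Bool
finite-Pos (push _ _)        = finite-Bool
finite-Pos (pop _)           = finite-⊤
finite-Pos (c ⨾ c′)          = finite-⊎ (finite-Pos c) (finite-Pos c′)
finite-Pos (branch _ _ c c′) = finite-⊎ finite-⊤ (finite-⊎ (finite-Pos c) (finite-Pos c′))
finite-Pos (while _ _ c)     = finite-⊎ finite-⊤ (finite-Pos c)

-- Translation of stack programs into Turing machines

module Compile {k : ℕ} (main body : Cmd (suc k)) (answer : Fin (suc k)) (isYes : Maybe Sym → Bool) where

  -- The last component holds the return state, the state that reads off the
  -- answer, and the two halting states.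
  State′ : Set
  State′ = (Pos main ⊎ Pos body) ⊎ (Bool ⊎ Bool)

  pattern atMain p = inj₁ (inj₁ p)
  pattern atBody p = inj₁ (inj₂ p)
  pattern return   = inj₂ (inj₁ false)
  pattern finish   = inj₂ (inj₁ true)
  pattern halt b   = inj₂ (inj₂ b)

  Symbol′ : Set
  Symbol′ = Maybe (Sym ⊎ State′)

  tapes′ : ℕ
  tapes′ = suc (suc k)

  -- Tape 1 holds the return addresses; the input has to be on tape 0.
  control : Fin tapes′
  control = suc zero

  emb : Fin (suc k) → Fin tapes′
  emb = punchIn control

  Action : Set
  Action = State′ × Vec (Symbol′ × Direction) tapes′

  keep : Vec Symbol′ tapes′ → Vec (Symbol′ × Direction) tapes′
  keep = Vec.map (λ h → h , stay)

  dat : Sym → Symbol′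
  dat a = just (inj₁ a)

  adr : State′ → Symbol′
  adr q = just (inj₂ q)

  read : Symbol′ → Maybe Sym
  read (just (inj₁ a)) = just a
  read _               = nothing

  -- `inj` places the positions of this occurrence of the command among the states, and `ex` is the
  -- state entered when the command is finished. Passing the exit down replaces jump labels; the
  -- exit of a loop body is the test of the loop.
  step : (c : Cmd (suc k)) → (Pos c → State′) → State′ → Pos c → Vec Symbol′ tapes′ → Action
  step skip       _   ex _     hs = ex , keep hs
  step call       inj ex false hs = inj true , keep hs [ control ]≔ (lookup hs control , left)
  step call       inj ex true  hs = atBody (first body) , keep hs [ control ]≔ (adr ex , stay)
  step (push i a) inj ex false hs = inj true , keep hs [ emb i ]≔ (lookup hs (emb i) , left)
  step (push i a) inj ex true  hs = ex , keep hs [ emb i ]≔ (dat a , stay)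
  step (pop i)    inj ex _     hs = ex , keep hs [ emb i ]≔ (nothing , right)
  step (c ⨾ c′) inj ex (inj₁ p) hs = step c (inj ∘ inj₁) (inj (inj₂ (first c′))) p hs
  step (c ⨾ c′) inj ex (inj₂ p) hs = step c′ (inj ∘ inj₂) ex p hs
  step (branch i f c c′) inj ex (inj₁ _) hs =
    inj (inj₂ (if f (read (lookup hs (emb i))) then inj₁ (first c) else inj₂ (first c′))) , keep hs
  step (branch i f c c′) inj ex (inj₂ (inj₁ p)) hs = step c (inj ∘ inj₂ ∘ inj₁) ex p hs
  step (branch i f c c′) inj ex (inj₂ (inj₂ p)) hs = step c′ (inj ∘ inj₂ ∘ inj₂) ex p hs
  step (while i f c) inj ex (inj₁ _) hs =
    (if f (read (lookup hs (emb i))) then inj (inj₂ (first c)) else ex) , keep hs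
  step (while i f c) inj ex (inj₂ p) hs = step c (inj ∘ inj₂) (inj (inj₁ tt)) p hs

  goBack : Symbol′ → Vec Symbol′ tapes′ → Maybe Action
  goBack (just (inj₂ q)) hs = just (q , keep hs [ control ]≔ (nothing , right))
  goBack _               hs = nothing

  δ′ : State′ → Vec Symbol′ tapes′ → Maybe Action
  δ′ (atMain p) hs = just (step main (λ p → atMain p) finish p hs)
  δ′ (atBody p) hs = just (step body (λ p → atBody p) return p hs)
  δ′ return     hs = goBack (lookup hs control) hs
  δ′ finish     hs = just (halt (isYes (read (lookup hs (emb answer)))) , keep hs)
  δ′ (halt _)   hs = nothing

  accepting′ : State′ → Bool
  accepting′ (halt b) = b
  accepting′ _        = false

  machine : TuringMachine
  machine = record
    { extraTapes    = suc k
    ; State         = State′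
    ; State-finite  = finite-⊎ (finite-⊎ (finite-Pos main) (finite-Pos body)) (finite-⊎ finite-Bool finite-Bool)
    ; Symbol        = Symbol′
    ; Symbol-finite = finite-Maybe (finite-⊎ (finite-Maybe finite-Bool)
        (finite-⊎ (finite-⊎ (finite-Pos main) (finite-Pos body)) (finite-⊎ finite-Bool finite-Bool)))
    ; blank         = nothing
    ; bit           = λ b → dat (just b)
    ; bit-injective = λ { refl → refl }
    ; bit≢blank     = λ _ ()
    ; start         = atMain (first main)
    ; accepting     = accepting′
    ; δ             = δ′
    }

  open Run machine hiding (initial) renaming (Config to Cfg)
  open Run machine using (initial)

  -- Reading off a stack top first yields the tape from the head onwards;
  -- popping the last symbol leaves a blank after it.
  Rep : ℕ → List Symbol′ → Tape Symbol′ → Set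
  Rep S s (tape xs h ys) =
    length xs + length s ≤ S × (h ∷ ys ≡ s ⊎ h ∷ ys ≡ s ++ nothing ∷ [])

  Rep-cells : ∀ {S s} t → Rep S s t → cells t ≤ suc S
  Rep-cells {S} {s} (tape xs h ys) (p , inj₁ refl) = m≤n⇒m≤1+n p
  Rep-cells {S} {s} (tape xs h ys) (p , inj₂ e) = begin
    length xs + length (h ∷ ys)  ≡⟨ cong (λ l → length xs + length l) e ⟩
    length xs + length (s ++ nothing ∷ []) ≡⟨ cong (length xs +_) (trans (length-++ s) (+-comm (length s) 1)) ⟩
    length xs + suc (length s) ≡⟨ +-suc (length xs) (length s) ⟩
    suc (length xs + length s) ≤⟨ s≤s p ⟩
    suc S ∎
    where open ≤-Reasoning

  -- Between the two steps of a push the head is on a stray cell and the tape need not represent a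
  -- stack, so its size is bounded separately.
  Rep-left-cells : ∀ {S s} t → Rep S s t → length s < S → cells (move nothing left t) ≤ suc S
  Rep-left-cells {S} {s} (tape [] h ys) (_ , inj₁ refl) lt = m≤n⇒m≤1+n lt
  Rep-left-cells {S} {s} (tape [] h ys) (_ , inj₂ e) lt = begin
    suc (length (h ∷ ys)) ≡⟨ cong (suc ∘ length) e ⟩
    suc (length (s ++ nothing ∷ [])) ≡⟨ cong suc (trans (length-++ s) (+-comm (length s) 1)) ⟩
    suc (suc (length s)) ≤⟨ s≤s lt ⟩
    suc S ∎
    where open ≤-Reasoning
  Rep-left-cells {S} {s} t@(tape (z ∷ xs) h ys) r lt =
    ≤-trans (≤-reflexive (+-suc (length xs) (suc (length ys)))) (Rep-cells {S} {s} t r)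

  -- As long as there are cells to the left of the head, a push reuses one of them and leaves
  -- `length xs + length s` unchanged. A new cell is created only when there are none, and then the
  -- height of the stack alone counts.
  Rep-push : ∀ {S s} a t → Rep S s t → length s < S →
             Rep S (a ∷ s) (write a (move nothing left t))
  Rep-push {s = s} a (tape [] h ys) (_ , inj₁ e) lt = lt , inj₁ (cong (a ∷_) e)
  Rep-push {s = s} a (tape [] h ys) (_ , inj₂ e) lt = lt , inj₂ (cong (a ∷_) e)
  Rep-push {s = s} a (tape (z ∷ xs) h ys) (p , e) lt =
    ≤-trans (≤-reflexive (+-suc (length xs) (length s))) p ,
    Sum.map (cong (a ∷_)) (cong (a ∷_)) e

  Rep-pop : ∀ {S s} a t → Rep S (a ∷ s) t → Rep S s (move nothing right (write nothing t))
  Rep-pop {s = s} a (tape xs h []) (p , inj₁ refl) = ≤-trans (≤-reflexive (sym (+-suc (length xs) 0))) p , inj₂ refl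
  Rep-pop {s = []} a (tape xs h []) (p , inj₂ ())
  Rep-pop {s = _ ∷ _} a (tape xs h []) (p , inj₂ ())
  Rep-pop {s = s} a (tape xs h (y ∷ ys)) (p , e) =
    ≤-trans (≤-reflexive (sym (+-suc (length xs) (length s)))) p ,
    Sum.map ∷-injectiveʳ ∷-injectiveʳ e

  Rep-read : ∀ {S} s t → Rep S (map dat s) t → read (head t) ≡ top s
  Rep-read []      (tape xs h ys) (_ , inj₁ ())
  Rep-read []      (tape xs h ys) (_ , inj₂ refl) = refl
  Rep-read (a ∷ s) (tape xs h ys) (_ , inj₁ refl) = refl
  Rep-read (a ∷ s) (tape xs h ys) (_ , inj₂ refl) = refl

  Rep-adr : ∀ {S} q s t → Rep S (adr q ∷ s) t → head t ≡ adr q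
  Rep-adr q s (tape xs h ys) (_ , inj₁ refl) = refl
  Rep-adr q s (tape xs h ys) (_ , inj₂ refl) = refl

  Tapes : Set
  Tapes = Vec (Tape Symbol′) tapes′

  heads : Tapes → Vec Symbol′ tapes′
  heads = Vec.map head

  after : Vec (Symbol′ × Direction) tapes′ → Tapes → Tapes
  after = Vec.zipWith act

  keep-same : ∀ ts l → lookup (after (keep (heads ts)) ts) l ≡ lookup ts l
  keep-same ts l
    rewrite V.lookup-zipWith act l (keep (heads ts)) ts
          | V.lookup-map l (λ h → h , stay) (heads ts)
          | V.lookup-map l head ts = refl

  upd-same : ∀ ts j {x d} → lookup (after (keep (heads ts) [ j ]≔ (x , d)) ts) j ≡ act (x , d) (lookup ts j)
  upd-same ts j {x} {d}
    rewrite V.lookup-zipWith act j (keep (heads ts) [ j ]≔ (x , d)) ts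
          | V.lookup∘update j (keep (heads ts)) (x , d) = refl

  upd-other : ∀ ts j {x d} l → l ≢ j → lookup (after (keep (heads ts) [ j ]≔ (x , d)) ts) l ≡ lookup ts l
  upd-other ts j {x} {d} l l≢j
    rewrite V.lookup-zipWith act l (keep (heads ts) [ j ]≔ (x , d)) ts
          | V.lookup∘update′ l≢j (keep (heads ts)) (x , d)
          | V.lookup-map l (λ h → h , stay) (heads ts)
          | V.lookup-map l head ts = refl

  emb≢control : ∀ i → emb i ≢ control
  emb≢control i = F.punchInᵢ≢i control i

  emb-injective : ∀ {i j} → i ≢ j → emb i ≢ emb j
  emb-injective i≢j e = i≢j (F.punchIn-injective control _ _ e)

  -- Simulation within bounded space

  module Bounded (S : ℕ) where

    space-bound : ℕ
    space-bound = tapes′ * suc S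

    sum-≤ : ∀ {n} (ts : Vec (Tape Symbol′) n) → (∀ l → cells (lookup ts l) ≤ suc S) →
            Vec.sum (Vec.map cells ts) ≤ n * suc S
    sum-≤ Vec.[]       h = z≤n
    sum-≤ (t Vec.∷ ts) h = +-mono-≤ (h zero) (sum-≤ ts (h ∘ suc))

    -- The bound on the source is part of a step, so that a `Path` bounds every configuration on it
    -- except the last.
    Step : Cfg → Cfg → Set
    Step c c′ = space c ≤ space-bound × c ⊢ c′

    record Inv (σ : Stacks (suc k)) (κ : List State′) (ts : Tapes) : Set where
      constructor inv
      field
        onData    : ∀ i → Rep S (map dat (lookup σ i)) (lookup ts (emb i))
        onControl : Rep S (map adr κ) (lookup ts control)
    open Inv

    allCells : ∀ {σ κ ts} → Inv σ κ ts → ∀ l → cells (lookup ts l) ≤ suc S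
    allCells {ts = ts} I zero = Rep-cells (lookup ts zero) (onData I zero)
    allCells {κ = κ} {ts} I (suc zero) = Rep-cells {s = map adr κ} (lookup ts (suc zero)) (onControl I)
    allCells {ts = ts} I (suc (suc l)) = Rep-cells (lookup ts (suc (suc l))) (onData I (suc l))

    one : ∀ q {q′ σ κ ts as} → Inv σ κ ts → δ′ q (heads ts) ≡ just (q′ , as) →
          Step (config q ts) (config q′ (after as ts))
    one q {ts = ts} I e rewrite e = sum-≤ ts (allCells I) , cong _ e

    Path : Cfg → Cfg → Set
    Path = Star Step

    left-space : ∀ {σ κ ts j} → Inv σ κ ts → cells (move nothing left (lookup ts j)) ≤ suc S →
                 ∀ l → cells (lookup (after (keep (heads ts) [ j ]≔ (lookup (heads ts) j , left)) ts) l) ≤ suc S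
    left-space {ts = ts} {j} I h l with l F.≟ j
    ... | yes refl rewrite upd-same ts j {lookup (heads ts) j} {left} | V.lookup-map j head ts = h
    ... | no l≢j rewrite upd-other ts j {lookup (heads ts) j} {left} l l≢j = allCells I l

    Changed : Fin tapes′ → List Symbol′ → Tapes → Tapes → Set
    Changed j s ts ts′ = Rep S s (lookup ts′ j) × (∀ l → l ≢ j → lookup ts′ l ≡ lookup ts l)

    pushSteps : ∀ {σ κ ts j s x q q₁ q₂} → Inv σ κ ts → Rep S s (lookup ts j) → length s < S →
                (∀ hs → δ′ q hs ≡ just (q₁ , keep hs [ j ]≔ (lookup hs j , left))) →
                (∀ hs → δ′ q₁ hs ≡ just (q₂ , keep hs [ j ]≔ (x , stay))) →
                ∃[ ts′ ] (Path (config q ts) (config q₂ ts′) × Changed j (x ∷ s) ts ts′)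
    pushSteps {ts = ts} {j} {s} {x} {q} {q₁} {q₂} I r lt e₁ e₂ =
      ts₂ , one q I (e₁ _) ◅ (sum-≤ ts₁ (left-space I (Rep-left-cells (lookup ts j) r lt)) , next₁) ◅ ε , pushed , other
      where
      ts₁ = after (keep (heads ts) [ j ]≔ (lookup (heads ts) j , left)) ts
      ts₂ = after (keep (heads ts₁) [ j ]≔ (x , stay)) ts₁
      next₁ : config q₁ ts₁ ⊢ config q₂ ts₂
      next₁ rewrite e₂ (heads ts₁) = refl
      pushed : Rep S (x ∷ s) (lookup ts₂ j)
      pushed rewrite upd-same ts₁ j {x} {stay} | upd-same ts j {lookup (heads ts) j} {left}
                   | V.lookup-map j head ts = Rep-push x (lookup ts j) r lt
      other : ∀ l → l ≢ j → lookup ts₂ l ≡ lookup ts l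
      other l l≢j = trans (upd-other ts₁ j l l≢j) (upd-other ts j l l≢j)

    popChange : ∀ ts j {s x} → Rep S (x ∷ s) (lookup ts j) →
                Changed j s ts (after (keep (heads ts) [ j ]≔ (nothing , right)) ts)
    popChange ts j {s} {x} r = popped , λ l → upd-other ts j l
      where
      popped : Rep S s (lookup (after (keep (heads ts) [ j ]≔ (nothing , right)) ts) j)
      popped rewrite upd-same ts j {nothing} {right} = Rep-pop x (lookup ts j) r

    keep-inv : ∀ {σ κ ts} → Inv σ κ ts → Inv σ κ (after (keep (heads ts)) ts)
    keep-inv {ts = ts} (inv D C) = inv
      (λ i → subst (Rep S _) (sym (keep-same ts (emb i))) (D i))
      (subst (Rep S _) (sym (keep-same ts control)) C)

    data-inv : ∀ {σ κ ts ts′ i s} → Inv σ κ ts → Changed (emb i) (map dat s) ts ts′ → Inv (σ [ i ]≔ s) κ ts′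
    data-inv {σ} {κ} {ts} {ts′} {i} {s} (inv D C) (r , o) =
      inv D′ (subst (Rep S _) (sym (o control (λ e → emb≢control i (sym e)))) C)
      where
      D′ : ∀ l → Rep S (map dat (lookup (σ [ i ]≔ s) l)) (lookup ts′ (emb l))
      D′ l with l F.≟ i
      ... | yes refl rewrite V.lookup∘update i σ s = r
      ... | no l≢i rewrite V.lookup∘update′ l≢i σ s | o (emb l) (emb-injective l≢i) = D l

    control-inv : ∀ {σ κ κ′ ts ts′} → Inv σ κ ts → Changed control (map adr κ′) ts ts′ → Inv σ κ′ ts′
    control-inv (inv D C) (r , o) = inv (λ l → subst (Rep S _) (sym (o (emb l) (emb≢control l))) (D l)) r

    read-top : ∀ {σ κ ts} → Inv σ κ ts → ∀ i → read (lookup (heads ts) (emb i)) ≡ top (lookup σ i)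
    read-top {σ} {ts = ts} I i rewrite V.lookup-map (emb i) head ts = Rep-read (lookup σ i) (lookup ts (emb i)) (onData I i)

    -- The hypothesis on `inj` only asks that the machine act as `step` at the positions of this
    -- occurrence, so the statement applies to all subcommands and to the procedure body alike. A
    -- call moves one unit from `d` to the control stack `κ`: the body runs with exit `return`, and
    -- `ex` waits on that stack.
    simulate : ∀ {d c σ σ′} → Exec S body d c σ σ′ →
               (inj : Pos c → State′) (ex : State′) → (∀ p hs → δ′ (inj p) hs ≡ just (step c inj ex p hs)) →
               ∀ κ ts → length κ + d ≤ S → Inv σ κ ts →
               ∃[ ts′ ] (Path (config (inj (first c)) ts) (config ex ts′) × Inv σ′ κ ts′)
    simulate skip inj ex e κ ts b I = _ , one (inj tt) I (e tt (heads ts)) ◅ ε , keep-inv I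
    simulate (call {d} r) inj ex e κ ts b I
      with b′ ← ≤-trans (≤-reflexive (sym (+-suc (length κ) d))) b
      with ts₁ , p₁ , ch ← pushSteps I (Inv.onControl I)
             (≤-trans (s≤s (≤-trans (≤-reflexive (length-map adr κ)) (m≤m+n (length κ) d))) b′)
             (e false) (e true)
      with ts₂ , p₂ , I₂ ← simulate r (λ p → atBody p) return (λ _ _ → refl) (ex ∷ κ) ts₁ b′
             (control-inv {κ′ = ex ∷ κ} I ch)
      = _ , p₁ ◅◅ p₂ ◅◅ one return I₂ back ◅ ε , control-inv {κ′ = κ} I₂ (popChange ts₂ control {x = adr ex} (Inv.onControl I₂))
      where
      back : δ′ return (heads ts₂) ≡ just (ex , keep (heads ts₂) [ control ]≔ (nothing , right))
      back rewrite V.lookup-map control head ts₂ | Rep-adr ex (map adr κ) (lookup ts₂ control) (Inv.onControl I₂) = refl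
    simulate (push {i = i} {a} {σ} lt) inj ex e κ ts b I
      with ts₁ , p₁ , ch ← pushSteps I (Inv.onData I i)
             (≤-trans (s≤s (≤-reflexive (length-map dat (lookup σ i)))) lt) (e false) (e true)
      = ts₁ , p₁ , data-inv {s = a ∷ lookup σ i} I ch
    simulate (pop {i = i} {a} {s} {σ} eq) inj ex e κ ts b I =
      _ , one (inj tt) I (e tt (heads ts)) ◅ ε ,
      data-inv {s = s} I (popChange ts (emb i) {x = dat a} (subst (λ s → Rep S (map dat s) (lookup ts (emb i))) eq (Inv.onData I i)))
    simulate (r ⨾ r′) inj ex e κ ts b I
      with ts₁ , p₁ , I₁ ← simulate r _ _ (e ∘ inj₁) κ ts b I
      with ts₂ , p₂ , I₂ ← simulate r′ _ _ (e ∘ inj₂) κ ts₁ b I₁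
      = ts₂ , p₁ ◅◅ p₂ , I₂
    simulate (ifT {i = i} {f} {c} {c′} t r) inj ex e κ ts b I
      with ts₁ , p₁ , I₁ ← simulate r _ _ (e ∘ inj₂ ∘ inj₁) κ _ b (keep-inv I)
      = ts₁ , one (inj (inj₁ tt)) I (trans (e (inj₁ tt) _) (cong (λ x → just (inj (inj₂ (if x then inj₁ (first c) else inj₂ (first c′))) , keep (heads ts)))
                 (trans (cong f (read-top I i)) t))) ◅ p₁ , I₁
    simulate (ifF {i = i} {f} {c} {c′} t r) inj ex e κ ts b I
      with ts₁ , p₁ , I₁ ← simulate r _ _ (e ∘ inj₂ ∘ inj₂) κ _ b (keep-inv I)
      = ts₁ , one (inj (inj₁ tt)) I (trans (e (inj₁ tt) _) (cong (λ x → just (inj (inj₂ (if x then inj₁ (first c) else inj₂ (first c′))) , keep (heads ts)))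
                 (trans (cong f (read-top I i)) t))) ◅ p₁ , I₁
    simulate (more {i = i} {f} {c} t r r′) inj ex e κ ts b I
      with ts₁ , p₁ , I₁ ← simulate r _ _ (e ∘ inj₂) κ _ b (keep-inv I)
      with ts₂ , p₂ , I₂ ← simulate r′ inj ex e κ ts₁ b I₁
      = ts₂ , one (inj (inj₁ tt)) I (trans (e (inj₁ tt) _) (cong (λ x → just ((if x then inj (inj₂ (first c)) else ex) , keep (heads ts)))
                 (trans (cong f (read-top I i)) t))) ◅ p₁ ◅◅ p₂ , I₂
    simulate (done {i = i} {f} {c} t) inj ex e κ ts b I =
      _ , one (inj (inj₁ tt)) I (trans (e (inj₁ tt) _) (cong (λ x → just ((if x then inj (inj₂ (first c)) else ex) , keep (heads ts)))
                 (trans (cong f (read-top I i)) t))) ◅ ε , keep-inv I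

    -- Determinism: whatever is reachable lies on the path to the halting configuration.
    confined : ∀ {c h c′} → Path c h → Halted h → space h ≤ space-bound → c ⊢* c′ → space c′ ≤ space-bound
    confined ε h b ε = b
    confined ε h b (s ◅ _) = contradiction (trans (sym h) s) λ ()
    confined ((b′ , _) ◅ _) h b ε = b′
    confined ((_ , s) ◅ p) h b (s′ ◅ p′) with refl ← just-injective (trans (sym s) s′) = confined p h b p′

    forget : ∀ {c h} → Path c h → c ⊢* h
    forget ε = ε
    forget ((_ , s) ◅ p) = s ◅ forget p

  halted-unique : ∀ {c h h′} → c ⊢* h → Halted h → c ⊢* h′ → Halted h′ → h ≡ h′
  halted-unique ε h ε h′ = refl
  halted-unique ε h (s ◅ _) h′ = contradiction (trans (sym h) s) λ ()
  halted-unique (s ◅ _) h ε h′ = contradiction (trans (sym h′) s) λ ()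
  halted-unique (s ◅ p) h (s′ ◅ p′) h′ with refl ← just-injective (trans (sym s) s′) = halted-unique p h p′ h′

  module _ {L : Language} (S : List Bool → ℕ)
           (run : ∀ w → ∃[ d ] ∃[ σ ] (d ≤ S w × length w ≤ S w × Exec (S w) body d main (map just w Vec.∷ Vec.replicate k []) σ
                        × (w ∈ L ⇔ T (isYes (top (lookup σ answer))))))
           where

    open Bounded

    start-inv : ∀ w → length w ≤ S w →
                Inv (S w) (map just w Vec.∷ Vec.replicate k []) [] (Cfg.contents (initial w))
    start-inv w w≤ = inv onTape (z≤n , inj₂ refl)
      where
      onInput : ∀ v → length v ≤ S w →
                Rep (S w) (map dat (map just v)) (load nothing (map (λ b → dat (just b)) v))
      onInput []      _  = z≤n , inj₂ refl
      onInput (b ∷ v) v≤ =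
        ≤-trans (≤-reflexive (trans (length-map dat (map just (b ∷ v))) (length-map just (b ∷ v)))) v≤ ,
        inj₁ (cong (dat (just b) ∷_) (map-∘ v))
      onTape : ∀ i → Rep (S w) (map dat (lookup (map just w Vec.∷ Vec.replicate k []) i))
                       (lookup (Cfg.contents (initial w)) (emb i))
      onTape zero = onInput w w≤
      onTape (suc i) rewrite V.lookup-replicate i (List Sym ∋ []) | V.lookup-replicate i (tape {Symbol′} [] nothing []) =
        z≤n , inj₂ refl

    outcome : ∀ w → ∃[ b ] ∃[ ts ] (Path (S w) (initial w) (config (halt b) ts)
                × space (config (halt b) ts) ≤ space-bound (S w) × (w ∈ L ⇔ T b))
    outcome w
      with d , σ , d≤ , w≤ , r , iff ← run w
      with ts , p , I ← simulate (S w) r (λ p → atMain p) finish (λ _ _ → refl) [] _ d≤ (start-inv w w≤)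
      = isYes (top (lookup σ answer)) , after (keep (heads ts)) ts ,
        p ◅◅ one (S w) finish I (cong (λ x → just (halt (isYes x) , keep (heads ts))) (read-top (S w) I answer)) ◅ ε ,
        sum-≤ (S w) (after (keep (heads ts)) ts) (allCells (S w) (keep-inv (S w) I)) , iff

    decides : (poly : List ℕ) → (∀ w → evalPoly poly (length w) ≡ space-bound (S w)) → DecidesInPolySpace machine L
    decides poly eq = record
      { halts   = λ w → let b , ts , p , _ , _ = outcome w in config (halt b) ts , forget (S w) p , refl
      ; correct = λ w → let b , ts , p , _ , iff = outcome w in mk⇔
          (λ w∈L → config (halt b) ts , forget (S w) p , refl , Equivalence.to iff w∈L)
          (λ (h , p′ , hh , acc) → Equivalence.from iff
             (subst (λ h → T (accepting′ (Cfg.state h))) (halted-unique p′ hh (forget (S w) p) refl) acc))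
      ; poly    = poly
      ; bounded = λ w c p′ → let b , ts , p , sp , _ = outcome w in
          ≤-trans (confined (S w) p refl sp p′) (≤-reflexive (sym (eq w)))
      }

-- Words on the stacks

Word : Set
Word = List Bool

-- Words are read in bijective base two, least significant digit first, false
-- being the digit 1 and true the digit 2; thus every word is a number.
incW : Word → Word
incW []          = false ∷ []
incW (false ∷ w) = true ∷ w
incW (true ∷ w)  = false ∷ incW w

decW : Word → Word
decW []              = []
decW (true ∷ w)      = false ∷ w
decW (false ∷ [])    = []
decW (false ∷ b ∷ w) = true ∷ decW (b ∷ w)

tailW : Word → Word
tailW []      = []
tailW (_ ∷ w) = w

-- The stack symbol `nothing` is the separator closing each word. It differs from the blank, which
-- is the `nothing` of `Symbol′`.
enc : List Word → List Sym
enc []       = []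
enc (w ∷ ws) = map just w ++ nothing ∷ enc ws

-- A separator on top means that the topmost word is empty; an empty stack is treated in the same
-- way.
onBit : (Maybe Bool → Bool) → Maybe Sym → Bool
onBit f (just a) = f a
onBit f nothing  = f nothing

some one one⁻ : Maybe Bool → Bool
some (just _)    = true
some nothing     = false
one (just b)     = b
one nothing      = false
one⁻ (just true) = false
one⁻ (just false) = true
one⁻ nothing     = false

isBit isOne isZero : Maybe Sym → Bool
isBit = onBit some
isOne = onBit one
isZero = onBit one⁻

pattern aux = zero
pattern stk = suc zero
pattern tmp = suc (suc zero)

moveBits mv : Fin 3 → Fin 3 → Cmd 3
moveBits X Y = while X isBit (branch X isOne (pop X ⨾ push Y (just true)) (pop X ⨾ push Y (just false)))
mv X Y = push Y nothing ⨾ moveBits X Y ⨾ pop X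

copyBits cpy drop′ incScan incC decScan decC tailC : Cmd 3
copyBits = while stk isBit (branch stk isOne (pop stk ⨾ push aux (just true) ⨾ push tmp (just true))
                                         (pop stk ⨾ push aux (just false) ⨾ push tmp (just false)))
cpy = push aux nothing ⨾ push tmp nothing ⨾ copyBits ⨾ moveBits aux stk ⨾ pop aux
drop′ = while stk isBit (pop stk) ⨾ pop stk
incScan = while stk isOne (pop stk ⨾ push aux (just false))
  ⨾ branch stk isBit (pop stk ⨾ push stk (just true)) (push stk (just false))
incC = push aux nothing ⨾ incScan ⨾ moveBits aux stk ⨾ pop aux
decScan = while stk isZero (pop stk ⨾ push aux (just true))
  -- When the borrow has passed the last digit, the leading 1 disappears and the 2 just written in
  -- its place is removed. A separator on top of `aux` means that the word was empty from the
  -- beginning.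
  ⨾ branch stk isOne (pop stk ⨾ push stk (just false)) (branch aux isBit (pop aux) skip)
decC = push aux nothing ⨾ decScan ⨾ moveBits aux stk ⨾ pop aux
tailC = branch stk isBit (pop stk) skip

toR toA : ℕ → Cmd 3
toR zero    = skip
toR (suc m) = mv stk aux ⨾ toR m
toA zero    = skip
toA (suc m) = toA m ⨾ mv aux stk

drops : ℕ → Cmd 3
drops zero    = skip
drops (suc m) = drop′ ⨾ drops m

pick : ℕ → Cmd 3
pick i = toR i ⨾ cpy ⨾ toA i ⨾ mv tmp stk

-- Removes the m words below the topmost k words.
squash : ℕ → ℕ → Cmd 3
squash k m = toR k ⨾ drops m ⨾ toA k

st : List Word → List Word → List Word → Stacks 3
st As Rs Cs = enc Rs ∷ enc As ∷ enc Cs ∷ []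

top-enc : ∀ f w ws → onBit f (top (enc (w ∷ ws))) ≡ f (top w)
top-enc f []      ws = refl
top-enc f (b ∷ w) ws = refl

enc-ʳ++ : ∀ w ws → map just w ʳ++ nothing ∷ enc ws ≡ enc (reverse w ∷ ws)
enc-ʳ++ w ws = go w []
  where
  go : ∀ w v → map just w ʳ++ (map just v ++ nothing ∷ enc ws) ≡ enc ((w ʳ++ v) ∷ ws)
  go []      v = refl
  go (b ∷ w) v = go w (b ∷ v)

length-enc : ∀ w ws → length (enc (w ∷ ws)) ≡ length w + suc (length (enc ws))
length-enc w ws = trans (length-++ (map just w)) (cong (_+ suc (length (enc ws))) (length-map just w))

-- Execution of the commands on words

module Moves (S : ℕ) (body : Cmd 3) {d : ℕ} where

  infix 3 _↦_by_
  _↦_by_ : Stacks 3 → Stacks 3 → Cmd 3 → Set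
  σ ↦ σ′ by c = Exec S body d c σ σ′

  update₂ : ∀ {X Y} (σ : Stacks 3) {u v s t} → X ≢ Y →
            (((σ [ X ]≔ u) [ Y ]≔ v) [ X ]≔ s) [ Y ]≔ t ≡ (σ [ X ]≔ s) [ Y ]≔ t
  update₂ {X} {Y} σ {u} {v} {s} {t} X≢Y = begin
    (((σ [ X ]≔ u) [ Y ]≔ v) [ X ]≔ s) [ Y ]≔ t ≡⟨ cong (_[ Y ]≔ t) (V.[]≔-commutes (σ [ X ]≔ u) Y X (X≢Y ∘ sym)) ⟩
    (((σ [ X ]≔ u) [ X ]≔ s) [ Y ]≔ v) [ Y ]≔ t ≡⟨ V.[]≔-idempotent ((σ [ X ]≔ u) [ X ]≔ s) Y ⟩
    ((σ [ X ]≔ u) [ X ]≔ s) [ Y ]≔ t ≡⟨ cong (_[ Y ]≔ t) (V.[]≔-idempotent σ X) ⟩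
    (σ [ X ]≔ s) [ Y ]≔ t ∎
    where open ≡-Reasoning

  moveBits-run : ∀ {X Y} → X ≢ Y → ∀ w s σ → lookup σ X ≡ map just w ++ s → isBit (top s) ≡ false →
                 length (lookup σ Y) + length w ≤ S →
                 σ ↦ (σ [ X ]≔ s) [ Y ]≔ (map just w ʳ++ lookup σ Y) by moveBits X Y
  moveBits-run {X} {Y} X≢Y [] s σ e t _ =
    subst (λ σ′ → σ ↦ σ′ by moveBits X Y)
      (sym (trans (cong₂ (λ a b → (σ [ X ]≔ a) [ Y ]≔ b) (sym e) refl)
           (trans (cong (_[ Y ]≔ lookup σ Y) (V.[]≔-lookup σ X)) (V.[]≔-lookup σ Y))))
      (done (trans (cong (isBit ∘ top) e) t))
  moveBits-run {X} {Y} X≢Y (b ∷ w) s σ e t le =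
    subst (λ σ′ → σ ↦ σ′ by moveBits X Y)
      (trans (update₂ σ X≢Y) (cong (λ l → (σ [ X ]≔ s) [ Y ]≔ (map just w ʳ++ l)) onY))
      (more (cong (isBit ∘ top) e) (step b e) (moveBits-run X≢Y w s σ₂ onX t le′))
    where
    σ₁ = σ [ X ]≔ (map just w ++ s)
    σ₂ = σ₁ [ Y ]≔ (just b ∷ lookup σ₁ Y)
    same : lookup σ₁ Y ≡ lookup σ Y
    same = V.lookup∘update′ (X≢Y ∘ sym) σ _
    onX : lookup σ₂ X ≡ map just w ++ s
    onX = trans (V.lookup∘update′ X≢Y σ₁ _) (V.lookup∘update X σ _)
    onY : lookup σ₂ Y ≡ just b ∷ lookup σ Y
    onY = trans (V.lookup∘update Y σ₁ _) (cong (just b ∷_) same)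
    room : suc (length (lookup σ Y)) + length w ≤ S
    room = ≤-trans (≤-reflexive (sym (+-suc (length (lookup σ Y)) (length w)))) le
    le′ : length (lookup σ₂ Y) + length w ≤ S
    le′ = ≤-trans (≤-reflexive (cong (λ l → length l + length w) onY)) room
    free : length (lookup σ₁ Y) < S
    free = ≤-trans (s≤s (≤-trans (≤-reflexive (cong length same)) (m≤m+n _ (length w)))) room
    step : ∀ b′ → lookup σ X ≡ just b′ ∷ map just w ++ s →
           σ ↦ σ₁ [ Y ]≔ (just b′ ∷ lookup σ₁ Y) by branch X isOne (pop X ⨾ push Y (just true)) (pop X ⨾ push Y (just false))
    step true  e = ifT (cong (isOne ∘ top) e) (pop e ⨾ push free)
    step false e = ifF (cong (isOne ∘ top) e) (pop e ⨾ push free)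

  mvAR : ∀ {w As Rs Cs} → length (enc Rs) + suc (length w) ≤ S →
         st (w ∷ As) Rs Cs ↦ st As (reverse w ∷ Rs) Cs by mv stk aux
  mvAR {w} {As} {Rs} {Cs} le =
    push (≤-trans (s≤s (m≤m+n _ (length w))) le′) ⨾
    subst (λ r → (nothing ∷ enc Rs) ∷ enc (w ∷ As) ∷ enc Cs ∷ [] ↦ r ∷ (nothing ∷ enc As) ∷ enc Cs ∷ [] by moveBits stk aux)
      (enc-ʳ++ w Rs) (moveBits-run (λ ()) w (nothing ∷ enc As) _ refl refl le′) ⨾
    pop refl
    where le′ = ≤-trans (≤-reflexive (sym (+-suc (length (enc Rs)) (length w)))) le

  mvRA : ∀ {w As Rs Cs} → length (enc As) + suc (length w) ≤ S →
         st As (w ∷ Rs) Cs ↦ st (reverse w ∷ As) Rs Cs by mv aux stk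
  mvRA {w} {As} {Rs} {Cs} le =
    push (≤-trans (s≤s (m≤m+n _ (length w))) le′) ⨾
    subst (λ r → enc (w ∷ Rs) ∷ (nothing ∷ enc As) ∷ enc Cs ∷ [] ↦ (nothing ∷ enc Rs) ∷ r ∷ enc Cs ∷ [] by moveBits aux stk)
      (enc-ʳ++ w As) (moveBits-run (λ ()) w (nothing ∷ enc Rs) _ refl refl le′) ⨾
    pop refl
    where le′ = ≤-trans (≤-reflexive (sym (+-suc (length (enc As)) (length w)))) le

  mvRC : ∀ {w As Rs Cs} → length (enc Cs) + suc (length w) ≤ S →
         st As (w ∷ Rs) Cs ↦ st As Rs (reverse w ∷ Cs) by mv aux tmp
  mvRC {w} {As} {Rs} {Cs} le =
    push (≤-trans (s≤s (m≤m+n _ (length w))) le′) ⨾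
    subst (λ r → enc (w ∷ Rs) ∷ enc As ∷ (nothing ∷ enc Cs) ∷ [] ↦ (nothing ∷ enc Rs) ∷ enc As ∷ r ∷ [] by moveBits aux tmp)
      (enc-ʳ++ w Cs) (moveBits-run (λ ()) w (nothing ∷ enc Rs) _ refl refl le′) ⨾
    pop refl
    where le′ = ≤-trans (≤-reflexive (sym (+-suc (length (enc Cs)) (length w)))) le

  mvCA : ∀ {w As Rs Cs} → length (enc As) + suc (length w) ≤ S →
         st As Rs (w ∷ Cs) ↦ st (reverse w ∷ As) Rs Cs by mv tmp stk
  mvCA {w} {As} {Rs} {Cs} le =
    push (≤-trans (s≤s (m≤m+n _ (length w))) le′) ⨾
    subst (λ r → enc Rs ∷ (nothing ∷ enc As) ∷ enc (w ∷ Cs) ∷ [] ↦ enc Rs ∷ r ∷ (nothing ∷ enc Cs) ∷ [] by moveBits tmp stk)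
      (enc-ʳ++ w As) (moveBits-run (λ ()) w (nothing ∷ enc Cs) _ refl refl le′) ⨾
    pop refl
    where le′ = ≤-trans (≤-reflexive (sym (+-suc (length (enc As)) (length w)))) le

  copyBits-run : ∀ w {s r c} → isBit (top s) ≡ false → length r + length w ≤ S → length c + length w ≤ S →
                 r ∷ (map just w ++ s) ∷ c ∷ [] ↦ (map just w ʳ++ r) ∷ s ∷ (map just w ʳ++ c) ∷ [] by copyBits
  copyBits-run [] t _ _ = done t
  copyBits-run (b ∷ w) {s} {r} {c} t rS cS =
    more refl (step b) (copyBits-run w t rS′ cS′)
    where
    rS′ = ≤-trans (≤-reflexive (sym (+-suc (length r) (length w)))) rS
    cS′ = ≤-trans (≤-reflexive (sym (+-suc (length c) (length w)))) cS
    r< = ≤-trans (s≤s (m≤m+n (length r) (length w))) rS′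
    c< = ≤-trans (s≤s (m≤m+n (length c) (length w))) cS′
    step : ∀ b → r ∷ (map just (b ∷ w) ++ s) ∷ c ∷ [] ↦ (just b ∷ r) ∷ (map just w ++ s) ∷ (just b ∷ c) ∷ [] by
           branch stk isOne (pop stk ⨾ push aux (just true) ⨾ push tmp (just true))
                          (pop stk ⨾ push aux (just false) ⨾ push tmp (just false))
    step true  = ifT refl (pop refl ⨾ push r< ⨾ push c<)
    step false = ifF refl (pop refl ⨾ push r< ⨾ push c<)

  restore : ∀ {v As Rs Cs} → length v + suc (length (enc As)) ≤ S →
            (map just v ++ nothing ∷ enc Rs) ∷ (nothing ∷ enc As) ∷ enc Cs ∷ [] ↦ st (reverse v ∷ As) Rs Cs
              by (moveBits aux stk ⨾ pop aux)
  restore {v} {As} {Rs} {Cs} le =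
    subst (λ r → (map just v ++ nothing ∷ enc Rs) ∷ (nothing ∷ enc As) ∷ enc Cs ∷ [] ↦ (nothing ∷ enc Rs) ∷ r ∷ enc Cs ∷ [] by moveBits aux stk)
      (enc-ʳ++ v As) (moveBits-run (λ ()) v (nothing ∷ enc Rs) _ refl refl (≤-trans (≤-reflexive (+-comm (suc (length (enc As))) (length v))) le)) ⨾
    pop refl

  restore-onto : ∀ acc {u v As Rs} → acc ʳ++ u ≡ v → length v + suc (length (enc As)) ≤ S →
                 (map just acc ++ nothing ∷ enc Rs) ∷ enc (u ∷ As) ∷ [] ∷ [] ↦ st (v ∷ As) Rs [] by (moveBits aux stk ⨾ pop aux)
  restore-onto acc {u} {_} {As} {Rs} refl le =
    subst (λ a → (map just acc ++ nothing ∷ enc Rs) ∷ enc (u ∷ As) ∷ [] ∷ [] ↦ (nothing ∷ enc Rs) ∷ a ∷ [] ∷ [] by moveBits aux stk)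
      (sym (++-ʳ++ᵐ acc))
      (moveBits-run (λ ()) acc (nothing ∷ enc Rs) _ refl refl bound) ⨾
    pop refl
    where
    ++-ʳ++ᵐ : ∀ acc {u a} → map just (acc ʳ++ u) ++ a ≡ map (just {A = Bool}) acc ʳ++ (map just u ++ a)
    ++-ʳ++ᵐ []        = refl
    ++-ʳ++ᵐ (b ∷ acc) = ++-ʳ++ᵐ acc
    bound : length (enc (u ∷ As)) + length acc ≤ S
    bound = ≤-trans (≤-reflexive (begin
      length (enc (u ∷ As)) + length acc ≡⟨ cong (_+ length acc) (length-enc u As) ⟩
      length u + suc (length (enc As)) + length acc ≡⟨ lem (length u) (length acc) (suc (length (enc As))) ⟩
      length acc + length u + suc (length (enc As)) ≡⟨ cong (_+ suc (length (enc As))) (sym (length-ʳ++ acc)) ⟩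
      length (acc ʳ++ u) + suc (length (enc As)) ∎)) le
      where
      open ≡-Reasoning
      lem : ∀ u a x → u + x + a ≡ a + u + x
      lem = solve-∀

  cpy-run : ∀ {w As Rs} → length (enc Rs) + suc (length w) ≤ S → length (enc (w ∷ As)) ≤ S →
            st (w ∷ As) Rs [] ↦ st (w ∷ As) Rs (reverse w ∷ []) by cpy
  cpy-run {w} {As} {Rs} le le₂ =
    push (≤-trans (s≤s (m≤m+n _ (length w))) le′) ⨾ push (≤-trans (s≤s z≤n) c≤) ⨾
    subst₂ (λ r c → (nothing ∷ enc Rs) ∷ enc (w ∷ As) ∷ (nothing ∷ []) ∷ [] ↦ r ∷ (nothing ∷ enc As) ∷ c ∷ [] by copyBits)
      (enc-ʳ++ w Rs) (enc-ʳ++ w []) (copyBits-run w refl le′ c≤) ⨾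
    subst (λ v → enc (reverse w ∷ Rs) ∷ (nothing ∷ enc As) ∷ enc (reverse w ∷ []) ∷ [] ↦ st (v ∷ As) Rs (reverse w ∷ []) by (moveBits aux stk ⨾ pop aux))
      (reverse-involutive w) (restore {v = reverse w} {As} {Rs} {reverse w ∷ []}
        (≤-trans (≤-reflexive (trans (cong (_+ suc (length (enc As))) (length-reverse w)) (sym (length-enc w As)))) le₂))
    where
    le′ = ≤-trans (≤-reflexive (sym (+-suc (length (enc Rs)) (length w)))) le
    c≤ : suc (length w) ≤ S
    c≤ = ≤-trans (m≤n+m _ (length (enc Rs))) le

  drop-run : ∀ {w As Rs Cs} → st (w ∷ As) Rs Cs ↦ st As Rs Cs by drop′
  drop-run {w} {As} {Rs} {Cs} = go w ⨾ pop refl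
    where
    go : ∀ w → st (w ∷ As) Rs Cs ↦ enc Rs ∷ (nothing ∷ enc As) ∷ enc Cs ∷ [] by while stk isBit (pop stk)
    go []      = done refl
    go (b ∷ w) = more refl (pop refl) (go w)

  tail-run : ∀ {w As Rs Cs} → st (w ∷ As) Rs Cs ↦ st (tailW w ∷ As) Rs Cs by tailC
  tail-run {[]}    = ifF refl skip
  tail-run {_ ∷ _} = ifT refl (pop refl)

  -- Loop invariant: `acc` holds the digits already treated, in reverse order, and `acc ʳ++ incW w`
  -- is the same in every round.
  inc-scan : ∀ w acc {a r c} → length r + (length acc + length w) ≤ S → suc (length w + length a) ≤ S → isBit (top a) ≡ false →
             ∃[ acc′ ] ∃[ u ]
             (((map just acc ++ r) ∷ (map just w ++ a) ∷ c ∷ [] ↦ (map just acc′ ++ r) ∷ (map just u ++ a) ∷ c ∷ [] by incScan)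
              × acc′ ʳ++ u ≡ acc ʳ++ incW w × length acc′ ≤ length acc + length w)
  inc-scan [] acc {a} {r} {c} _ le t = acc , false ∷ [] , done (isBit⇒isOne {top a} t) ⨾ ifF t (push le) , refl , m≤m+n _ _
    where
    isBit⇒isOne : ∀ {x} → isBit x ≡ false → isOne x ≡ false
    isBit⇒isOne {nothing}      _ = refl
    isBit⇒isOne {just nothing} _ = refl
  inc-scan (false ∷ w) acc le le₂ t =
    acc , true ∷ w , done refl ⨾ ifT refl (pop refl ⨾ push (≤-trans (≤-reflexive (cong suc (trans (length-++ (map just w)) (cong (_+ _) (length-map just w))))) (≤-trans (n≤1+n _) le₂))) , refl , m≤m+n _ _
  inc-scan (true ∷ w) acc {a} {r} {c} le le₂ t
    with acc′ , u , p ⨾ q , e , l ← inc-scan w (false ∷ acc) {a} {r} {c}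
           (≤-trans (≤-reflexive (cong (length r +_) (sym (+-suc (length acc) (length w))))) le) (≤-trans (n≤1+n _) le₂) t
    = acc′ , u , more refl (pop refl ⨾ push lt) p ⨾ q , e , ≤-trans l (≤-reflexive (sym (+-suc (length acc) (length w))))
    where
    lt : length (map just acc ++ r) < S
    lt = ≤-trans (s≤s (≤-reflexive (trans (length-++ (map just acc)) (trans (cong (_+ length r) (length-map just acc)) (+-comm (length acc) (length r))))))
         (≤-trans (≤-reflexive (sym (+-suc (length r) (length acc)))) (≤-trans (+-monoʳ-≤ (length r) (≤-trans (s≤s (m≤m+n (length acc) (length w))) (≤-reflexive (sym (+-suc (length acc) (length w)))))) le))

  inc-run : ∀ {w As Rs} → suc (length (enc Rs) + length w) ≤ S → suc (length (enc (w ∷ As))) ≤ S →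
            length (incW w) + suc (length (enc As)) ≤ S →
            st (w ∷ As) Rs [] ↦ st (incW w ∷ As) Rs [] by incC
  inc-run {w} {As} {Rs} rS aS iS
    with acc , u , p , e , _ ← inc-scan w [] {nothing ∷ enc As} {nothing ∷ enc Rs} {[]} rS
           (≤-trans (≤-reflexive (cong suc (sym (length-enc w As)))) aS) refl
    = push (≤-trans (s≤s (m≤m+n _ (length w))) rS) ⨾ p ⨾ restore-onto acc {As = As} {Rs} e iS

  dec-scan : ∀ b w acc {a r c} → length r + (length acc + length (b ∷ w)) ≤ S → length (b ∷ w) + length a ≤ S →
             isBit (top a) ≡ false →
             ∃[ acc′ ] ∃[ u ]
             (((map just acc ++ r) ∷ (map just (b ∷ w) ++ a) ∷ c ∷ [] ↦ (map just acc′ ++ r) ∷ (map just u ++ a) ∷ c ∷ [] by decScan)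
              × acc′ ʳ++ u ≡ acc ʳ++ decW (b ∷ w))
  dec-scan true w acc rS aS t =
    acc , false ∷ w ,
    done refl ⨾ ifT refl (pop refl ⨾ push (≤-trans (s≤s (≤-reflexive (trans (length-++ (map just w)) (cong (_+ _) (length-map just w))))) aS)) , refl
  dec-scan false w acc {a} {r} {c} rS aS t = go w aS rS
    where
    push< : ∀ {w} → length r + (length acc + length (false ∷ w)) ≤ S → length (map just acc ++ r) < S
    push< {w} rS = ≤-trans (s≤s (≤-reflexive (trans (length-++ (map just acc)) (trans (cong (_+ length r) (length-map just acc)) (+-comm (length acc) (length r))))))
         (≤-trans (≤-reflexive (sym (+-suc (length r) (length acc)))) (≤-trans (+-monoʳ-≤ (length r) (≤-trans (s≤s (m≤m+n (length acc) (length w))) (≤-reflexive (sym (+-suc (length acc) (length w)))))) rS))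
    stops : ∀ {x} → isBit x ≡ false → isZero x ≡ false × isOne x ≡ false
    stops {nothing}      _ = refl , refl
    stops {just nothing} _ = refl , refl
    go : ∀ w → length (false ∷ w) + length a ≤ S → length r + (length acc + length (false ∷ w)) ≤ S → ∃[ acc′ ] ∃[ u ]
             (((map just acc ++ r) ∷ (map just (false ∷ w) ++ a) ∷ c ∷ [] ↦ (map just acc′ ++ r) ∷ (map just u ++ a) ∷ c ∷ [] by decScan)
              × acc′ ʳ++ u ≡ acc ʳ++ decW (false ∷ w))
    go [] aS rS = acc , [] , more refl (pop refl ⨾ push (push< {[]} rS)) (done (proj₁ (stops {top a} t)))
                  ⨾ ifF (proj₂ (stops {top a} t)) (ifT refl (pop refl)) , refl
    go (b ∷ w) aS rS
      with acc′ , u , p ⨾ q , e ← dec-scan b w (true ∷ acc) {a} {r} {c}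
           (≤-trans (≤-reflexive (cong (length r +_) (sym (+-suc (length acc) (suc (length w)))))) rS) (≤-trans (n≤1+n _) aS) t
      = acc′ , u , more refl (pop refl ⨾ push (push< {b ∷ w} rS)) p ⨾ q , e

  dec-run : ∀ {w As Rs} → suc (length (enc Rs) + length w) ≤ S → length (enc (w ∷ As)) ≤ S →
            length (decW w) + suc (length (enc As)) ≤ S →
            st (w ∷ As) Rs [] ↦ st (decW w ∷ As) Rs [] by decC
  dec-run {[]} {As} {Rs} rS aS dS =
    push (≤-trans (s≤s (m≤m+n _ 0)) rS) ⨾ (done refl ⨾ ifF refl (ifF refl skip)) ⨾ restore-onto [] {u = []} {As = As} {Rs} refl dS
  dec-run {b ∷ w} {As} {Rs} rS aS dS
    with acc , u , p , e ← dec-scan b w [] {nothing ∷ enc As} {nothing ∷ enc Rs} {[]} rS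
           (≤-trans (≤-reflexive (sym (length-enc (b ∷ w) As))) aS) refl
    = push (≤-trans (s≤s (m≤m+n _ (suc (length w)))) rS) ⨾ p ⨾ restore-onto acc {As = As} {Rs} e dS

-- First-order terms with one recursive procedure

-- Terms with n free variables and k results; p is the number of parameters
-- of the recursive procedure.  A loop runs as long as its test holds for the
-- first digit of its first component.
data Tm (p : ℕ) : ℕ → ℕ → Set where
  var    : ∀ {n} → Fin n → Tm p n 1
  nil    : ∀ {n} → Tm p n 1
  cons   : ∀ {n} → Bool → Tm p n 1 → Tm p n 1
  tl inc dec : ∀ {n} → Tm p n 1 → Tm p n 1
  caseOf : ∀ {n k} → Tm p n 1 → Tm p n k → Tm p n k → Tm p n k → Tm p n k
  _⊗_    : ∀ {n k l} → Tm p n k → Tm p n l → Tm p n (k + l)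
  bind   : ∀ {n k l} → Tm p n k → Tm p (k + n) l → Tm p n l
  loop   : ∀ {n k} → (Maybe Bool → Bool) → Tm p n (suc k) → Tm p (suc k + n) (suc k) → Tm p n (suc k)
  call   : ∀ {n} → Tm p n p → Tm p n 1

infixr 5 _⊗_

module Semantics (N : ℕ) {p : ℕ} (body : Tm p p 1) where

  -- z bounds the depth of nested calls.
  data Ev (z : ℕ) {n} (ρ : Vec Word n) : ∀ {k} → Tm p n k → Vec Word k → Set
  data Iter (z : ℕ) {n k} (ρ : Vec Word n) (f : Maybe Bool → Bool) (t : Tm p (suc k + n) (suc k)) :
            Vec Word (suc k) → Vec Word (suc k) → Set

  data Ev z {n} ρ where
    var   : ∀ {i} → Ev z ρ (var i) (lookup ρ i ∷ [])
    nil   : Ev z ρ nil ([] ∷ [])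
    cons  : ∀ {b t w} → Ev z ρ t (w ∷ []) → suc (length w) ≤ N → Ev z ρ (cons b t) ((b ∷ w) ∷ [])
    tl    : ∀ {t w} → Ev z ρ t (w ∷ []) → Ev z ρ (tl t) (tailW w ∷ [])
    inc   : ∀ {t w} → Ev z ρ t (w ∷ []) → length (incW w) ≤ N → Ev z ρ (inc t) (incW w ∷ [])
    dec   : ∀ {t w} → Ev z ρ t (w ∷ []) → Ev z ρ (dec t) (decW w ∷ [])
    case[] : ∀ {k t} {a b c : Tm p n k} {r} → Ev z ρ t ([] ∷ []) → Ev z ρ a r → Ev z ρ (caseOf t a b c) r
    case₀ : ∀ {k t w} {a b c : Tm p n k} {r} → Ev z ρ t ((false ∷ w) ∷ []) → Ev z ρ b r → Ev z ρ (caseOf t a b c) r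
    case₁ : ∀ {k t w} {a b c : Tm p n k} {r} → Ev z ρ t ((true ∷ w) ∷ []) → Ev z ρ c r → Ev z ρ (caseOf t a b c) r
    _⊗_   : ∀ {k l} {t : Tm p n k} {u : Tm p n l} {r s} → Ev z ρ t r → Ev z ρ u s → Ev z ρ (t ⊗ u) (r ++ᵛ s)
    bind  : ∀ {k l} {t : Tm p n k} {u : Tm p (k + n) l} {r s} → Ev z ρ t r → Ev z (r ++ᵛ ρ) u s → Ev z ρ (bind t u) s
    loop  : ∀ {k f} {i : Tm p n (suc k)} {t r s} → Ev z ρ i r → Iter z ρ f t r s → Ev z ρ (loop f i t) s
    call  : ∀ {y t as r} → z ≡ suc y → Ev z ρ t as → Ev y as body r → Ev z ρ (call t) r

  data Iter z ρ f t where
    done : ∀ {w ws} → f (top w) ≡ false → Iter z ρ f t (w ∷ ws) (w ∷ ws)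
    more : ∀ {w ws r s} → f (top w) ≡ true → Ev z ((w ∷ ws) ++ᵛ ρ) t r → Iter z ρ f t r s → Iter z ρ f t (w ∷ ws) s

  Short : ∀ {n} → Vec Word n → Set
  Short = All (λ w → length w ≤ N)

  length-tail : ∀ w → length (tailW w) ≤ length w
  length-tail []      = z≤n
  length-tail (_ ∷ w) = n≤1+n _

  length-dec : ∀ w → length (decW w) ≤ length w
  length-dec []              = z≤n
  length-dec (true ∷ w)      = ≤-refl
  length-dec (false ∷ [])    = z≤n
  length-dec (false ∷ b ∷ w) = s≤s (length-dec (b ∷ w))

  -- Only `cons` and `inc` can lengthen a word, and their rules carry the bound; everything else
  -- inherits it from the variables.
  short : ∀ {z n k} {ρ : Vec Word n} {t : Tm p n k} {r} → Short ρ → Ev z ρ t r → Short r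
  short-iter : ∀ {z n k} {ρ : Vec Word n} {f} {t : Tm p (suc k + n) (suc k)} {r s} →
               Short ρ → Short r → Iter z ρ f t r s → Short s
  short ρs (var {i})   = AllP.lookup⁺ ρs i ∷ []
  short ρs nil         = z≤n ∷ []
  short ρs (cons e l)  = l ∷ []
  short ρs (tl {w = w} e) with l ∷ [] ← short ρs e = ≤-trans (length-tail w) l ∷ []
  short ρs (inc e l)   = l ∷ []
  short ρs (dec {w = w} e) with l ∷ [] ← short ρs e = ≤-trans (length-dec w) l ∷ []
  short ρs (case[] _ e) = short ρs e
  short ρs (case₀ _ e) = short ρs e
  short ρs (case₁ _ e) = short ρs e
  short ρs (e ⊗ e′)    = AllP.++⁺ (short ρs e) (short ρs e′)
  short ρs (bind e e′) = short (AllP.++⁺ (short ρs e) ρs) e′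
  short ρs (loop e i)  = short-iter ρs (short ρs e) i
  short ρs (call _ e e′) = short (short ρs e) e′
  short-iter ρs rs (done _)     = rs
  short-iter ρs rs (more _ e i) = short-iter ρs (short (AllP.++⁺ rs ρs) e) i

-- A compiled term leaves its results, the first one on top, above the values of
-- its variables.
compile : ∀ {p n k} → Tm p n k → Cmd 3
compile (var i)      = pick (toℕ i)
compile nil          = push stk nothing
compile (cons b t)   = compile t ⨾ push stk (just b)
compile (tl t)       = compile t ⨾ tailC
compile (inc t)      = compile t ⨾ incC
compile (dec t)      = compile t ⨾ decC
compile (caseOf t a b c) = compile t ⨾
  branch stk isBit (branch stk isOne (drop′ ⨾ compile c) (drop′ ⨾ compile b)) (drop′ ⨾ compile a)
compile (_⊗_ {k = k} t u) = compile t ⨾ toR k ⨾ compile u ⨾ toA k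
compile (bind {k = k} {l} t u) = compile t ⨾ compile u ⨾ squash l k
compile (loop {k = k} f i t) = compile i ⨾ while stk (onBit f) (compile t ⨾ squash (suc k) (suc k))
compile {p} (call t) = compile t ⨾ call ⨾ squash 1 p

-- The number of words by which the evaluation of a term, apart from calls,
-- enlarges the stacks.
cost : ∀ {p n k} → Tm p n k → ℕ
cost (var _)          = 1
cost nil              = 1
cost (cons _ t)       = 1 + cost t
cost (tl t)           = 1 + cost t
cost (inc t)          = 1 + cost t
cost (dec t)          = 1 + cost t
cost (caseOf t a b c) = 1 + cost t + (cost a + cost b + cost c)
cost (_⊗_ {k = k} {l} t u)  = k + l + (cost t + cost u)
cost (bind {k = k} {l} t u) = k + l + (cost t + cost u)
cost (loop {k = k} _ i t)   = suc k + suc k + (cost i + cost t)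
cost {p} (call t)     = suc p + cost t

≤-by : ∀ {m n} k → m + k ≡ n → m ≤ n
≤-by {m} k e = ≤-trans (m≤m+n m k) (≤-reflexive e)

infixr 5 _▸_
_▸_ : ∀ {n} → Vec Word n → List Word → List Word
[]      ▸ ws = ws
(w ∷ ρ) ▸ ws = w ∷ (ρ ▸ ws)

▸-++ : ∀ {m n} (ρ : Vec Word m) {σ : Vec Word n} {ws} → (ρ ++ᵛ σ) ▸ ws ≡ ρ ▸ (σ ▸ ws)
▸-++ []      = refl
▸-++ (w ∷ ρ) = cong (w ∷_) (▸-++ ρ)

-- The state of words parked on the other stack: moving a word reverses both its digits and its
-- place in the sequence, and moving it back restores them.
flipped : ∀ {n} → Vec Word n → List Word → List Word
flipped []      ws = ws
flipped (w ∷ ρ) ws = flipped ρ (reverse w ∷ ws)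

-- Moving words between the two stacks preserves this sum, so one bound on it controls both heights.
total : List Word → List Word → ℕ
total As Rs = length (enc As) + length (enc Rs)

total-mv : ∀ w As Rs → total As (reverse w ∷ Rs) ≡ total (w ∷ As) Rs
total-mv w As Rs = begin
  length (enc As) + length (enc (reverse w ∷ Rs)) ≡⟨ cong (length (enc As) +_) (length-enc (reverse w) Rs) ⟩
  length (enc As) + (length (reverse w) + suc (length (enc Rs))) ≡⟨ cong (λ l → length (enc As) + (l + suc (length (enc Rs)))) (length-reverse w) ⟩
  length (enc As) + (length w + suc (length (enc Rs))) ≡⟨ lem (length (enc As)) (length w) (length (enc Rs)) ⟩
  length w + suc (length (enc As)) + length (enc Rs) ≡⟨ cong (_+ length (enc Rs)) (length-enc w As) ⟨
  total (w ∷ As) Rs ∎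
  where
  open ≡-Reasoning
  lem : ∀ a w r → a + (w + suc r) ≡ w + suc a + r
  lem = solve-∀

total-flipped : ∀ {n} (ρ : Vec Word n) As Rs → total As (flipped ρ Rs) ≡ total (ρ ▸ As) Rs
total-flipped []      As Rs = refl
total-flipped (w ∷ ρ) As Rs = trans (total-flipped ρ As (reverse w ∷ Rs)) (total-mv w (ρ ▸ As) Rs)

split-at : ∀ {n} (i : Fin n) (ρ : Vec Word n) As →
           ∃[ π ] ∃[ ws ] ρ ▸ As ≡ (Vec Word (toℕ i) ∋ π) ▸ (lookup ρ i ∷ ws)
split-at zero    (w ∷ ρ) As = [] , ρ ▸ As , refl
split-at (suc i) (w ∷ ρ) As with π , ws , e ← split-at i ρ As = w ∷ π , ws , cong (w ∷_) e

-- Correctness and space of compiled terms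

module Correct (N S₀ : ℕ) {p : ℕ} (body : Tm p p 1) where

  open Semantics N body
  S : ℕ
  -- The slack absorbs single symbols pushed on top of the words counted by `S₀`, such as a
  -- separator that opens a working area.
  S = 2 + S₀

  R-space : ∀ {w As Rs} → total (w ∷ As) Rs ≤ S₀ → length (enc Rs) + suc (length w) ≤ S₀
  R-space {w} {As} {Rs} le = ≤-trans (≤-trans (≤-trans (m≤m+n _ (length (enc As))) (≤-reflexive (lem (length (enc Rs)) (length w) (length (enc As))))) (≤-reflexive (cong (_+ length (enc Rs)) (sym (length-enc w As))))) le
    where
    lem : ∀ r w a → r + suc w + a ≡ w + suc a + r
    lem = solve-∀

  A-space : ∀ {w As Rs} → total (w ∷ As) Rs ≤ S₀ → length w + suc (length (enc As)) ≤ S₀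
  A-space {w} {As} {Rs} le = ≤-trans (≤-reflexive (sym (length-enc w As))) (≤-trans (m≤m+n _ (length (enc Rs))) le)

  up : ∀ {m} → m ≤ S₀ → m ≤ S
  up le = m≤n⇒m≤1+n (m≤n⇒m≤1+n le)

  module _ {d : ℕ} where
    open Moves S (compile body) {d} public

    toR-run : ∀ {n} (ρ : Vec Word n) {As Rs} → total (ρ ▸ As) Rs ≤ S₀ →
              st (ρ ▸ As) Rs [] ↦ st As (flipped ρ Rs) [] by toR n
    toR-run []      le = skip
    toR-run (w ∷ ρ) {As} {Rs} le =
      mvAR {As = ρ ▸ As} {Rs} {[]} (up (R-space {w} {ρ ▸ As} {Rs} le)) ⨾ toR-run ρ {As} {reverse w ∷ Rs} (≤-trans (≤-reflexive (total-mv w (ρ ▸ As) Rs)) le)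

    toA-run : ∀ {n} (ρ : Vec Word n) {As Rs Cs} → total (ρ ▸ As) Rs ≤ S₀ →
              st As (flipped ρ Rs) Cs ↦ st (ρ ▸ As) Rs Cs by toA n
    toA-run []      le = skip
    toA-run (w ∷ ρ) {As} {Rs} {Cs} le =
      toA-run ρ {As} {reverse w ∷ Rs} {Cs} (≤-trans (≤-reflexive (total-mv w (ρ ▸ As) Rs)) le) ⨾
      subst (λ v → st (ρ ▸ As) (reverse w ∷ Rs) Cs ↦ st (v ∷ (ρ ▸ As)) Rs Cs by mv aux stk) (reverse-involutive w)
        (mvRA {As = ρ ▸ As} {Rs} {Cs} (≤-trans (≤-reflexive (trans (cong (λ l → length (enc (ρ ▸ As)) + suc l) (length-reverse w))
          (trans (+-comm _ (suc (length w))) (sym (+-suc (length w) _)))))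
          (up (A-space {w} {ρ ▸ As} {Rs} le))))

    drops-run : ∀ {n} (ρ : Vec Word n) {As Rs} → st (ρ ▸ As) Rs [] ↦ st As Rs [] by drops n
    drops-run []      = skip
    drops-run (w ∷ ρ) {As} {Rs} = drop-run {w} {ρ ▸ As} {Rs} {[]} ⨾ drops-run ρ {As} {Rs}

    squash-run : ∀ {k m} (r : Vec Word k) (ρ : Vec Word m) {As Rs} → total (r ▸ ρ ▸ As) Rs ≤ S₀ → total (r ▸ As) Rs ≤ S₀ →
                 st (r ▸ ρ ▸ As) Rs [] ↦ st (r ▸ As) Rs [] by squash k m
    squash-run r ρ {As} {Rs} le le′ = toR-run r {ρ ▸ As} {Rs} le ⨾ drops-run ρ {As} {flipped r Rs} ⨾ toA-run r {As} {Rs} {[]} le′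

    pick-run : ∀ {n} (i : Fin n) (ρ : Vec Word n) {As Rs} → total (lookup ρ i ∷ (ρ ▸ As)) Rs ≤ S₀ →
               st (ρ ▸ As) Rs [] ↦ st (lookup ρ i ∷ (ρ ▸ As)) Rs [] by pick (toℕ i)
    pick-run i ρ {As} {Rs} le with π , ws , e ← split-at i ρ As rewrite e =
      toR-run π {x ∷ ws} {Rs} le′ ⨾
      cpy-run {x} {ws} {flipped π Rs} (up (R-space {x} {ws} {flipped π Rs} le″))
        (up (≤-trans (m≤m+n (length (enc (x ∷ ws))) _) le″)) ⨾
      toA-run π {x ∷ ws} {Rs} {reverse x ∷ []} le′ ⨾
      subst (λ v → st (π ▸ x ∷ ws) Rs (reverse x ∷ []) ↦ st (v ∷ (π ▸ x ∷ ws)) Rs [] by mv tmp stk) (reverse-involutive x)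
        (mvCA {As = π ▸ x ∷ ws} {Rs} {[]} (≤-trans (≤-reflexive (trans (cong (λ l → length (enc (π ▸ x ∷ ws)) + suc l) (length-reverse x))
          (trans (+-comm _ (suc (length x))) (sym (+-suc (length x) _)))))
          (up (A-space {x} {π ▸ x ∷ ws} {Rs} le))))
      where
      x = lookup ρ i
      le′ : total (π ▸ x ∷ ws) Rs ≤ S₀
      le′ = ≤-trans (+-monoˡ-≤ (length (enc Rs)) (≤-trans (n≤1+n _) (≤-trans (m≤n+m _ (length x)) (≤-reflexive (sym (length-enc x (π ▸ x ∷ ws))))))) le
      le″ : total (x ∷ ws) (flipped π Rs) ≤ S₀
      le″ = ≤-trans (≤-reflexive (total-flipped π (x ∷ ws) Rs)) le′

  -- `q` counts further words that still fit, each with at most `N` digits and one separator.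
  record Room (q : ℕ) (As Rs : List Word) : Set where
    constructor space
    field slack : total As Rs + q * suc N ≤ S₀

  fits : ∀ {q As Rs} → Room q As Rs → total As Rs ≤ S₀
  fits (space le) = ≤-trans (m≤m+n _ _) le

  shrink : ∀ {q q′ As Rs} → q′ ≤ q → Room q As Rs → Room q′ As Rs
  shrink {As = As} {Rs} q≤ (space le) = space (≤-trans (+-monoʳ-≤ (total As Rs) (*-monoˡ-≤ (suc N) q≤)) le)

  room-∷ : ∀ {q w As Rs} → length w ≤ N → Room (suc q) As Rs → Room q (w ∷ As) Rs
  room-∷ {q} {w} {As} {Rs} l (space le) = space (begin
    length (enc (w ∷ As)) + length (enc Rs) + q * suc N ≡⟨ cong (λ x → x + length (enc Rs) + q * suc N) (length-enc w As) ⟩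
    length w + suc (length (enc As)) + length (enc Rs) + q * suc N ≤⟨ +-monoˡ-≤ (q * suc N) (+-monoˡ-≤ (length (enc Rs)) (+-monoˡ-≤ (suc (length (enc As))) l)) ⟩
    N + suc (length (enc As)) + length (enc Rs) + q * suc N ≡⟨ lem N (length (enc As)) (length (enc Rs)) (q * suc N) ⟩
    length (enc As) + length (enc Rs) + suc q * suc N ≤⟨ le ⟩
    S₀ ∎)
    where
    open ≤-Reasoning
    lem : ∀ N a r x → N + suc a + r + x ≡ a + r + (suc N + x)
    lem = solve-∀

  room-▸ : ∀ {q k As Rs} {r : Vec Word k} → Short r → Room (k + q) As Rs → Room q (r ▸ As) Rs
  room-▸ [] le = le
  room-▸ {q} {suc k} {As} {Rs} {w ∷ r} (l ∷ ls) le =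
    room-∷ {q} {w} {r ▸ As} {Rs} l (room-▸ {suc q} {k} ls (subst (λ x → Room x As Rs) (sym (+-suc k q)) le))

  room-flipped : ∀ {q k As Rs} (r : Vec Word k) → Room q (r ▸ As) Rs → Room q As (flipped r Rs)
  room-flipped {q} {_} {As} {Rs} r (space le) = space (≤-trans (≤-reflexive (cong (_+ q * suc N) (total-flipped r As Rs))) le)

  cb : ℕ
  cb = cost body

  A-fits : ∀ {w As Rs} → total (w ∷ As) Rs ≤ S₀ → length (enc (w ∷ As)) ≤ S₀
  A-fits {w} {As} {Rs} le = ≤-trans (m≤m+n _ (length (enc Rs))) le

  -- A term needs room for `cost t` words of its own and for `cost body` words per level of nested
  -- calls. At a call, `suc y * cb` unfolds to `cb + y * cb`, which is the room for the body with
  -- `y` levels left.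
  exec : ∀ {z n k} {ρ : Vec Word n} {t : Tm p n k} {r} → Ev z ρ t r → Short ρ → ∀ As Rs →
         Room (cost t + z * cb) (ρ ▸ As) Rs → Exec S (compile body) z (compile t) (st (ρ ▸ As) Rs []) (st (r ▸ ρ ▸ As) Rs [])
  execIter : ∀ {z n k f} {ρ : Vec Word n} {t : Tm p (suc k + n) (suc k)} {r s} → Iter z ρ f t r s → Short ρ → Short r →
             ∀ As Rs → Room (suc k + suc k + (cost t + z * cb)) (ρ ▸ As) Rs →
             Exec S (compile body) z (while stk (onBit f) (compile t ⨾ squash (suc k) (suc k)))
               (st (r ▸ ρ ▸ As) Rs []) (st (s ▸ ρ ▸ As) Rs [])
  exec {ρ = ρ} (var {i}) ρs As Rs room =
    pick-run i ρ {As} {Rs} (fits (room-∷ {w = lookup ρ i} (AllP.lookup⁺ ρs i) room))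
  exec {ρ = ρ} nil ρs As Rs room =
    push (s≤s (m≤n⇒m≤1+n (≤-trans (m≤m+n _ (length (enc Rs))) (fits {As = ρ ▸ As} {Rs} room))))
  exec {ρ = ρ} (cons {w = w} e l) ρs As Rs room =
    exec e ρs As Rs (shrink (n≤1+n _) room) ⨾
    push (s≤s (m≤n⇒m≤1+n (A-fits {w} {ρ ▸ As} {Rs} (fits (room-∷ {w = w} (≤-trans (n≤1+n _) l) room)))))
  exec {ρ = ρ} (tl e) ρs As Rs room = exec e ρs As Rs (shrink (n≤1+n _) room) ⨾ tail-run {As = ρ ▸ As} {Rs} {[]}
  exec {ρ = ρ} (inc {w = w} e l) ρs As Rs room with l′ ∷ [] ← short ρs e =
    exec e ρs As Rs (shrink (n≤1+n _) room) ⨾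
    inc-run {w = w} {ρ ▸ As} {Rs} (m≤n⇒m≤1+n (m≤n⇒m≤1+n (≤-trans (≤-reflexive (sym (+-suc (length (enc Rs)) (length w)))) (R-space {w} {ρ ▸ As} {Rs} fw))))
      (m≤n⇒m≤1+n (s≤s (A-fits {w} {ρ ▸ As} {Rs} fw)))
      (up (A-space {incW w} {ρ ▸ As} {Rs} (fits (room-∷ {w = incW w} l room))))
    where
    fw : total (w ∷ (ρ ▸ As)) Rs ≤ S₀
    fw = fits (room-∷ {w = w} l′ room)
  exec {ρ = ρ} (dec {w = w} e) ρs As Rs room with l′ ∷ [] ← short ρs e =
    exec e ρs As Rs (shrink (n≤1+n _) room) ⨾
    dec-run {w = w} {ρ ▸ As} {Rs} (m≤n⇒m≤1+n (m≤n⇒m≤1+n (≤-trans (≤-reflexive (sym (+-suc (length (enc Rs)) (length w)))) (R-space {w} {ρ ▸ As} {Rs} fw))))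
      (up (A-fits {w} {ρ ▸ As} {Rs} fw))
      (up (A-space {decW w} {ρ ▸ As} {Rs} (fits (room-∷ {w = decW w} (≤-trans (length-dec w) l′) room))))
    where
    fw : total (w ∷ (ρ ▸ As)) Rs ≤ S₀
    fw = fits (room-∷ {w = w} l′ room)
  exec {z} {ρ = ρ} {caseOf t a b c} (case[] e e′) ρs As Rs room =
    exec e ρs As Rs (shrink (+-monoˡ-≤ (z * cb) (≤-trans (n≤1+n _) (m≤m+n _ _))) room) ⨾
    ifF refl (drop-run {w = []} {ρ ▸ As} {Rs} {[]} ⨾ exec e′ ρs As Rs (shrink (+-monoˡ-≤ (z * cb)
      (≤-trans (≤-trans (m≤m+n (cost a) (cost b)) (m≤m+n _ (cost c))) (m≤n+m _ (suc (cost t))))) room))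
  exec {z} {ρ = ρ} {caseOf t a b c} (case₀ {w = w} e e′) ρs As Rs room =
    exec e ρs As Rs (shrink (+-monoˡ-≤ (z * cb) (≤-trans (n≤1+n _) (m≤m+n _ _))) room) ⨾
    ifT refl (ifF refl (drop-run {w = false ∷ w} {ρ ▸ As} {Rs} {[]} ⨾ exec e′ ρs As Rs (shrink (+-monoˡ-≤ (z * cb)
      (≤-trans (≤-trans (m≤n+m (cost b) (cost a)) (m≤m+n _ (cost c))) (m≤n+m _ (suc (cost t))))) room)))
  exec {z} {ρ = ρ} {caseOf t a b c} (case₁ {w = w} e e′) ρs As Rs room =
    exec e ρs As Rs (shrink (+-monoˡ-≤ (z * cb) (≤-trans (n≤1+n _) (m≤m+n _ _))) room) ⨾
    ifT refl (ifT refl (drop-run {w = true ∷ w} {ρ ▸ As} {Rs} {[]} ⨾ exec e′ ρs As Rs (shrink (+-monoˡ-≤ (z * cb)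
      (≤-trans (m≤n+m (cost c) (cost a + cost b)) (m≤n+m _ (suc (cost t))))) room)))
  exec {z} {ρ = ρ} (_⊗_ {k} {l} {t} {u} {r} {s} e e′) ρs As Rs room =
    exec e ρs As Rs (shrink (≤-by (k + l + cost u) (lem₁ k l (cost t) (cost u) (z * cb))) room) ⨾
    -- The results of `t` wait on the other stack, so that `u` finds the values of its variables on
    -- top.
    toR-run r {ρ ▸ As} {Rs} (fits (room-▸ {cost u + z * cb} (short ρs e) room₁)) ⨾
    exec e′ ρs As (flipped r Rs) (room-flipped r (room-▸ {cost u + z * cb} (short ρs e) room₁)) ⨾
    subst (λ ws → st (s ▸ ρ ▸ As) (flipped r Rs) [] ↦ st ws Rs [] by toA k) (sym (▸-++ r {s} {ρ ▸ As}))
      (toA-run r {s ▸ ρ ▸ As} {Rs} {[]} (fits (room-▸ {0} {As = s ▸ ρ ▸ As} {Rs} (short ρs e) (room-▸ {k + 0} (short ρs e′)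
        (shrink (≤-by (cost t + cost u + z * cb) (lem₃ k l (cost t) (cost u) (z * cb))) room)))))
    where
    lem₁ : ∀ k l t u z → t + z + (k + l + u) ≡ k + l + (t + u) + z
    lem₁ = solve-∀
    lem₂ : ∀ k l t u z → k + (u + z) + (l + t) ≡ k + l + (t + u) + z
    lem₂ = solve-∀
    lem₃ : ∀ k l t u z → l + (k + 0) + (t + u + z) ≡ k + l + (t + u) + z
    lem₃ = solve-∀
    room₁ : Room (k + (cost u + z * cb)) (ρ ▸ As) Rs
    room₁ = shrink (≤-by (l + cost t) (lem₂ k l (cost t) (cost u) (z * cb))) room
  exec {z} {ρ = ρ} (bind {k} {l} {t} {u} {r} {s} e e′) ρs As Rs room =
    exec e ρs As Rs (shrink (≤-by (k + l + cost u) (lem₁ k l (cost t) (cost u) (z * cb))) room) ⨾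
    subst (λ ws → st ws Rs [] ↦ st (s ▸ ws) Rs [] by compile u) (▸-++ r)
      (exec e′ (AllP.++⁺ (short ρs e) ρs) As Rs (subst (λ ws → Room (cost u + z * cb) ws Rs) (sym (▸-++ r))
         (room-▸ (short ρs e) room₁))) ⨾
    squash-run s r {ρ ▸ As} {Rs} (fits (room-▸ {0} {As = r ▸ ρ ▸ As} {Rs} ss (room-▸ {l + 0} (short ρs e)
        (shrink (≤-by (cost t + cost u + z * cb) (lem₃ k l (cost t) (cost u) (z * cb))) room))))
      (fits (room-▸ {0} ss (shrink (≤-by (k + (cost t + cost u + z * cb)) (lem₄ k l (cost t) (cost u) (z * cb))) room)))
    where
    ss = short (AllP.++⁺ (short ρs e) ρs) e′
    lem₁ : ∀ k l t u z → t + z + (k + l + u) ≡ k + l + (t + u) + z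
    lem₁ = solve-∀
    lem₂ : ∀ k l t u z → k + (u + z) + (l + t) ≡ k + l + (t + u) + z
    lem₂ = solve-∀
    lem₃ : ∀ k l t u z → k + (l + 0) + (t + u + z) ≡ k + l + (t + u) + z
    lem₃ = solve-∀
    lem₄ : ∀ k l t u z → l + 0 + (k + (t + u + z)) ≡ k + l + (t + u) + z
    lem₄ = solve-∀
    room₁ : Room (k + (cost u + z * cb)) (ρ ▸ As) Rs
    room₁ = shrink (≤-by (l + cost t) (lem₂ k l (cost t) (cost u) (z * cb))) room
  exec {z} {ρ = ρ} (loop {k} {f} {i} {t} e it) ρs As Rs room =
    exec e ρs As Rs (shrink (≤-by (suc k + suc k + cost t) (lem₁ (suc k) (cost i) (cost t) (z * cb))) room) ⨾
    execIter it ρs (short ρs e) As Rs (shrink (≤-by (cost i) (lem₂ (suc k) (cost i) (cost t) (z * cb))) room)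
    where
    lem₁ : ∀ k i t z → i + z + (k + k + t) ≡ k + k + (i + t) + z
    lem₁ = solve-∀
    lem₂ : ∀ k i t z → k + k + (t + z) + i ≡ k + k + (i + t) + z
    lem₂ = solve-∀
  exec {ρ = ρ} (call {y} {t} {as} {r} refl e e′) ρs As Rs room =
    exec e ρs As Rs (shrink (≤-by (suc p) (lem₁ (suc p) (cost t) (cb + y * cb))) room) ⨾
    call (exec e′ (short ρs e) (ρ ▸ As) Rs
      (room-▸ (short ρs e) (shrink (≤-by (1 + cost t) (lem₂ p (cost t) (cb + y * cb))) room))) ⨾
    squash-run r as {ρ ▸ As} {Rs}
      (fits (room-▸ {0} {As = as ▸ ρ ▸ As} {Rs} rs (room-▸ {1} (short ρs e)
        (shrink (≤-by (cost t + (cb + y * cb)) (lem₃ p (cost t) (cb + y * cb))) room))))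
      (fits (room-▸ {0} rs (shrink (s≤s z≤n) room)))
    where
    rs = short (short ρs e) e′
    lem₁ : ∀ p t z → t + z + p ≡ p + t + z
    lem₁ = solve-∀
    lem₂ : ∀ p t z → p + z + (1 + t) ≡ suc p + t + z
    lem₂ = solve-∀
    lem₃ : ∀ p t z → p + 1 + (t + z) ≡ suc p + t + z
    lem₃ = solve-∀
  execIter {z} {ρ = ρ} (done {w} {ws} fw) ρs rs As Rs room = done (trans (top-enc _ w (ws ▸ ρ ▸ As)) fw)
  execIter {z} {k = k} {ρ = ρ} {t} (more {w} {ws} {r} {s} fw e it) ρs rs As Rs room =
    more (trans (top-enc _ w (ws ▸ ρ ▸ As)) fw)
      (subst (λ us → Exec S (compile body) z (compile t) (st us Rs []) (st (r ▸ us) Rs [])) (▸-++ (w ∷ ws))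
         (exec e (AllP.++⁺ rs ρs) As Rs (subst (λ us → Room (cost t + z * cb) us Rs) (sym (▸-++ (w ∷ ws)))
            (room-▸ rs (shrink (≤-by (suc k) (lem₁ (suc k) (cost t + z * cb))) room)))) ⨾
       squash-run r (w ∷ ws) {ρ ▸ As} {Rs}
         (fits (room-▸ {0} {As = (w ∷ ws) ▸ ρ ▸ As} {Rs} rs′ (room-▸ {suc k + 0} rs
           (shrink (≤-by (cost t + z * cb) (lem₂ (suc k) (cost t + z * cb))) room))))
         (fits (room-▸ {0} rs′ (shrink (≤-by (suc k + (cost t + z * cb)) (lem₃ (suc k) (cost t + z * cb))) room))))
      (execIter it ρs rs′ As Rs room)
    where
    rs′ = short (AllP.++⁺ rs ρs) e
    lem₁ : ∀ k t → k + t + k ≡ k + k + t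
    lem₁ = solve-∀
    lem₂ : ∀ k t → k + (k + 0) + t ≡ k + k + t
    lem₂ = solve-∀
    lem₃ : ∀ k t → k + 0 + (k + t) ≡ k + k + t
    lem₃ = solve-∀

-- Four reversals bring the input word from its tape onto the main stack.
prelude : Cmd 3
prelude = push stk nothing ⨾ moveBits aux stk ⨾ mv stk aux ⨾ mv aux tmp ⨾ mv tmp stk

module _ (N S₀ : ℕ) {p : ℕ} (body : Tm p p 1) {d : ℕ} where
  open Correct N S₀ body

  prelude-run : ∀ w → suc (length w) ≤ S → Exec S (compile body) d prelude (map just w ∷ [] ∷ [] ∷ []) (st (w ∷ []) [] [])
  prelude-run w le =
    push (≤-trans (s≤s z≤n) le) ⨾
    subst₂ (λ r a → r ∷ (nothing ∷ []) ∷ [] ∷ [] ↦ [] ∷ a ∷ [] ∷ [] by moveBits aux stk) (++-identityʳ (map just w)) (enc-ʳ++ w [])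
      (moveBits-run (λ ()) w [] _ refl refl le) ⨾
    mvAR {w = reverse w} {[]} {[]} {[]} (≤-trans (s≤s (≤-reflexive (length-reverse w))) le) ⨾
    mvRC {w = reverse (reverse w)} {[]} {[]} {[]} (≤-trans (s≤s (≤-reflexive (trans (length-reverse (reverse w)) (length-reverse w)))) le) ⨾
    subst (λ v → st [] [] (reverse (reverse (reverse w)) ∷ []) ↦ st (v ∷ []) [] [] by mv tmp stk)
      (trans (reverse-involutive (reverse (reverse w))) (reverse-involutive w))
      (mvCA {As = []} {[]} {[]} (≤-trans (s≤s (≤-reflexive (trans (length-reverse (reverse (reverse w))) (trans (length-reverse (reverse w)) (length-reverse w))))) le))

module _ {p : ℕ} (body : Tm p p 1) (main : Tm p 1 1) {L : Language}
         (eval : ∀ w → ∃[ z ] ∃[ r ] (z ≤ length w × Semantics.Ev (suc (length w)) body z (w ∷ []) main (r ∷ [])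
                      × (w ∈ L ⇔ T (some (top r)))))
         where

  -- The factor `2 + length w` is the room for one word with separator when `N` is `suc (length w)`;
  -- the other factor counts words: the input, those of `main`, and those of up to `length w` nested
  -- calls. The summand 2 is the slack of `S` over `S₀`.
  stackBound : Word → ℕ
  stackBound w = 2 + (1 + cost main + length w * cost body) * (2 + length w)

  term-PSPACE : L ∈ PSPACE
  term-PSPACE = machine , decides stackBound run poly poly-eq
    where
    open Compile (prelude ⨾ compile main) (compile body) stk isBit
    run : ∀ w → ∃[ d ] ∃[ σ ] (d ≤ stackBound w × length w ≤ stackBound w
            × Exec (stackBound w) (compile body) d (prelude ⨾ compile main) (map just w ∷ [] ∷ [] ∷ []) σ
            × (w ∈ L ⇔ T (isBit (top (lookup σ stk)))))
    run w with z , r , z≤ , e , iff ← eval w =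
      z , _ , ≤-trans z≤ w≤ , w≤ ,
      prelude-run N S₀ body w (≤-trans (s≤s (n≤1+n _)) (m≤n⇒m≤1+n (m≤n⇒m≤1+n (m≤m+n (suc N) _)))) ⨾ Correct.exec N S₀ body e (n≤1+n _ ∷ []) [] [] room ,
      subst (λ b → w ∈ L ⇔ T b) (sym (top-enc some r (w ∷ []))) iff
      where
      N  = suc (length w)
      S₀ = (1 + cost main + length w * cost body) * (2 + length w)
      w≤ : length w ≤ stackBound w
      w≤ = ≤-trans (≤-trans (n≤1+n _) (n≤1+n _)) (m≤n⇒m≤1+n (m≤n⇒m≤1+n (m≤m+n (suc N) _)))
      room : Correct.Room N S₀ body (cost main + z * cost body) (w ∷ []) []
      room = Correct.space (begin
        length (enc (w ∷ [])) + 0 + (cost main + z * cost body) * suc N ≡⟨ cong (λ x → x + 0 + (cost main + z * cost body) * suc N) (length-enc w []) ⟩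
        length w + 1 + 0 + (cost main + z * cost body) * suc N ≤⟨ +-mono-≤ (≤-trans (≤-reflexive (lem (length w))) (n≤1+n _)) (*-monoˡ-≤ (suc N) (+-monoʳ-≤ (cost main) (*-monoˡ-≤ (cost body) z≤))) ⟩
        suc N + (cost main + length w * cost body) * suc N ∎)
        where
        open ≤-Reasoning
        lem : ∀ n → n + 1 + 0 ≡ suc n
        lem = solve-∀
    poly : List ℕ
    -- The expansion of `4 * (1 + stackBound w)` in powers of `length w`: there are four tapes, each
    -- with at most one cell more than the stack bound.
    poly = 20 + 8 * cost main ∷ 4 + 4 * cost main + 8 * cost body ∷ 4 * cost body ∷ []
    poly-eq : ∀ w → evalPoly poly (length w) ≡ Bounded.space-bound (stackBound w)
    poly-eq w = lem (cost main) (cost body) (length w)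
      where
      lem : ∀ m b n → 20 + 8 * m + n * (4 + 4 * m + 8 * b + n * (4 * b + n * 0)) ≡ 4 * (3 + (1 + m + n * b) * (2 + n))
      lem = solve-∀

-- Numbers and encodings

nb : ℕ → Word
nb zero    = []
nb (suc n) = incW (nb n)

val : Word → ℕ
val []          = 0
val (false ∷ w) = suc (val w + val w)
val (true ∷ w)  = suc (suc (val w + val w))

nb-odd : ∀ n → nb (suc (n + n)) ≡ false ∷ nb n
nb-odd zero    = refl
nb-odd (suc n) rewrite +-suc n n | nb-odd n = refl

nb-val : ∀ w → nb (val w) ≡ w
nb-val []          = refl
nb-val (false ∷ w) = trans (nb-odd (val w)) (cong (false ∷_) (nb-val w))
nb-val (true ∷ w)  = trans (cong incW (nb-odd (val w))) (cong (true ∷_) (nb-val w))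

val-inc : ∀ w → val (incW w) ≡ suc (val w)
val-inc []          = refl
val-inc (false ∷ w) = refl
val-inc (true ∷ w) rewrite val-inc w | +-suc (val w) (val w) = refl

val-nb : ∀ n → val (nb n) ≡ n
val-nb zero    = refl
val-nb (suc n) = trans (val-inc (nb n)) (cong suc (val-nb n))

dec-inc : ∀ w → decW (incW w) ≡ w
dec-inc []          = refl
dec-inc (false ∷ w) = refl
dec-inc (true ∷ w) with incW w | dec-inc w | inc≢[] w
  where
  inc≢[] : ∀ w → ∃[ b ] ∃[ v ] incW w ≡ b ∷ v
  inc≢[] []          = _ , _ , refl
  inc≢[] (false ∷ w) = _ , _ , refl
  inc≢[] (true ∷ w)  = _ , _ , refl
... | _ ∷ _ | e | _ , _ , refl = cong (true ∷_) e

dec-nb : ∀ n → decW (nb n) ≡ nb (pred n)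
dec-nb zero    = refl
dec-nb (suc n) = dec-inc (nb n)

length-inc : ∀ w → length w ≤ length (incW w)
length-inc []          = z≤n
length-inc (false ∷ w) = ≤-refl
length-inc (true ∷ w)  = s≤s (length-inc w)

length-inc-≤ : ∀ w → length (incW w) ≤ suc (length w)
length-inc-≤ []          = ≤-refl
length-inc-≤ (false ∷ w) = n≤1+n _
length-inc-≤ (true ∷ w)  = s≤s (length-inc-≤ w)

nb-mono : ∀ {m n} → m ≤ n → length (nb m) ≤ length (nb n)
nb-mono {m} m≤n = go (≤⇒≤′ m≤n)
  where
  go : ∀ {n} → m ≤′ n → length (nb m) ≤ length (nb n)
  go ≤′-refl               = ≤-refl
  go {suc n} (≤′-step m≤n) = ≤-trans (go m≤n) (length-inc (nb n))

nb-short : ∀ {n} w → n ≤ suc (val w) → length (nb n) ≤ suc (length w)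
nb-short w n≤ = ≤-trans (nb-mono n≤) (≤-trans (≤-reflexive (cong (length ∘′ incW) (nb-val w))) (length-inc-≤ w))
  where
  _∘′_ : ∀ {A B C : Set} → (B → C) → (A → B) → A → C
  (f ∘′ g) x = f (g x)

-- In bijective base two the words of length l are the numbers from 2^l - 1 to 2^(l+1) - 2. The
-- lower end makes the input word a large number; the upper end, in `val-<-2^`, bounds a number by
-- the length of its encoding.
2^-≤-val : ∀ w → 2 ^ length w ≤ suc (val w)
2^-≤-val []      = ≤-refl
2^-≤-val (b ∷ w) = ≤-trans (*-monoʳ-≤ 2 (2^-≤-val w)) (≤-trans (≤-reflexive (lem (val w))) (digit b))
  where
  lem : ∀ v → 2 * suc v ≡ suc (suc (v + v))
  lem = solve-∀
  digit : ∀ b → suc (suc (val w + val w)) ≤ suc (val (b ∷ w))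
  digit false = ≤-refl
  digit true  = n≤1+n _

val-<-2^ : ∀ w → suc (val w) < 2 ^ suc (length w)
val-<-2^ []      = ≤-refl
val-<-2^ (b ∷ w) = ≤-trans (digit b) (≤-trans (≤-reflexive (lem (val w))) (*-monoʳ-≤ 2 (val-<-2^ w)))
  where
  lem : ∀ v → suc (suc (suc (suc (v + v)))) ≡ 2 * suc (suc v)
  lem = solve-∀
  digit : ∀ b → suc (suc (val (b ∷ w))) ≤ suc (suc (suc (suc (val w + val w))))
  digit false = n≤1+n _
  digit true  = ≤-refl

-- Ordinary binary digits of n + 1 without the leading 1 are the bijective digits of n. Hence an
-- encoded number is converted by deleting its leading digit and incrementing once.
digits-suc : ∀ n → binaryDigits (suc n) ≡ nb n ++ true ∷ []
digits-suc zero    = refl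
digits-suc (suc n) = trans (cong increment (digits-suc n)) (step (nb n))
  where
  step : ∀ w → increment (w ++ true ∷ []) ≡ incW w ++ true ∷ []
  step []          = refl
  step (false ∷ w) = refl
  step (true ∷ w)  = cong (false ∷_) (step w)

digits-bound : ∀ n → suc n ≤ 2 ^ length (binaryDigits n)
digits-bound zero    = ≤-refl
digits-bound (suc n) rewrite digits-suc n | length-++ (nb n) {true ∷ []} | +-comm (length (nb n)) 1 =
  ≤-trans (≤-reflexive (cong (λ m → suc (suc m)) (sym (val-nb n)))) (val-<-2^ (nb n))

-- The list of accumulated digits is in reverse order.
scan : Word → Word → Maybe (Word × Word)
scan []              acc = nothing
scan (true ∷ [])     acc = nothing
scan (true ∷ d ∷ v)  acc = scan v (d ∷ acc)
scan (false ∷ v)     acc = just (acc , v)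

-- The digits come most significant first, as `scan` leaves them. A first digit `false` is a leading
-- zero, which no encoding has.
value : Word → Maybe ℕ
value []          = just 0
value (false ∷ _) = nothing
value (true ∷ ds) = just (suc (val (reverse ds)))

parseNum : Word → Maybe (ℕ × Word)
parseNum v = scan v [] >>= λ (ds , r) → value ds >>= λ n → just (n , r)

spread : Word → Word
spread = concatMap (λ d → true ∷ d ∷ [])

scan-spread : ∀ ds {r acc} → scan (spread ds ++ false ∷ r) acc ≡ just (ds ʳ++ acc , r)
scan-spread []       = refl
scan-spread (d ∷ ds) = scan-spread ds

scan-sound : ∀ v acc {ds r} → scan v acc ≡ just (ds , r) → ∃[ es ] (ds ≡ es ʳ++ acc × v ≡ spread es ++ false ∷ r)
scan-sound (true ∷ d ∷ v) acc e with es , p , q ← scan-sound v (d ∷ acc) e = d ∷ es , p , cong (λ u → true ∷ d ∷ u) q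
scan-sound (false ∷ v)    acc refl = [] , refl , refl

value-digits : ∀ n → value (reverse (binaryDigits n)) ≡ just n
value-digits zero = refl
value-digits (suc n) rewrite digits-suc n | reverse-++ (nb n) (true ∷ [])
  | reverse-involutive (nb n) | val-nb n = refl

value-sound : ∀ ds {n} → value (reverse ds) ≡ just n → binaryDigits n ≡ ds
value-sound ds {n} e = trans (go (reverse ds) e) (reverse-involutive ds)
  where
  go : ∀ ds {n} → value ds ≡ just n → binaryDigits n ≡ reverse ds
  go []          refl = refl
  go (true ∷ ds) refl = trans (digits-suc (val (reverse ds)))
    (trans (cong (_++ true ∷ []) (nb-val (reverse ds))) (sym (unfold-reverse true ds)))

encodeℕ-++ : ∀ n r → encodeℕ n ++ r ≡ spread (binaryDigits n) ++ false ∷ r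
encodeℕ-++ n r = ++-assoc (spread (binaryDigits n)) (false ∷ []) r

parseNum-complete : ∀ n r → parseNum (encodeℕ n ++ r) ≡ just (n , r)
parseNum-complete n r rewrite encodeℕ-++ n r | scan-spread (binaryDigits n) {r} {[]} | value-digits n = refl

parseNum-sound : ∀ v {n r} → parseNum v ≡ just (n , r) → v ≡ encodeℕ n ++ r
parseNum-sound v {n} {r} e with scan v [] in eq
... | just (ds , r′) with value ds in eq′
...   | just n′ with refl ← e with es , refl , refl ← scan-sound v [] eq =
  trans (cong (λ ds → spread ds ++ false ∷ r) (sym (value-sound es eq′))) (sym (encodeℕ-++ n r))

-- Parsing of gate lists

Ops : List Op
Ops = bin cup ∷ bin cap ∷ compl ∷ bin plus ∷ bin div ∷ []

-- A gate with its name, the incoming edges being given by names.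
Raw : Set
Raw = ℕ × Gate Ops ℕ

encodeBody : Gate Ops ℕ → List Bool
encodeBody x = encodeLabel x ++ encodeList encodeℕ (preds x)

encodeRaw : Raw → List Bool
encodeRaw (n , x) = encodeℕ n ++ encodeBody x

encodeRaws : List Raw → List Bool
encodeRaws = encodeList encodeRaw

pattern cup∈  = here refl
pattern cap∈  = there (here refl)
pattern compl∈ = there (there (here refl))
pattern plus∈ = there (there (there (here refl)))
pattern div∈  = there (there (there (there (here refl))))

parsePred : Word → Maybe (ℕ × Word)
parsePred (true ∷ r) = parseNum r
parsePred _          = nothing

parseEnd : Word → Maybe Word
parseEnd (false ∷ r) = just r
parseEnd _           = nothing

parse₀ parse₁ : Word → Maybe (ℕ × Word)
parse₀ r = parseNum r >>= λ (n , r) → parseEnd r >>= λ r → just (n , r)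
parse₁ r = parsePred r >>= λ (p , r) → parseEnd r >>= λ r → just (p , r)

parse₂ : Word → Maybe (ℕ × ℕ × Word)
parse₂ r = parsePred r >>= λ (p , r) → parsePred r >>= λ (q , r) → parseEnd r >>= λ r → just (p , q , r)

parseBin : (σ : BinOp) → bin σ ∈ˡ Ops → Word → Maybe (Gate Ops ℕ × Word)
parseBin σ σ∈ r = parse₂ r >>= λ (p , q , r) → just (binary σ σ∈ p q , r)

parseBody : Word → Maybe (Gate Ops ℕ × Word)
parseBody (false ∷ false ∷ false ∷ r) = parse₀ r >>= λ (n , r) → just (input n , r)
parseBody (false ∷ false ∷ true ∷ r)  = parse₁ r >>= λ (p , r) → just (complement compl∈ p , r)
parseBody (false ∷ true ∷ false ∷ r)  = parseBin cup cup∈ r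
parseBody (false ∷ true ∷ true ∷ r)   = parseBin cap cap∈ r
parseBody (true ∷ false ∷ false ∷ r)  = parseBin plus plus∈ r
parseBody (true ∷ true ∷ false ∷ r)   = parseBin div div∈ r
parseBody _                           = nothing

parseRaw : Word → Maybe (Raw × Word)
parseRaw v = parseNum v >>= λ (n , r) → parseBody r >>= λ (x , r) → just ((n , x) , r)

-- The first argument is fuel for the number of gates. The length of the word is enough, since each
-- gate is announced by a bit of its own.
parseRaws : ℕ → Word → Maybe (List Raw × Word)
parseRaws k       (false ∷ v) = just ([] , v)
parseRaws (suc k) (true ∷ v)  = parseRaw v >>= λ (g , r) → parseRaws k r >>= λ (gs , r) → just (g ∷ gs , r)
parseRaws _       _           = nothing

parse₂-complete : ∀ p q r → parse₂ (true ∷ encodeℕ p ++ true ∷ encodeℕ q ++ false ∷ r) ≡ just (p , q , r)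
parse₂-complete p q r rewrite parseNum-complete p (true ∷ encodeℕ q ++ false ∷ r) | parseNum-complete q (false ∷ r) = refl

encode₁ : ∀ p r → encodeList encodeℕ (p ∷ []) ++ r ≡ true ∷ encodeℕ p ++ false ∷ r
encode₁ p r = cong (true ∷_) (trans (cong (λ u → (u ++ false ∷ []) ++ r) (++-identityʳ (encodeℕ p))) (++-assoc (encodeℕ p) _ r))

encode₂ : ∀ p q r → encodeList encodeℕ (p ∷ q ∷ []) ++ r ≡ true ∷ encodeℕ p ++ true ∷ encodeℕ q ++ false ∷ r
encode₂ p q r = cong (true ∷_) (begin
  ((encodeℕ p ++ true ∷ encodeℕ q ++ []) ++ false ∷ []) ++ r ≡⟨ ++-assoc (encodeℕ p ++ true ∷ encodeℕ q ++ []) (false ∷ []) r ⟩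
  (encodeℕ p ++ true ∷ encodeℕ q ++ []) ++ false ∷ r ≡⟨ ++-assoc (encodeℕ p) _ (false ∷ r) ⟩
  encodeℕ p ++ true ∷ (encodeℕ q ++ []) ++ false ∷ r ≡⟨ cong (λ u → encodeℕ p ++ true ∷ u ++ false ∷ r) (++-identityʳ (encodeℕ q)) ⟩
  encodeℕ p ++ true ∷ encodeℕ q ++ false ∷ r ∎)
  where open ≡-Reasoning

encodeInput : ∀ n r → (encodeℕ n ++ false ∷ []) ++ r ≡ encodeℕ n ++ false ∷ r
encodeInput n r = ++-assoc (encodeℕ n) _ r

parse₀-complete : ∀ n r → parse₀ (encodeℕ n ++ false ∷ r) ≡ just (n , r)
parse₀-complete n r rewrite parseNum-complete n (false ∷ r) = refl

parse₁-complete : ∀ p r → parse₁ (true ∷ encodeℕ p ++ false ∷ r) ≡ just (p , r)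
parse₁-complete p r rewrite parseNum-complete p (false ∷ r) = refl

parseBin-complete : ∀ σ σ∈ p q r → parseBin σ σ∈ (encodeList encodeℕ (p ∷ q ∷ []) ++ r) ≡ just (binary σ σ∈ p q , r)
parseBin-complete σ σ∈ p q r = cong (_>>= λ (p , q , r) → just (binary σ σ∈ p q , r))
  (trans (cong parse₂ (encode₂ p q r)) (parse₂-complete p q r))

parseBody-complete : ∀ x r → parseBody (encodeBody x ++ r) ≡ just (x , r)
parseBody-complete (input n) r = cong (_>>= λ (n , r) → just (input n , r))
  (trans (cong parse₀ (encodeInput n r)) (parse₀-complete n r))
parseBody-complete (complement compl∈ p) r = cong (_>>= λ (p , r) → just (complement compl∈ p , r))
  (trans (cong parse₁ (encode₁ p r)) (parse₁-complete p r))
parseBody-complete (complement (there (there (there (there (there ()))))) p) r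
parseBody-complete (binary cup cup∈ p q) r   = parseBin-complete cup cup∈ p q r
parseBody-complete (binary cap cap∈ p q) r   = parseBin-complete cap cap∈ p q r
parseBody-complete (binary plus plus∈ p q) r = parseBin-complete plus plus∈ p q r
parseBody-complete (binary div div∈ p q) r   = parseBin-complete div div∈ p q r
parseBody-complete (binary cup (there (there (there (there (there ()))))) p q) r
parseBody-complete (binary cap (there (there (there (there (there ()))))) p q) r
parseBody-complete (binary plus (there (there (there (there (there ()))))) p q) r
parseBody-complete (binary div (there (there (there (there (there ()))))) p q) r
parseBody-complete (binary times (there (there (there (there (there ()))))) p q) r

parseRaw-complete : ∀ g r → parseRaw (encodeRaw g ++ r) ≡ just (g , r)
parseRaw-complete (n , x) r rewrite ++-assoc (encodeℕ n) (encodeBody x) r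
  | parseNum-complete n (encodeBody x ++ r) | parseBody-complete x r = refl

encodeRaws-∷ : ∀ g gs r → encodeRaws (g ∷ gs) ++ r ≡ true ∷ encodeRaw g ++ encodeRaws gs ++ r
encodeRaws-∷ g gs r = cong (true ∷_) (begin
  ((encodeRaw g ++ concatMap _ gs) ++ false ∷ []) ++ r ≡⟨ cong (_++ r) (++-assoc (encodeRaw g) _ _) ⟩
  (encodeRaw g ++ encodeRaws gs) ++ r ≡⟨ ++-assoc (encodeRaw g) _ r ⟩
  encodeRaw g ++ encodeRaws gs ++ r ∎)
  where open ≡-Reasoning

parseRaws-complete : ∀ gs r {k} → length gs ≤ k → parseRaws k (encodeRaws gs ++ r) ≡ just (gs , r)
parseRaws-complete []       r le = refl
parseRaws-complete (g ∷ gs) r {suc k} (s≤s le) = trans (cong (parseRaws (suc k)) (encodeRaws-∷ g gs r)) step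
  where
  step : parseRaws (suc k) (true ∷ encodeRaw g ++ encodeRaws gs ++ r) ≡ just (g ∷ gs , r)
  step rewrite parseRaw-complete g (encodeRaws gs ++ r) | parseRaws-complete gs r le = refl

parsePred-sound : ∀ v {n r} → parsePred v ≡ just (n , r) → v ≡ true ∷ encodeℕ n ++ r
parsePred-sound (true ∷ v) e = cong (true ∷_) (parseNum-sound v e)

parseEnd-sound : ∀ v {r} → parseEnd v ≡ just r → v ≡ false ∷ r
parseEnd-sound (false ∷ v) refl = refl

parse₀-sound : ∀ v {n r} → parse₀ v ≡ just (n , r) → v ≡ encodeℕ n ++ false ∷ r
parse₀-sound v e with parseNum v in eq
... | just (n , r) with parseEnd r in eq′
...   | just r′ with refl ← e = trans (parseNum-sound v eq) (cong (encodeℕ n ++_) (parseEnd-sound r eq′))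

parse₁-sound : ∀ v {n r} → parse₁ v ≡ just (n , r) → v ≡ true ∷ encodeℕ n ++ false ∷ r
parse₁-sound v e with parsePred v in eq
... | just (n , r) with parseEnd r in eq′
...   | just r′ with refl ← e = trans (parsePred-sound v eq) (cong (λ u → true ∷ encodeℕ n ++ u) (parseEnd-sound r eq′))

parse₂-sound : ∀ v {p q r} → parse₂ v ≡ just (p , q , r) → v ≡ true ∷ encodeℕ p ++ true ∷ encodeℕ q ++ false ∷ r
parse₂-sound v e with parsePred v in eq₁
... | just (p , r₁) with parsePred r₁ in eq₂
...   | just (q , r₂) with parseEnd r₂ in eq₃
...     | just r₃ with refl ← e = trans (parsePred-sound v eq₁) (cong (λ u → true ∷ encodeℕ p ++ u)
            (trans (parsePred-sound r₁ eq₂) (cong (λ u → true ∷ encodeℕ q ++ u) (parseEnd-sound r₂ eq₃))))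

parseBin-sound : ∀ σ σ∈ v {x r} → parseBin σ σ∈ v ≡ just (x , r) → encodeBinOp σ ++ v ≡ encodeBody x ++ r
parseBin-sound σ σ∈ v e with parse₂ v in eq
... | just (p , q , r) with refl ← e = trans (cong (encodeBinOp σ ++_) (trans (parse₂-sound v eq) (sym (encode₂ p q r))))
                                             (sym (++-assoc (encodeBinOp σ) _ r))

parseBody-sound : ∀ v {x r} → parseBody v ≡ just (x , r) → v ≡ encodeBody x ++ r
parseBody-sound (false ∷ false ∷ false ∷ v) e with parse₀ v in eq
... | just (n , r) with refl ← e = cong (λ u → false ∷ false ∷ false ∷ u) (trans (parse₀-sound v eq) (sym (encodeInput n r)))
parseBody-sound (false ∷ false ∷ true ∷ v) e with parse₁ v in eq
... | just (n , r) with refl ← e = cong (λ u → false ∷ false ∷ true ∷ u) (trans (parse₁-sound v eq) (sym (encode₁ n r)))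
parseBody-sound (false ∷ true ∷ false ∷ v) e = parseBin-sound cup _ v e
parseBody-sound (false ∷ true ∷ true ∷ v)  e = parseBin-sound cap _ v e
parseBody-sound (true ∷ false ∷ false ∷ v) e = parseBin-sound plus _ v e
parseBody-sound (true ∷ true ∷ false ∷ v)  e = parseBin-sound div _ v e

parseRaw-sound : ∀ v {g r} → parseRaw v ≡ just (g , r) → v ≡ encodeRaw g ++ r
parseRaw-sound v e with parseNum v in eq
... | just (n , r) with parseBody r in eq′
...   | just (x , r′) with refl ← e = trans (parseNum-sound v eq) (trans (cong (encodeℕ n ++_) (parseBody-sound r eq′))
                                            (sym (++-assoc (encodeℕ n) (encodeBody x) r′)))

parseRaws-sound : ∀ k v {gs r} → parseRaws k v ≡ just (gs , r) → v ≡ encodeRaws gs ++ r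
parseRaws-sound zero    (false ∷ v) refl = refl
parseRaws-sound (suc k) (false ∷ v) refl = refl
parseRaws-sound (suc k) (true ∷ v)  e with parseRaw v in eq
... | just (g , r) with parseRaws k r in eq′
...   | just (gs , r′) with refl ← e = trans (cong (true ∷_) (trans (parseRaw-sound v eq) (cong (encodeRaw g ++_) (parseRaws-sound k r eq′))))
                                             (sym (encodeRaws-∷ g gs r′))

-- The name of the output gate, the gates, and the number whose membership is asked.
Decoded : Set
Decoded = ℕ × List Raw × ℕ

encodeAll : Decoded → Word
encodeAll (o , gs , b) = encodeℕ o ++ encodeRaws gs ++ encodeℕ b

length-encodeRaws : ∀ gs → length gs ≤ length (encodeRaws gs)
length-encodeRaws [] = z≤n
length-encodeRaws (g ∷ gs) = s≤s (begin
  length gs ≤⟨ length-encodeRaws gs ⟩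
  length (encodeRaws gs) ≤⟨ m≤n+m _ (length (encodeRaw g)) ⟩
  length (encodeRaw g) + length (encodeRaws gs) ≡⟨ length-++ (encodeRaw g) ⟨
  length (encodeRaw g ++ encodeRaws gs) ≡⟨ cong length (++-assoc (encodeRaw g) _ _) ⟨
  length ((encodeRaw g ++ concatMap _ gs) ++ false ∷ []) ∎)
  where open ≤-Reasoning

-- Thresholds

open Equivalence using (to; from)

-- Predecessors are looked up by name among the later gates only. A reverse topological order
-- permits this, and it makes the recursion structural. A name that is not found denotes the empty
-- set.
Mem : List Raw → ℕ → Pred ℕ 0ℓ
Mem []             n x = ⊥
Mem ((m , g) ∷ gs) n x = if m ≡ᵇ n then evalGate g (λ {p} _ → Mem gs p) x else Mem gs n x

anyFrom : ℕ → ℕ → (ℕ → Bool) → Bool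
anyFrom a zero    f = false
anyFrom a (suc k) f = f a ∨ anyFrom (suc a) k f

-- Membership in a gate; arguments and values of f matter only up to M, which
-- stands for all larger numbers.
gateB : ℕ → Gate Ops ℕ → (ℕ → ℕ → Bool) → ℕ → Bool
gateB M (input n)              f x = n ≡ᵇ x
gateB M (complement _ p)       f x = not (f p x)
gateB M (binary cup _ p q)     f x = f p x ∨ f q x
gateB M (binary cap _ p q)     f x = f p x ∧ f q x
gateB M (binary plus _ p q)    f x = anyFrom 0 (suc x) (λ a → f p a ∧ f q (x ∸ a))
gateB M (binary times _ p q)   f x = false
gateB M (binary div _ p q)     f x = anyFrom 1 M (λ b → f q b ∧ f p (b * x ⊓ M))

memB : ℕ → List Raw → ℕ → ℕ → Bool
memB M []             n x = false
memB M ((m , g) ∷ gs) n x = if m ≡ᵇ n then gateB M g (memB M gs) x else memB M gs n x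

-- One number for all gates of the list. An input n contributes the factor n + 1 instead of entering
-- a maximum, so that the logarithm is additive like the length of the encoding. The start value 1
-- keeps all thresholds positive.
threshold : List Raw → ℕ
threshold []                               = 1
threshold ((_ , input n) ∷ gs)             = threshold gs * suc n
threshold ((_ , complement _ _) ∷ gs)      = threshold gs
threshold ((_ , binary plus _ _ _) ∷ gs)   = threshold gs + threshold gs
threshold ((_ , binary _ _ _ _) ∷ gs)      = threshold gs

Stable : ℕ → Pred ℕ 0ℓ → Set
Stable t P = ∀ {x} → t ≤ x → P x ⇔ P t

stable-iff : ∀ {t P x y} → Stable t P → t ≤ x → t ≤ y → P x → P y
stable-iff s t≤x t≤y = from (s t≤y) ∘ to (s t≤x)

stable-mono : ∀ {t u P} → t ≤ u → Stable t P → Stable u P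
stable-mono t≤u s u≤x = mk⇔ (stable-iff s (≤-trans t≤u u≤x) t≤u) (stable-iff s t≤u (≤-trans t≤u u≤x))

stable-cap : ∀ {t P M} x → Stable t P → t ≤ M → P x ⇔ P (x ⊓ M)
stable-cap {P = P} {M} x s t≤M with ≤-total x M
... | inj₁ x≤M rewrite m≤n⇒m⊓n≡m x≤M = mk⇔ id id
... | inj₂ M≤x rewrite m≥n⇒m⊓n≡n M≤x = mk⇔ (stable-iff s (≤-trans t≤M M≤x) t≤M) (stable-iff s t≤M (≤-trans t≤M M≤x))

threshold≥1 : ∀ gs → 1 ≤ threshold gs
threshold≥1 [] = ≤-refl
threshold≥1 ((_ , input n) ∷ gs)            = *-mono-≤ (threshold≥1 gs) (s≤s z≤n)
threshold≥1 ((_ , complement _ _) ∷ gs)     = threshold≥1 gs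
threshold≥1 ((_ , binary plus _ _ _) ∷ gs)  = ≤-trans (threshold≥1 gs) (m≤m+n _ _)
threshold≥1 ((_ , binary cup _ _ _) ∷ gs)   = threshold≥1 gs
threshold≥1 ((_ , binary cap _ _ _) ∷ gs)   = threshold≥1 gs
threshold≥1 ((_ , binary times _ _ _) ∷ gs) = threshold≥1 gs
threshold≥1 ((_ , binary div _ _ _) ∷ gs)   = threshold≥1 gs

threshold-mono : ∀ g gs → threshold gs ≤ threshold (g ∷ gs)
threshold-mono (_ , input n)            gs = m≤m*n _ (suc n)
threshold-mono (_ , complement _ _)     gs = ≤-refl
threshold-mono (_ , binary plus _ _ _)  gs = m≤m+n _ _
threshold-mono (_ , binary cup _ _ _)   gs = ≤-refl
threshold-mono (_ , binary cap _ _ _)   gs = ≤-refl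
threshold-mono (_ , binary times _ _ _) gs = ≤-refl
threshold-mono (_ , binary div _ _ _)   gs = ≤-refl

-- If one summand is below `t`, the other is at least `t` and can absorb the difference between the
-- two sums. If both are at least `t`, they may be exchanged for `t` and `z ∸ t`.
stable-plus : ∀ {t A B} → Stable t A → Stable t B → Stable (t + t) (applyOp plus A B)
stable-plus {t} {A} {B} sA sB {x} 2t≤x = mk⇔ down up
  where
  large : ∀ {a y} → t + t ≤ y → a < t → t ≤ y ∸ a
  large {a} {y} 2t≤y a<t = ≤-trans (≤-reflexive (sym (m+n∸n≡m t t))) (∸-mono 2t≤y (<⇒≤ a<t))
  transfer : ∀ {y z} → t + t ≤ y → t + t ≤ z → applyOp plus A B y → applyOp plus A B z
  transfer {z = z} 2t≤y 2t≤z (a , b , a∈ , b∈ , refl) with a <? t | b <? t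
  ... | yes a<t | _ = a , z ∸ a , a∈ ,
        stable-iff sB (≤-trans (large 2t≤y a<t) (≤-reflexive (m+n∸m≡n a b))) (large 2t≤z a<t) b∈ ,
        sym (m+[n∸m]≡n (≤-trans (<⇒≤ a<t) (≤-trans (m≤m+n t t) 2t≤z)))
  ... | no _ | yes b<t = z ∸ b , b ,
        stable-iff sA (≤-trans (large 2t≤y b<t) (≤-reflexive (m+n∸n≡m a b))) (large 2t≤z b<t) a∈ , b∈ ,
        sym (m∸n+n≡m (≤-trans (<⇒≤ b<t) (≤-trans (m≤m+n t t) 2t≤z)))
  ... | no a≮t | no b≮t = t , z ∸ t , stable-iff sA (≮⇒≥ a≮t) ≤-refl a∈ ,
        stable-iff sB (≮⇒≥ b≮t) (≤-trans (≤-reflexive (sym (m+n∸n≡m t t))) (∸-monoˡ-≤ t 2t≤z)) b∈ ,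
        sym (m+[n∸m]≡n (≤-trans (m≤m+n t t) 2t≤z))
  down : applyOp plus A B x → applyOp plus A B (t + t)
  down = transfer 2t≤x ≤-refl
  up : applyOp plus A B (t + t) → applyOp plus A B x
  up = transfer ≤-refl 2t≤x

-- The divisor `b` is kept. As it is positive, the dividends `y * b` and `z * b` are both at least
-- `t`, where `A` is constant.
stable-div : ∀ {t A B} → Stable t A → Stable t (applyOp div A B)
stable-div {t} {A} {B} sA t≤x = mk⇔ (transfer t≤x ≤-refl) (transfer ≤-refl t≤x)
  where
  transfer : ∀ {y z} → t ≤ y → t ≤ z → applyOp div A B y → applyOp div A B z
  transfer t≤y t≤z (_ , zero , _ , _ , b≢0 , _) = contradiction refl b≢0
  transfer {y} {z} t≤y t≤z (_ , b@(suc _) , a∈ , b∈ , b≢0 , refl) =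
    z * b , b , stable-iff sA (≤-trans t≤y (m≤m*n y b)) (≤-trans t≤z (m≤m*n z b)) a∈ , b∈ , b≢0 , refl

mem-stable : ∀ gs n → Stable (threshold gs) (Mem gs n)
mem-stable []             n _ = mk⇔ id id
mem-stable ((m , g) ∷ gs) n t≤x with m ≡ᵇ n
... | false = stable-mono (threshold-mono (m , g) gs) (mem-stable gs n) t≤x
... | true  = go g t≤x
  where
  t = threshold gs
  go : ∀ g → Stable (threshold ((m , g) ∷ gs)) (evalGate g (λ {p} _ → Mem gs p))
  go (input k) {x} t≤x = mk⇔ (λ { refl → contradiction t≤x (<⇒≱ (n<thr t (threshold≥1 gs))) })
                             (λ e → contradiction (≤-reflexive (sym e)) (<⇒≱ (n<thr t (threshold≥1 gs))))
    where
    n<thr : ∀ t → 1 ≤ t → k < t * suc k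
    n<thr t 1≤t = ≤-trans (≤-reflexive (sym (*-identityˡ (suc k)))) (*-monoˡ-≤ (suc k) 1≤t)
  go (complement _ p) t≤x = mk⇔ (_∘ from (mem-stable gs p t≤x)) (_∘ to (mem-stable gs p t≤x))
  go (binary cup _ p q) t≤x =
    mk⇔ (Sum.map (to (mem-stable gs p t≤x)) (to (mem-stable gs q t≤x)))
        (Sum.map (from (mem-stable gs p t≤x)) (from (mem-stable gs q t≤x)))
  go (binary cap _ p q) t≤x =
    mk⇔ (λ (a , b) → to (mem-stable gs p t≤x) a , to (mem-stable gs q t≤x) b)
        (λ (a , b) → from (mem-stable gs p t≤x) a , from (mem-stable gs q t≤x) b)
  go (binary plus _ p q) = stable-plus (mem-stable gs p) (mem-stable gs q)
  go (binary times (there (there (there (there (there ()))))) p q)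
  go (binary div _ p q) = stable-div {B = Mem gs q} (mem-stable gs p)

T-∨ : ∀ {a b} {P Q : Set} → T a ⇔ P → T b ⇔ Q → T (a ∨ b) ⇔ (P ⊎ Q)
T-∨ {true}  f g = mk⇔ (λ _ → inj₁ (to f tt)) _
T-∨ {false} f g = mk⇔ (inj₂ ∘ to g) λ { (inj₁ p) → ⊥-elim (from f p) ; (inj₂ q) → from g q }

T-∧ : ∀ {a b} {P Q : Set} → T a ⇔ P → T b ⇔ Q → T (a ∧ b) ⇔ (P × Q)
T-∧ {true}  f g = mk⇔ (λ b → to f tt , to g b) (from g ∘ proj₂)
T-∧ {false} f g = mk⇔ (λ ()) (from f ∘ proj₁)

T-not : ∀ {a} {P : Set} → T a ⇔ P → T (not a) ⇔ (¬ P)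
T-not {true}  f = mk⇔ (λ ()) (λ ¬p → ¬p (to f tt))
T-not {false} f = mk⇔ (λ _ p → from f p) _

T-any : ∀ a k f → T (anyFrom a k f) ⇔ (∃[ i ] (a ≤ i × i < a + k × T (f i)))
T-any a zero    f = mk⇔ (λ ()) λ (i , a≤i , i< , _) → contradiction a≤i (<⇒≱ (≤-trans i< (≤-reflexive (+-identityʳ a))))
T-any a (suc k) f = mk⇔ there′ back
  where
  there′ : T (f a ∨ anyFrom (suc a) k f) → ∃[ i ] (a ≤ i × i < a + suc k × T (f i))
  there′ t with f a in eq
  ... | true  = a , ≤-refl , ≤-trans (s≤s (m≤m+n a k)) (≤-reflexive (sym (+-suc a k))) , subst T (sym eq) tt
  ... | false with i , a<i , i< , fi ← to (T-any (suc a) k f) t =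
    i , <⇒≤ a<i , ≤-trans i< (≤-reflexive (sym (+-suc a k))) , fi
  back : (∃[ i ] (a ≤ i × i < a + suc k × T (f i))) → T (f a ∨ anyFrom (suc a) k f)
  back (i , a≤i , i< , fi) with m≤n⇒m<n∨m≡n a≤i
  ... | inj₂ refl = from (T-∨ {f a} {P = T (f a)} {Q = T (anyFrom (suc a) k f)} (mk⇔ id id) (mk⇔ id id)) (inj₁ fi)
  ... | inj₁ a<i = from (T-∨ {f a} {P = T (f a)} {Q = T (anyFrom (suc a) k f)} (mk⇔ id id) (mk⇔ id id))
         (inj₂ (from (T-any (suc a) k f) (i , a<i , ≤-trans i< (≤-reflexive (+-suc a k)) , fi)))

-- If `b` reaches `M` and `x` is positive, both products reach `M`; if `x` is zero, both vanish.
-- This allows a divisor to be replaced by its minimum with `M`.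
cap-* : ∀ b x M → (b ⊓ M) * x ⊓ M ≡ b * x ⊓ M
cap-* b zero    M rewrite *-zeroʳ b | *-zeroʳ (b ⊓ M) = refl
cap-* b (suc x) M with ≤-total b M
... | inj₁ b≤M rewrite m≤n⇒m⊓n≡m b≤M = refl
... | inj₂ M≤b rewrite m≥n⇒m⊓n≡n M≤b =
  trans (m≥n⇒m⊓n≡n (m≤m*n M (suc x))) (sym (m≥n⇒m⊓n≡n (≤-trans M≤b (m≤m*n b (suc x)))))

-- Summands of `x` never exceed `x`, so a sum stays below the cap by itself. A division leaves the
-- range with divisor and dividend; stability of the operands lets both be cut down to `M`, and
-- `cap-*` shows that the two cuts are compatible.
mem-correct : ∀ M gs n x → threshold gs ≤ M → x ≤ M → T (memB M gs n x) ⇔ Mem gs n x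
mem-correct M []             n x t≤M x≤M = mk⇔ id id
mem-correct M ((m , g) ∷ gs) n x t≤M x≤M with m ≡ᵇ n
... | false = mem-correct M gs n x (≤-trans (threshold-mono (m , g) gs) t≤M) x≤M
... | true  = go g
  where
  t≤ : threshold gs ≤ M
  t≤ = ≤-trans (threshold-mono (m , g) gs) t≤M
  IH : ∀ p {y} → y ≤ M → T (memB M gs p y) ⇔ Mem gs p y
  IH p {y} = mem-correct M gs p y t≤
  go : ∀ g → T (gateB M g (memB M gs) x) ⇔ evalGate g (λ {p} _ → Mem gs p) x
  go (input k)          = mk⇔ (≡ᵇ⇒≡ k x) (≡⇒≡ᵇ k x)
  go (complement _ p)   = T-not (IH p x≤M)
  go (binary cup _ p q) = T-∨ (IH p x≤M) (IH q x≤M)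
  go (binary cap _ p q) = T-∧ (IH p x≤M) (IH q x≤M)
  go (binary plus _ p q) = mk⇔ sound complete
    where
    sound : T (anyFrom 0 (suc x) (λ a → memB M gs p a ∧ memB M gs q (x ∸ a))) → applyOp plus (Mem gs p) (Mem gs q) x
    sound t with a , _ , s≤s a≤x , ab ← to (T-any 0 (suc x) _) t
            with a∈ , b∈ ← to (T-∧ (IH p (≤-trans a≤x x≤M)) (IH q (≤-trans (m∸n≤m x a) x≤M))) ab
            = a , x ∸ a , a∈ , b∈ , sym (m+[n∸m]≡n a≤x)
    complete : applyOp plus (Mem gs p) (Mem gs q) x → T (anyFrom 0 (suc x) (λ a → memB M gs p a ∧ memB M gs q (x ∸ a)))
    complete (a , b , a∈ , b∈ , refl) = from (T-any 0 (suc x) _) (a , z≤n , s≤s (m≤m+n a b) ,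
      from (T-∧ (IH p (≤-trans (m≤m+n a b) x≤M)) (IH q (≤-trans (m∸n≤m (a + b) a) x≤M)))
        (a∈ , subst (Mem gs q) (sym (m+n∸m≡n a b)) b∈))
  go (binary times (there (there (there (there (there ()))))) p q)
  go (binary div _ p q) = mk⇔ sound complete
    where
    sound : T (anyFrom 1 M (λ b → memB M gs q b ∧ memB M gs p (b * x ⊓ M))) → applyOp div (Mem gs p) (Mem gs q) x
    sound t with b , 1≤b , s≤s b≤M , ab ← to (T-any 1 M _) t
            with b∈ , a∈ ← to (T-∧ (IH q b≤M) (IH p (m⊓n≤n (b * x) M))) ab
            = x * b , b , subst (Mem gs p) (*-comm b x) (from (stable-cap (b * x) (mem-stable gs p) t≤) a∈) , b∈ ,
              (λ { refl → contradiction 1≤b λ () }) , refl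
    complete : applyOp div (Mem gs p) (Mem gs q) x → T (anyFrom 1 M (λ b → memB M gs q b ∧ memB M gs p (b * x ⊓ M)))
    complete (_ , zero , a∈ , b∈ , b≢0 , _) = contradiction refl b≢0
    complete (_ , b@(suc _) , a∈ , b∈ , b≢0 , refl) = from (T-any 1 M _) (b ⊓ M ,
      -- Thresholds are positive, hence so is `M`, and the capped divisor remains nonzero.
      ⊓-glb (s≤s z≤n) (≤-trans (threshold≥1 gs) t≤) , s≤s (m⊓n≤n b M) ,
      from (T-∧ (IH q (m⊓n≤n b M)) (IH p (m⊓n≤n ((b ⊓ M) * x) M)))
        (to (stable-cap b (mem-stable gs q) t≤) b∈ ,
         subst (Mem gs p) (trans (cong (_⊓ M) (*-comm x b)) (sym (cap-* b x M))) (to (stable-cap (x * b) (mem-stable gs p) t≤) a∈)))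

-- Each gate pays with its own bits: the factor 2 of a sum with the bit announcing the gate, the
-- factor n + 1 of an input with the digits of n, which appear in its encoding.
threshold-bound : ∀ gs → threshold gs ≤ 2 ^ length (encodeRaws gs)
threshold-bound [] = s≤s z≤n
threshold-bound (g ∷ gs) = ≤-trans (go g) (≤-reflexive (cong (2 ^_) (sym (cong suc (begin
    length ((encodeRaw g ++ _) ++ false ∷ []) ≡⟨ cong length (++-assoc (encodeRaw g) _ _) ⟩
    length (encodeRaw g ++ encodeRaws gs) ≡⟨ length-++ (encodeRaw g) ⟩
    length (encodeRaw g) + length (encodeRaws gs) ∎)))))
  where
  open ≡-Reasoning
  t = threshold gs
  L = length (encodeRaws gs)
  IH : t ≤ 2 ^ L
  IH = threshold-bound gs
  wide : ∀ k → t ≤ 2 ^ (k + L)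
  wide k = ≤-trans IH (^-monoʳ-≤ 2 (m≤n+m L k))
  double : ∀ k → t + t ≤ 2 ^ suc (k + L)
  double k = +-mono-≤ (wide k) (≤-trans (wide k) (≤-reflexive (sym (+-identityʳ _))))
  spread-length : ∀ ds → length ds ≤ length (spread ds)
  spread-length []       = z≤n
  spread-length (d ∷ ds) = s≤s (m≤n⇒m≤1+n (spread-length ds))
  go : ∀ g → threshold (g ∷ gs) ≤ 2 ^ suc (length (encodeRaw g) + L)
  go (m , input k) = begin′
    where
    e = encodeRaw (m , input k)
    digits≤ : length (binaryDigits k) ≤ length e
    digits≤ = ≤-trans (spread-length (binaryDigits k)) (≤-trans (m≤m+n _ 1) (≤-trans (≤-reflexive (sym (length-++ (spread (binaryDigits k)))))
      (≤-trans (m≤m+n (length (encodeℕ k)) 1) (≤-trans (≤-reflexive (sym (length-++ (encodeℕ k) {false ∷ []})))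
      (≤-trans (m≤n+m _ (3 + length (encodeℕ m))) (≤-reflexive (sym (trans (length-++ (encodeℕ m)) (trans (+-suc _ _) (cong suc (trans (+-suc _ _) (cong suc (+-suc _ _)))))))))))))
    begin′ : threshold ((m , input k) ∷ gs) ≤ 2 ^ suc (length e + L)
    begin′ = ≤-trans (*-mono-≤ IH (≤-trans (digits-bound k) (^-monoʳ-≤ 2 digits≤)))
      (≤-trans (≤-reflexive (sym (^-distribˡ-+-* 2 L (length e)))) (^-monoʳ-≤ 2 (≤-trans (≤-reflexive (+-comm L (length e))) (n≤1+n _))))
  go (m , x@(complement _ _))     = wide (suc (length (encodeRaw (m , x))))
  go (m , x@(binary cup _ _ _))   = wide (suc (length (encodeRaw (m , x))))
  go (m , x@(binary cap _ _ _))   = wide (suc (length (encodeRaw (m , x))))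
  go (m , x@(binary times _ _ _)) = wide (suc (length (encodeRaw (m , x))))
  go (m , x@(binary div _ _ _))   = wide (suc (length (encodeRaw (m , x))))
  go (m , x@(binary plus _ _ _))  = double (length (encodeRaw (m , x)))

-- A word of length l is only known to have a value of at least 2^l - 1. The bit of `u` provides one
-- more doubling, which makes up for the missing 1.
threshold-≤-val : ∀ u gs v → 1 ≤ length u → threshold gs ≤ val (u ++ encodeRaws gs ++ v)
threshold-≤-val u gs v 1≤u = ≤-pred (begin
  suc (threshold gs) ≤⟨ s≤s (threshold-bound gs) ⟩
  suc (2 ^ L) ≤⟨ +-monoˡ-≤ (2 ^ L) (m^n>0 2 L) ⟩
  2 ^ L + 2 ^ L ≡⟨ cong (2 ^ L +_) (+-identityʳ (2 ^ L)) ⟨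
  2 ^ suc L ≤⟨ ^-monoʳ-≤ 2 L< ⟩
  2 ^ length (u ++ encodeRaws gs ++ v) ≤⟨ 2^-≤-val (u ++ encodeRaws gs ++ v) ⟩
  suc (val (u ++ encodeRaws gs ++ v)) ∎)
  where
  open ≤-Reasoning
  L = length (encodeRaws gs)
  L< : suc L ≤ length (u ++ encodeRaws gs ++ v)
  L< = begin
    1 + L ≤⟨ +-mono-≤ 1≤u (m≤m+n L (length v)) ⟩
    length u + (L + length v) ≡⟨ cong (length u +_) (length-++ (encodeRaws gs)) ⟨
    length u + length (encodeRaws gs ++ v) ≡⟨ length-++ u ⟨
    length (u ++ encodeRaws gs ++ v) ∎

-- Circuits as lists of gates

mapGate : ∀ {O} {G H : Set} → (G → H) → Gate O G → Gate O H
mapGate f (input n)         = input n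
mapGate f (complement e p)  = complement e (f p)
mapGate f (binary σ e p q)  = binary σ e (f p) (f q)

preds-mapGate : ∀ {O} {G H : Set} (f : G → H) (x : Gate O G) → preds (mapGate f x) ≡ map f (preds x)
preds-mapGate f (input n)        = refl
preds-mapGate f (complement e p) = refl
preds-mapGate f (binary σ e p q) = refl

hasName : ℕ → List Raw → Bool
hasName n []             = false
hasName n ((m , _) ∷ gs) = (m ≡ᵇ n) ∨ hasName n gs

-- Requiring the predecessors to be among the gates that follow yields acyclicity and the reverse
-- topological order at once; the comparison is the condition `sorted`.
okB : List Raw → Gate Ops ℕ → Bool
okB gs (input _)        = true
okB gs (complement _ p) = hasName p gs
okB gs (binary _ _ p q) = hasName p gs ∧ (hasName q gs ∧ (p ≤ᵇ q))

validB : List Raw → Bool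
validB []             = true
validB ((n , x) ∷ gs) = not (hasName n gs) ∧ (okB gs x ∧ validB gs)

T-id : ∀ {a} → T a ⇔ T a
T-id = mk⇔ id id

split-∧ : ∀ a {b} → T (a ∧ b) → T a × T b
split-∧ a = to (T-∧ {a} T-id T-id)

T-≡ᵇ : ∀ {m n} → T (m ≡ᵇ n) ⇔ m ≡ n
T-≡ᵇ {m} {n} = mk⇔ (≡ᵇ⇒≡ m n) (≡⇒≡ᵇ m n)

≡ᵇ-refl : ∀ n → (n ≡ᵇ n) ≡ true
≡ᵇ-refl zero    = refl
≡ᵇ-refl (suc n) = ≡ᵇ-refl n

≢⇒≡ᵇ-false : ∀ {m n} → m ≢ n → (m ≡ᵇ n) ≡ false
≢⇒≡ᵇ-false {m} {n} m≢n with m ≡ᵇ n in eq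
... | true  = contradiction (≡ᵇ⇒≡ m n (subst T (sym eq) tt)) m≢n
... | false = refl

evalGate-cong : ∀ {O} {G H : Set} (f : G → H) (x : Gate O G) (I : ∀ {p} → p ∈ˡ preds x → Pred ℕ 0ℓ) (J : H → Pred ℕ 0ℓ) →
                (∀ {p} (e : p ∈ˡ preds x) y → I e y ⇔ J (f p) y) → ∀ y →
                evalGate x I y ⇔ evalGate (mapGate f x) (λ {p} _ → J p) y
evalGate-cong f (input n) I J h y = mk⇔ id id
evalGate-cong f (complement _ p) I J h y = mk⇔ (_∘ from (h (here refl) y)) (_∘ to (h (here refl) y))
evalGate-cong f (binary σ _ p q) I J h y = go σ
  where
  P = h (here refl)
  Q = h (there (here refl))
  go : ∀ σ → applyOp σ (I (here refl)) (I (there (here refl))) y ⇔ applyOp σ (J (f p)) (J (f q)) y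
  go cup   = mk⇔ (Sum.map (to (P y)) (to (Q y))) (Sum.map (from (P y)) (from (Q y)))
  go cap   = mk⇔ (λ (a , b) → to (P y) a , to (Q y) b) (λ (a , b) → from (P y) a , from (Q y) b)
  go plus  = mk⇔ (λ (a , b , a∈ , b∈ , e) → a , b , to (P a) a∈ , to (Q b) b∈ , e)
                 (λ (a , b , a∈ , b∈ , e) → a , b , from (P a) a∈ , from (Q b) b∈ , e)
  go times = mk⇔ (λ (a , b , a∈ , b∈ , e) → a , b , to (P a) a∈ , to (Q b) b∈ , e)
                 (λ (a , b , a∈ , b∈ , e) → a , b , from (P a) a∈ , from (Q b) b∈ , e)
  go div   = mk⇔ (λ (a , b , a∈ , b∈ , e) → a , b , to (P a) a∈ , to (Q b) b∈ , e)
                 (λ (a , b , a∈ , b∈ , e) → a , b , from (P a) a∈ , from (Q b) b∈ , e)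

module _ (C : Circuit Ops) where
  open Circuit C

  toRaw : Fin size → Raw
  toRaw g = name g , mapGate name (gate g)

  raws : List Raw
  raws = tabulate toRaw

  -- A final segment of a reverse topological numbering contains the
  -- predecessors of its gates.
  Segment : ∀ {m} → (Fin m → Fin size) → Set
  Segment e = Injective _≡_ _≡_ e × (∀ j {p} → p ⟶ e j → ∃[ i ] (j <ᶠ i × e i ≡ p))

  segment-suc : ∀ {m} {e : Fin (suc m) → Fin size} → Segment e → Segment (e ∘ suc)
  segment-suc {e = e} (inj , closed) = F.suc-injective ∘ inj , closed′
    where
    closed′ : ∀ j {p} → p ⟶ e (suc j) → ∃[ i ] (j <ᶠ i × e (suc i) ≡ p)
    closed′ j e with closed (suc j) e
    ... | suc i , s≤s j<i , eq = i , j<i , eq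

  hasName-segment : ∀ {m} (e : Fin m → Fin size) n → T (hasName n (tabulate (toRaw ∘ e))) ⇔ (∃[ j ] name (e j) ≡ n)
  hasName-segment {zero}  e n = mk⇔ (λ ()) λ ()
  hasName-segment {suc m} e n = mk⇔
    (λ t → Sum.[ (λ eq → zero , eq) , (λ (j , eq) → suc j , eq) ] (to both t))
    (λ { (zero , eq) → from both (inj₁ eq) ; (suc j , eq) → from both (inj₂ (j , eq)) })
    where both = T-∨ (T-≡ᵇ {name (e zero)} {n}) (hasName-segment (e ∘ suc) n)

  pred-segment : ∀ {m} {e : Fin (suc m) → Fin size} → Segment e → ∀ {p} → p ⟶ e zero → ∃[ i ] e (suc i) ≡ p
  pred-segment (_ , closed) q with closed zero q
  ... | suc i , _ , eq = i , eq

  valid-segment : ∀ {m} (e : Fin m → Fin size) → Segment e → T (validB (tabulate (toRaw ∘ e)))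
  valid-segment {zero}  e s = tt
  valid-segment {suc m} e s = from (T-∧ (T-not (hasName-segment (e ∘ suc) _)) (T-∧ T-id T-id))
    (fresh , ok (gate (e zero)) (sorted (e zero)) named , valid-segment (e ∘ suc) (segment-suc s))
    where
    fresh : ¬ (∃[ j ] name (e (suc j)) ≡ name (e zero))
    fresh (j , eq) = contradiction (proj₁ s (name-injective eq)) λ ()
    gs = tabulate (toRaw ∘ e ∘ suc)
    named : ∀ {p} → p ⟶ e zero → T (hasName (name p) gs)
    named q with i , refl ← pred-segment s q = from (hasName-segment (e ∘ suc) _) (i , refl)
    ok : ∀ x → Linked _≤_ (map name (preds x)) → (∀ {p} → p ∈ˡ preds x → T (hasName (name p) gs)) → T (okB gs (mapGate name x))
    ok (input _)        _         h = tt
    ok (complement _ p) _         h = h (here refl)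
    ok (binary _ _ p q) (le ∷ _)  h = from (T-∧ T-id (T-∧ T-id T-id)) (h (here refl) , h (there (here refl)) , ≤⇒≤ᵇ le)

  -- The accessibility proof is arbitrary because `resultAcc` passes on `rs` of an edge. The first
  -- gate of a segment has its predecessors in the tail, where `Mem` searches by name; injectivity
  -- of the names makes the search hit the right gate.
  result-segment : ∀ {m} (e : Fin m → Fin size) → Segment e → ∀ j (a : Acc _⟶_ (e j)) x →
                   resultAcc C (e j) a x ⇔ Mem (tabulate (toRaw ∘ e)) (name (e j)) x
  result-segment {suc m} e s zero (accessible rs) x rewrite ≡ᵇ-refl (name (e zero)) =
    evalGate-cong name (gate (e zero)) _ (Mem (tabulate (toRaw ∘ e ∘ suc))) IH x
    where
    IH : ∀ {p} (q : p ⟶ e zero) y → resultAcc C p (rs q) y ⇔ Mem (tabulate (toRaw ∘ e ∘ suc)) (name p) y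
    IH q y with i , refl ← pred-segment s q = result-segment (e ∘ suc) (segment-suc s) i (rs q) y
  result-segment {suc m} e s (suc j) a x
    rewrite ≢⇒≡ᵇ-false {name (e zero)} {name (e (suc j))} (λ eq → contradiction (proj₁ s (name-injective eq)) λ ()) =
    result-segment (e ∘ suc) (segment-suc s) j a x

  module _ (rt : ReverseTopological C) where

    all-segment : Segment id
    all-segment = id , λ j {p} q → p , rt q , refl

    raws-valid : T (validB raws)
    raws-valid = valid-segment id all-segment

    raws-output : T (hasName (name output) raws)
    raws-output = from (hasName-segment id _) (output , refl)

    raws-result : ∀ x → result C x ⇔ Mem raws (name output) x
    raws-result = result-segment id all-segment output (⟶-wellFounded output)

  encodeList-map : {A : Set} (f : A → List Bool) (g : A → Raw) (xs : List A) → (∀ x → f x ≡ encodeRaw (g x)) →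
                   encodeList f xs ≡ encodeRaws (map g xs)
  encodeList-map f g xs h = cong (λ l → concat l ++ false ∷ [])
    (trans (map-cong (λ x → cong (true ∷_) (h x)) xs) (map-∘ xs))

  encode-raws : encodeCircuit C ≡ encodeℕ (name output) ++ encodeRaws raws
  encode-raws = cong (encodeℕ (name output) ++_)
    (trans (encodeList-map _ toRaw (allFin size) same) (cong encodeRaws (map-tabulate id toRaw)))
    where
    body : ∀ x → encodeLabel x ++ encodeList (λ p → encodeℕ (name p)) (preds x) ≡ encodeBody (mapGate name x)
    body (input n)        = refl
    body (complement _ _) = refl
    body (binary _ _ _ _) = refl
    same : ∀ g → encodeℕ (name g) ++ encodeLabel (gate g) ++ encodeList (λ p → encodeℕ (name p)) (preds (gate g)) ≡ encodeRaw (toRaw g)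
    same g = cong (encodeℕ (name g) ++_) (body (gate g))

index : ∀ n gs → T (hasName n gs) → Fin (length gs)
index n ((m , _) ∷ gs) t with m ≡ᵇ n
... | true  = zero
... | false = suc (index n gs t)

nameOf : (gs : List Raw) → Fin (length gs) → ℕ
nameOf gs i = proj₁ (List.lookup gs i)

nameOf-index : ∀ n gs t → nameOf gs (index n gs t) ≡ n
nameOf-index n []             ()
nameOf-index n ((m , _) ∷ gs) t with m ≡ᵇ n in eq
... | true  = ≡ᵇ⇒≡ m n (subst T (sym eq) tt)
... | false = nameOf-index n gs t

hasName-nameOf : ∀ gs i → T (hasName (nameOf gs i) gs)
hasName-nameOf ((m , _) ∷ gs) zero    = from (T-∨ (T-≡ᵇ {m} {m}) (T-id {hasName m gs})) (inj₁ refl)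
hasName-nameOf ((m , _) ∷ gs) (suc i) = from (T-∨ (T-≡ᵇ {m} {nameOf gs i}) (T-id {hasName (nameOf gs i) gs})) (inj₂ (hasName-nameOf gs i))

valid-∷ : ∀ n x gs → T (validB ((n , x) ∷ gs)) → ¬ T (hasName n gs) × T (okB gs x) × T (validB gs)
valid-∷ n x gs v with a , bc ← split-∧ (not (hasName n gs)) v = to (T-not {hasName n gs} T-id) a , split-∧ (okB gs x) bc

resolve : ∀ gs x → T (okB gs x) → Gate Ops (Fin (length gs))
resolve gs (input n)        ok = input n
resolve gs (complement e p) ok = complement e (index p gs ok)
resolve gs (binary σ e p q) ok = binary σ e (index p gs (proj₁ ok′)) (index q gs (proj₁ (split-∧ (hasName q gs) (proj₂ ok′))))
  where ok′ = split-∧ (hasName p gs) ok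

resolve-name : ∀ gs x ok → mapGate (nameOf gs) (resolve gs x ok) ≡ x
resolve-name gs (input n)        ok = refl
resolve-name gs (complement e p) ok = cong (complement e) (nameOf-index p gs ok)
resolve-name gs (binary σ e p q) ok = cong₂ (binary σ e) (nameOf-index p gs (proj₁ ok′)) (nameOf-index q gs (proj₁ (split-∧ (hasName q gs) (proj₂ ok′))))
  where ok′ = split-∧ (hasName p gs) ok

gates : ∀ gs → T (validB gs) → Fin (length gs) → Gate Ops (Fin (length gs))
gates ((n , x) ∷ gs) v zero    = mapGate suc (resolve gs x (proj₁ (proj₂ (valid-∷ n x gs v))))
gates ((n , x) ∷ gs) v (suc i) = mapGate suc (gates gs (proj₂ (proj₂ (valid-∷ n x gs v))) i)

mapGate-∘ : ∀ {O} {G H K : Set} (f : H → K) (g : G → H) (x : Gate O G) → mapGate f (mapGate g x) ≡ mapGate (f ∘ g) x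
mapGate-∘ f g (input _)        = refl
mapGate-∘ f g (complement _ _) = refl
mapGate-∘ f g (binary _ _ _ _) = refl

gates-name : ∀ gs v i → mapGate (nameOf gs) (gates gs v i) ≡ proj₂ (List.lookup gs i)
gates-name ((n , x) ∷ gs) v zero    = trans (mapGate-∘ (nameOf ((n , x) ∷ gs)) suc (resolve gs x ok)) (resolve-name gs x ok)
  where ok = proj₁ (proj₂ (valid-∷ n x gs v))
gates-name ((n , x) ∷ gs) v (suc i) = trans (mapGate-∘ (nameOf ((n , x) ∷ gs)) suc (gates gs v′ i)) (gates-name gs v′ i)
  where v′ = proj₂ (proj₂ (valid-∷ n x gs v))

preds-suc : ∀ {O n p} (x : Gate O (Fin n)) → p ∈ˡ preds (mapGate suc x) → ∃[ q ] (q ∈ˡ preds x × p ≡ suc q)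
preds-suc (complement _ p) (here refl)         = p , here refl , refl
preds-suc (binary _ _ p q) (here refl)         = p , here refl , refl
preds-suc (binary _ _ p q) (there (here refl)) = q , there (here refl) , refl

-- Names are resolved in the tail of the list and the resulting indices are shifted by `suc`. This
-- gives both acyclicity and the reverse topological order of the reconstructed circuit.
gates-later : ∀ gs v i {p} → p ∈ˡ preds (gates gs v i) → i <ᶠ p
gates-later ((n , x) ∷ gs) v zero    e with _ , _ , refl ← preds-suc (resolve gs x (proj₁ (proj₂ (valid-∷ n x gs v)))) e = s≤s z≤n
gates-later ((n , x) ∷ gs) v (suc i) e with _ , e′ , refl ← preds-suc (gates gs (proj₂ (proj₂ (valid-∷ n x gs v))) i) e = s≤s (gates-later gs (proj₂ (proj₂ (valid-∷ n x gs v))) i e′)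

gates-sorted : ∀ gs → T (validB gs) → ∀ i → Linked _≤_ (preds (proj₂ (List.lookup gs i)))
gates-sorted ((n , x) ∷ gs) v zero = go x (proj₁ (proj₂ (valid-∷ n x gs v)))
  where
  go : ∀ x → T (okB gs x) → Linked _≤_ (preds x)
  go (input _)        ok = []
  go (complement _ _) ok = [-]
  go (binary _ _ p q) ok =
    ≤ᵇ⇒≤ p q (proj₂ (split-∧ (hasName q gs) (proj₂ (split-∧ (hasName p gs) ok)))) ∷ [-]
gates-sorted ((n , x) ∷ gs) v (suc i) = gates-sorted gs (proj₂ (proj₂ (valid-∷ n x gs v))) i

nameOf-injective : ∀ gs → T (validB gs) → Injective _≡_ _≡_ (nameOf gs)
nameOf-injective ((n , x) ∷ gs) v {zero}  {zero}  e = refl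
nameOf-injective ((n , x) ∷ gs) v {zero}  {suc j} e =
  contradiction (subst (λ m → T (hasName m gs)) (sym e) (hasName-nameOf gs j)) (proj₁ (valid-∷ n x gs v))
nameOf-injective ((n , x) ∷ gs) v {suc i} {zero}  e =
  contradiction (subst (λ m → T (hasName m gs)) e (hasName-nameOf gs i)) (proj₁ (valid-∷ n x gs v))
nameOf-injective ((n , x) ∷ gs) v {suc i} {suc j} e = cong suc (nameOf-injective gs (proj₂ (proj₂ (valid-∷ n x gs v))) e)

fromRaws : ∀ gs o → T (validB gs) → T (hasName o gs) → Circuit Ops
fromRaws gs o v t = record
  { size           = length gs
  ; name           = nameOf gs
  ; name-injective = nameOf-injective gs v
  ; gate           = gates gs v
  ; sorted         = λ g → subst (Linked _≤_) (trans (cong preds (sym (gates-name gs v g))) (preds-mapGate (nameOf gs) (gates gs v g)))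
                             (gates-sorted gs v g)
  ; output         = index o gs t
  ; acyclic        = λ g c → <-irrefl refl (closure c)
  }
  where
  closure : ∀ {p g} → TransClosure (λ p g → p ∈ˡ preds (gates gs v g)) p g → g <ᶠ p
  closure {g = g} [ e ]           = gates-later gs v g e
  closure         (_∷_ {y = y} e c) = <-trans (closure c) (gates-later gs v y e)

fromRaws-raws : ∀ gs o v t → raws (fromRaws gs o v t) ≡ gs
fromRaws-raws gs o v t = trans (tabulate-cong (λ i → cong (nameOf gs i ,_) (gates-name gs v i))) (tabulate-lookup gs)

fromRaws-reverse : ∀ gs o v t → ReverseTopological (fromRaws gs o v t)
fromRaws-reverse gs o v t {g = g} e = gates-later gs v g e

-- This eliminates circuits from the problem. The position in the list plays the part of the
-- numbering, and the Boolean tests express what `Circuit` and `ReverseTopological` demand.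
MC-raws : ∀ w → w ∈ MC Ops ⇔
  (∃[ o ] ∃[ gs ] ∃[ b ] (w ≡ encodeAll (o , gs , b) × T (validB gs) × T (hasName o gs) × Mem gs o b))
MC-raws w = mk⇔
  (λ { (C , b , rt , refl , b∈) → let o = Circuit.name C (Circuit.output C) in o , raws C , b ,
    trans (cong (_++ encodeℕ b) (encode-raws C)) (++-assoc (encodeℕ o) (encodeRaws (raws C)) (encodeℕ b)) ,
    raws-valid C rt , raws-output C rt , to (raws-result C rt b) b∈ })
  (λ { (o , gs , b , refl , v , t , b∈) →
    let C = fromRaws gs o v t
        rt : ReverseTopological C
        rt = λ {p} {g} → fromRaws-reverse gs o v t {p} {g}
    in C , b , (λ {p} {g} → rt {p} {g}) ,
    trans (sym (++-assoc (encodeℕ o) (encodeRaws gs) (encodeℕ b)))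
      (cong (_++ encodeℕ b) (sym (trans (encode-raws C)
        (cong₂ (λ n gs → encodeℕ n ++ encodeRaws gs) {x = nameOf gs (index o gs t)} (nameOf-index o gs t) (fromRaws-raws gs o v t))))) ,
    from (raws-result C (λ {p} {g} → rt {p} {g}) b)
      (subst₂ (λ n gs → Mem gs n b) (sym (nameOf-index o gs t)) (sym (fromRaws-raws gs o v t)) b∈) })

-- The decision procedure

private variable
  n k z : ℕ
  ρ : Vec Word n

Term : ℕ → ℕ → Set
Term = Tm 4

x₀ : Term (1 + n) 1
x₀ = var zero
x₁ : Term (2 + n) 1
x₁ = var (suc zero)
x₂ : Term (3 + n) 1
x₂ = var (suc (suc zero))
x₃ : Term (4 + n) 1
x₃ = var (suc (suc (suc zero)))
x₄ : Term (5 + n) 1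
x₄ = var (suc (suc (suc (suc zero))))
x₅ : Term (6 + n) 1
x₅ = var (suc (suc (suc (suc (suc zero)))))
x₆ : Term (7 + n) 1
x₆ = var (suc (suc (suc (suc (suc (suc zero))))))
x₇ : Term (8 + n) 1
x₇ = var (suc (suc (suc (suc (suc (suc (suc zero)))))))
x₈ : Term (9 + n) 1
x₈ = var (suc (suc (suc (suc (suc (suc (suc (suc zero))))))))
x₉ : Term (10 + n) 1
x₉ = var (suc (suc (suc (suc (suc (suc (suc (suc (suc zero)))))))))
x₁₀ : Term (11 + n) 1
x₁₀ = var (suc (suc (suc (suc (suc (suc (suc (suc (suc (suc zero))))))))))
x₁₂ : Term (13 + n) 1
x₁₂ = var (suc (suc (suc (suc (suc (suc (suc (suc (suc (suc (suc (suc zero))))))))))))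
x₁₃ : Term (14 + n) 1
x₁₃ = var (suc (suc (suc (suc (suc (suc (suc (suc (suc (suc (suc (suc (suc zero)))))))))))))

-- Truth values are represented by the words true ∷ [] and [].
yesT noT : Term n 1
yesT = cons true nil
noT  = nil

ifT′ ifZero : Term n 1 → Term n k → Term n k → Term n k
ifT′ t a b   = caseOf t b b a
ifZero t a b = caseOf t a b b

-- The variables of these terms are x, y; for the capped operations, the last
-- variable is the cap.
monusT eqT leT : Term (2 + n) 1
monusT = bind (loop some (x₁ ⊗ x₀) (dec x₀ ⊗ dec x₁)) x₁
eqT = ifZero monusT (ifZero (bind (x₁ ⊗ x₀) monusT) yesT noT) noT
leT = ifZero monusT yesT noT

addT mulT : Term (3 + n) 1
addT = bind (loop some (x₁ ⊗ x₀) (dec x₀ ⊗ ifT′ (bind (x₄ ⊗ x₁) leT) x₁ (inc x₁))) x₁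
mulT = bind (loop some (x₀ ⊗ nil) (dec x₀ ⊗ bind (x₁ ⊗ x₃ ⊗ x₄) addT)) x₁

consT : Term n 1 → Term n 1 → Term n 1
consT t u = caseOf t u (cons false u) (cons true u)

scanBody : Term (2 + n) 2
scanBody = tl (tl x₀) ⊗ consT (tl x₀) x₁

-- The rest returned as second result of `numT` still begins with the end marker `false`, so that an
-- empty rest signals failure. `predT` removes the marker; there an empty rest leads to failure
-- anyway, because the end of the list of predecessors would be missing.
scanT numT predT : Term (1 + n) 2
scanT = loop one (x₀ ⊗ nil) scanBody

revT endT : Term (1 + n) 1
revT = bind (loop some (x₀ ⊗ nil) (tl x₀ ⊗ consT x₀ x₁)) x₁
numT = bind scanT (caseOf x₁ (nil ⊗ x₀) (nil ⊗ nil) (bind (tl x₁) (inc revT) ⊗ x₀))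
predT = caseOf x₀ (nil ⊗ nil) (nil ⊗ nil) (bind (tl x₀) (bind numT (x₀ ⊗ tl x₁)))
endT = caseOf x₀ nil (tl x₀) nil

-- The decision tree of the three-bit label codes. The default `d` covers the codes of no operation
-- in `Ops` and words that are too short.
switch : Term n 1 → (d inputs complements cups caps pluses divs : Term n k) → Term n k
switch l d a b c e f g = caseOf l d
  (caseOf (tl l) d (caseOf (tl (tl l)) d a b) (caseOf (tl (tl l)) d c e))
  (caseOf (tl l) d (caseOf (tl (tl l)) d f d) (caseOf (tl (tl l)) d g d))

inputT complT binT bodyT : Term (1 + n) 3
inputT = bind numT (x₀ ⊗ nil ⊗ bind (tl x₁) endT)
complT = bind predT (x₀ ⊗ nil ⊗ bind x₁ endT)
binT = bind predT (bind (bind x₁ predT) (x₂ ⊗ x₀ ⊗ bind x₁ endT))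
bodyT = switch x₀ (nil ⊗ nil ⊗ nil)
  (after inputT) (after complT) (after binT) (after binT) (after binT) (after binT)
  where
  after : Term (2 + n) 3 → Term (1 + n) 3
  after = bind (tl (tl (tl x₀)))

-- The results are the name, the word from the label on, the numbers of the
-- gate, and the rest of the word, which is empty on failure.
gateT : Term (1 + n) 5
gateT = bind numT (bind (tl x₁) (bind bodyT (x₄ ⊗ x₃ ⊗ x₀ ⊗ x₁ ⊗ x₂)))

skipT : Term (1 + n) 1
skipT = loop one x₀ (bind (tl x₀) (bind gateT x₄))

isinBody : Term (4 + n) 2
isinBody = bind (bind (tl x₀) gateT) (x₄ ⊗ ifT′ (bind (x₀ ⊗ x₇) eqT) yesT x₆)

isinT : Term (2 + n) 1
isinT = bind (loop one (x₁ ⊗ noT) isinBody) x₁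

bothT linkT : Term (5 + n) 1
bothT = ifT′ (bind (x₂ ⊗ x₄) isinT) (ifT′ (bind (x₃ ⊗ x₄) isinT) (bind (x₂ ⊗ x₃) leT) noT) noT
linkT = switch x₁ noT yesT (bind (x₂ ⊗ x₄) isinT) bothT bothT bothT bothT

validBody : Term (2 + n) 2
validBody = bind (bind (tl x₀) gateT)
  (x₄ ⊗ ifT′ x₆ (ifT′ (ifT′ (bind (x₀ ⊗ x₄) isinT) noT yesT) linkT noT) noT)

validT : Term (1 + n) 1
validT = bind (loop one (x₀ ⊗ yesT) validBody) x₁

-- The flag stands first because a loop tests its first component. At the gate sought, the word from
-- this gate on is kept, not the word after it: `memT` decodes the gate again.
findBody : Term (4 + n) 2
findBody = bind (bind (tl x₁) gateT) (ifT′ (bind (x₀ ⊗ x₈) eqT) (noT ⊗ x₆) (yesT ⊗ x₄))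

findT : Term (2 + n) 2
findT = loop one (yesT ⊗ x₀) findBody

-- The first three variables are the number of remaining rounds, the summand or divisor to be tried,
-- and the answer so far. The others are those of `gateMemT` shifted by three: `x₅` and `x₆` are the
-- operands, `x₇` the later gates, `x₁₂` the argument and `x₁₃` the cap.
plusBody divBody : Term (14 + n) 3
plusBody = dec x₀ ⊗ inc x₁ ⊗ ifT′ x₂ yesT
  (ifT′ (call (x₇ ⊗ x₅ ⊗ x₁ ⊗ x₁₃)) (call (x₇ ⊗ x₆ ⊗ bind (x₁₂ ⊗ x₁) monusT ⊗ x₁₃)) noT)
divBody = dec x₀ ⊗ inc x₁ ⊗ ifT′ x₂ yesT
  (ifT′ (call (x₇ ⊗ x₆ ⊗ x₁ ⊗ x₁₃)) (call (x₇ ⊗ x₅ ⊗ bind (x₁ ⊗ x₁₂ ⊗ x₁₃) mulT ⊗ x₁₃)) noT)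

askT : Term (11 + n) 1 → Term (11 + n) 1
askT p = call (x₄ ⊗ p ⊗ x₉ ⊗ x₁₀)

plusT divT gateMemT : Term (11 + n) 1
plusT = bind (loop some (inc x₉ ⊗ nil ⊗ noT) plusBody) x₂
divT = bind (loop some (x₁₀ ⊗ cons false nil ⊗ noT) divBody) x₂
gateMemT = switch x₁ noT
  (bind (x₂ ⊗ x₉) eqT)
  (ifT′ (askT x₂) noT yesT)
  (ifT′ (askT x₂) yesT (askT x₃))
  (ifT′ (askT x₂) (askT x₃) noT)
  plusT
  divT

-- Parameters: a list of gates, the name of a gate, an argument, the cap.
memT : Term 4 1
memT = bind findT (bind (bind (tl x₁) gateT) gateMemT)

checkT : Term (8 + n) 1
checkT = ifT′ (bind x₄ validT) (ifT′ (bind (x₅ ⊗ x₄) isinT)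
  -- With `W` the value of the input word `x₇`, the argument `W ∸ (W ∸ b)` is the minimum of `b` and
  -- `W`. The input word itself is passed as the cap.
  (call (x₄ ⊗ x₅ ⊗ bind (x₇ ⊗ bind (x₇ ⊗ x₀) monusT) monusT ⊗ x₇)) noT) noT

lastT : Term (6 + n) 1
lastT = bind numT (caseOf x₁ noT (caseOf (tl x₁) checkT noT noT) noT)

gatesT : Term (4 + n) 1
gatesT = bind skipT (caseOf x₀ noT (bind (tl x₀) lastT) noT)

mainT : Term 1 1
mainT = bind numT (bind (tl x₁) gatesT)

rep : Bool → Word
rep true  = true ∷ []
rep false = []

some-inc : ∀ w → some (top (incW w)) ≡ true
some-inc []          = refl
some-inc (true ∷ w)  = refl
some-inc (false ∷ w) = refl

T-not-elim : ∀ {b} → T (not b) → ¬ T b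
T-not-elim {false} _ ()

⊓-absorb : ∀ a j M → (a ⊓ M + j) ⊓ M ≡ (a + j) ⊓ M
⊓-absorb a j M with ≤-total a M
... | inj₁ a≤M rewrite m≤n⇒m⊓n≡m a≤M = refl
... | inj₂ M≤a rewrite m≥n⇒m⊓n≡n M≤a =
  trans (m≥n⇒m⊓n≡n (m≤m+n M j)) (sym (m≥n⇒m⊓n≡n (≤-trans M≤a (m≤m+n a j))))

-- Evaluation of the logical, arithmetical and scanning terms

module Evaluation (w : Word) where

  W N : ℕ
  W = val w
  -- The counters of `plusT` and `divT` run up to `W + 1`, whose word may be one digit longer than
  -- `w`.
  N = suc (length w)
  open Semantics N memT


  cast : ∀ {t : Term n k} {r s} → r ≡ s → Ev z ρ t r → Ev z ρ t s
  cast refl e = e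

  dec= : ∀ j {t : Term n 1} → Ev z ρ t (nb (suc j) ∷ []) → Ev z ρ (dec t) (nb j ∷ [])
  dec= j e = cast (cong (_∷ []) (dec-inc (nb j))) (dec e)

  decPred : ∀ j {t : Term n 1} → Ev z ρ t (nb j ∷ []) → Ev z ρ (dec t) (nb (pred j) ∷ [])
  decPred j e = cast (cong (_∷ []) (dec-nb j)) (dec e)

  inc= : ∀ j {t : Term n 1} → j ≤ W → Ev z ρ t (nb j ∷ []) → Ev z ρ (inc t) (nb (suc j) ∷ [])
  inc= j j≤ e = inc e (nb-short {suc j} w (s≤s j≤))

  yesE : Ev z ρ yesT (rep true ∷ [])
  yesE = cons nil (s≤s z≤n)

  ifE : ∀ b {t} {u v : Term n k} {r} → Ev z ρ t (rep b ∷ []) → (T b → Ev z ρ u r) → (T (not b) → Ev z ρ v r) →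
        Ev z ρ (ifT′ t u v) r
  ifE true  e f g = case₁ e (f tt)
  ifE false e f g = case[] e (g tt)

  andE : ∀ a {b t u} → Ev z ρ t (rep a ∷ []) → (T a → Ev z ρ u (rep b ∷ [])) → Ev z ρ (ifT′ t u noT) (rep (a ∧ b) ∷ [])
  andE true  e f = case₁ e (f tt)
  andE false e f = case[] e nil

  orE : ∀ a {b t u} → Ev z ρ t (rep a ∷ []) → (T (not a) → Ev z ρ u (rep b ∷ [])) → Ev z ρ (ifT′ t yesT u) (rep (a ∨ b) ∷ [])
  orE true  e f = case₁ e yesE
  orE false e f = case[] e (f tt)

  notE : ∀ a {t} → Ev z ρ t (rep a ∷ []) → Ev z ρ (ifT′ t noT yesT) (rep (not a) ∷ [])
  notE true  e = case₁ e nil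
  notE false e = case[] e yesE

  ifSuc : ∀ j {t} {u v : Term n k} {r} → Ev z ρ t (nb (suc j) ∷ []) → Ev z ρ v r → Ev z ρ (ifZero t u v) r
  ifSuc j e f with incW (nb j) | some-inc (nb j)
  ... | false ∷ _ | _ = case₀ e f
  ... | true ∷ _  | _ = case₁ e f

  ifZeroE : ∀ d {t u v b} → Ev z ρ t (nb d ∷ []) → (d ≡ 0 → Ev z ρ u (rep b ∷ [])) → (d ≢ 0 → Ev z ρ v (rep b ∷ [])) →
            Ev z ρ (ifZero t u v) (rep b ∷ [])
  ifZeroE zero    e f g = case[] e (f refl)
  ifZeroE (suc d) e f g = ifSuc d e (g λ ())

  monusIter : ∀ j x → Iter z ρ some (dec x₀ ⊗ dec x₁) (nb j ∷ nb x ∷ []) ([] ∷ nb (x ∸ j) ∷ [])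
  monusIter zero    x = done refl
  monusIter {z = z} {ρ = ρ} (suc j) x = more (some-inc (nb j)) (dec= j var ⊗ decPred x var)
    (subst (λ y → Iter z ρ some (dec x₀ ⊗ dec x₁) (nb j ∷ nb (pred x) ∷ []) ([] ∷ nb y ∷ [])) (lem x) (monusIter j (pred x)))
    where
    lem : ∀ x → pred x ∸ j ≡ x ∸ suc j
    lem zero    = 0∸n≡0 j
    lem (suc x) = refl


  monusE : ∀ x y → Ev z (nb x ∷ nb y ∷ ρ) monusT (nb (x ∸ y) ∷ [])
  monusE x y = bind (loop (var ⊗ var) (monusIter y x)) var

  leE : ∀ x y → Ev z (nb x ∷ nb y ∷ ρ) leT (rep (x ≤ᵇ y) ∷ [])
  leE x y = ifZeroE (x ∸ y) (monusE x y)
    (λ e → cast (cong (λ b → rep b ∷ []) (sym (T-true (≤⇒≤ᵇ {x} {y} (m∸n≡0⇒m≤n e))))) yesE)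
    (λ ne → cast (cong (λ b → rep b ∷ []) (sym (T-false (ne ∘ m≤n⇒m∸n≡0 ∘ ≤ᵇ⇒≤ x y)))) nil)
    where
    T-true : ∀ {b} → T b → b ≡ true
    T-true {true} _ = refl
    T-false : ∀ {b} → ¬ T b → b ≡ false
    T-false {true}  f = contradiction tt f
    T-false {false} f = refl

  eqE : ∀ x y → Ev z (nb x ∷ nb y ∷ ρ) eqT (rep (x ≡ᵇ y) ∷ [])
  eqE x y = ifZeroE (x ∸ y) (monusE x y)
    (λ e → ifZeroE (y ∸ x) (bind (var ⊗ var) (monusE y x))
      (λ e′ → cast (cong (λ b → rep b ∷ []) (trans (sym (≡ᵇ-refl x)) (cong (x ≡ᵇ_) (≤-antisym (m∸n≡0⇒m≤n e) (m∸n≡0⇒m≤n e′))))) yesE)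
      (λ ne → cast (cong (λ b → rep b ∷ []) (sym (≢⇒≡ᵇ-false {x} {y} (λ { refl → ne (n∸n≡0 x) })))) nil))
    (λ ne → cast (cong (λ b → rep b ∷ []) (sym (≢⇒≡ᵇ-false {x} {y} (λ { refl → ne (n∸n≡0 x) })))) nil)


  -- The accumulator is incremented only while it is below `M`, which keeps its word within `N`
  -- digits. By `⊓-absorb`, capping in every round amounts to capping once at the end.
  addIter : ∀ {M} → M ≤ W → ∀ j acc x y → acc ≤ M →
            Iter z (nb x ∷ nb y ∷ nb M ∷ ρ) some (dec x₀ ⊗ ifT′ (bind (x₄ ⊗ x₁) leT) x₁ (inc x₁))
              (nb j ∷ nb acc ∷ []) ([] ∷ nb ((acc + j) ⊓ M) ∷ [])
  addIter {M = M} M≤ zero acc x y a≤ rewrite +-identityʳ acc | m≤n⇒m⊓n≡m a≤ = done refl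
  addIter {z = z} {ρ = ρ} {M = M} M≤ (suc j) acc x y a≤ = more (some-inc (nb j)) (dec= j var ⊗ step)
    (subst (λ m → Iter _ _ some _ (nb j ∷ nb (suc acc ⊓ M) ∷ []) ([] ∷ nb m ∷ []))
      (trans (⊓-absorb (suc acc) j M) (cong (_⊓ M) (sym (+-suc acc j))))
      (addIter M≤ j (suc acc ⊓ M) x y (m⊓n≤n (suc acc) M)))
    where
    step : Ev z (nb (suc j) ∷ nb acc ∷ nb x ∷ nb y ∷ nb M ∷ ρ) (ifT′ (bind (x₄ ⊗ x₁) leT) x₁ (inc x₁)) (nb (suc acc ⊓ M) ∷ [])
    step = ifE (M ≤ᵇ acc) (bind (var ⊗ var) (leE M acc))
      (λ t → cast (cong (λ m → nb m ∷ []) (trans (≤-antisym a≤ (≤ᵇ⇒≤ M acc t)) (sym (m≥n⇒m⊓n≡n (m≤n⇒m≤1+n (≤ᵇ⇒≤ M acc t)))))) var)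
      (λ t → cast (cong (λ m → nb m ∷ []) (sym (m≤n⇒m⊓n≡m {suc acc} {M} (≰⇒> {M} {acc} (λ le → T-not-elim {M ≤ᵇ acc} t (≤⇒≤ᵇ le))))))
               (inc= acc (≤-trans a≤ M≤) var))

  addE : ∀ {M} → M ≤ W → ∀ x y → x ≤ M → Ev z (nb x ∷ nb y ∷ nb M ∷ ρ) addT (nb ((x + y) ⊓ M) ∷ [])
  addE M≤ x y x≤ = bind (loop (var ⊗ var) (addIter M≤ y x x y x≤)) var


  mulIter : ∀ {M} → M ≤ W → ∀ j acc b x → acc ≤ M → x ≤ M →
            Iter z (nb b ∷ nb x ∷ nb M ∷ ρ) some (dec x₀ ⊗ bind (x₁ ⊗ x₃ ⊗ x₄) addT)
              (nb j ∷ nb acc ∷ []) ([] ∷ nb ((acc + j * x) ⊓ M) ∷ [])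
  mulIter {M = M} M≤ zero acc b x a≤ x≤ rewrite +-identityʳ acc | m≤n⇒m⊓n≡m a≤ = done refl
  mulIter {M = M} M≤ (suc j) acc b x a≤ x≤ = more (some-inc (nb j))
    (dec= j var ⊗ bind (var ⊗ var ⊗ var) (addE M≤ acc x a≤))
    (subst (λ m → Iter _ _ some _ (nb j ∷ nb ((acc + x) ⊓ M) ∷ []) ([] ∷ nb m ∷ []))
      (trans (⊓-absorb (acc + x) (j * x) M) (cong (_⊓ M) (+-assoc acc x (j * x))))
      (mulIter M≤ j ((acc + x) ⊓ M) b x (m⊓n≤n (acc + x) M) x≤))

  mulE : ∀ {M} → M ≤ W → ∀ b x → x ≤ M → Ev z (nb b ∷ nb x ∷ nb M ∷ ρ) mulT (nb (b * x ⊓ M) ∷ [])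
  mulE M≤ b x x≤ = bind (loop (var ⊗ nil) (mulIter M≤ b 0 b x z≤n x≤)) var

  consE : ∀ d {t u v acc} → Ev z ρ t ((d ∷ v) ∷ []) → Ev z ρ u (acc ∷ []) → suc (length acc) ≤ N →
          Ev z ρ (consT t u) ((d ∷ acc) ∷ [])
  consE true  e f le = case₁ e (cons f le)
  consE false e f le = case₀ e (cons f le)


  revIter : ∀ v acc {u} → length acc + length v ≤ N →
            Iter z (u ∷ ρ) some (tl x₀ ⊗ consT x₀ x₁) (v ∷ acc ∷ []) ([] ∷ (v ʳ++ acc) ∷ [])
  revIter []      acc le = done refl
  revIter (d ∷ v) acc le = more refl (tl var ⊗ consE d var var (≤-trans (s≤s (m≤m+n _ (length v))) le′))
                             (revIter v (d ∷ acc) le′)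
    where le′ = ≤-trans (≤-reflexive (sym (+-suc (length acc) (length v)))) le

  revE : ∀ v → length v ≤ N → Ev z (v ∷ ρ) revT (reverse v ∷ [])
  revE v le = bind (loop (var ⊗ nil) (revIter v [] le)) var

  -- The specification is read off the result of the parser, so that malformed words are covered. On
  -- failure only the empty rest is prescribed; the digits gathered so far may be any short word.
  Scanned : ∀ {n} (z : ℕ) (ρ : Vec Word n) → Word → Word → Word → Maybe (Word × Word) → Set
  Scanned z ρ u v acc (just (ds , r)) = Iter z (u ∷ ρ) one scanBody (v ∷ acc ∷ []) ((false ∷ r) ∷ ds ∷ []) × length ds ≤ N
  Scanned z ρ u v acc nothing         = ∃[ ds ] (Iter z (u ∷ ρ) one scanBody (v ∷ acc ∷ []) ([] ∷ ds ∷ []) × length ds ≤ N)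

  scanIter : ∀ u v acc → length acc + length v ≤ N → Scanned z ρ u v acc (scan v acc)
  scanIter u []             acc le = acc , done refl , ≤-trans (m≤m+n _ _) le
  scanIter u (true ∷ [])    acc le = acc , more refl (tl (tl var) ⊗ case[] (tl var) var) (done refl) , ≤-trans (m≤m+n _ _) le
  scanIter u (false ∷ v)    acc le = done refl , ≤-trans (m≤m+n _ _) le
  scanIter u (true ∷ d ∷ v) acc le with scan v (d ∷ acc) | scanIter u v (d ∷ acc) le′
    where le′ = ≤-trans (≤-trans (n≤1+n _) (≤-reflexive (trans (cong suc (sym (+-suc (length acc) (length v)))) (sym (+-suc (length acc) (suc (length v))))))) le
  ... | just _  | it , l = more refl (tl (tl var) ⊗ consE d (tl var) var fits₁) it , l
    where fits₁ = ≤-trans (s≤s (m≤m+n _ (suc (length v)))) (≤-trans (≤-reflexive (sym (+-suc (length acc) (suc (length v))))) le)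
  ... | nothing | ds , it , l = ds , more refl (tl (tl var) ⊗ consE d (tl var) var fits₁) it , l
    where fits₁ = ≤-trans (s≤s (m≤m+n _ (suc (length v)))) (≤-trans (≤-reflexive (sym (+-suc (length acc) (suc (length v))))) le)

  Num : ∀ {n} (z : ℕ) (ρ : Vec Word n) → Word → Maybe (ℕ × Word) → Set
  Num z ρ v (just (m , r)) = Ev z (v ∷ ρ) numT (nb m ∷ (false ∷ r) ∷ [])
  Num z ρ v nothing        = ∃[ u ] Ev z (v ∷ ρ) numT (u ∷ [] ∷ [])


  incRevE : ∀ ds {u : Word} → length (true ∷ ds) ≤ N →
            Ev z (u ∷ (true ∷ ds) ∷ ρ) (bind (tl x₁) (inc revT)) (nb (suc (val (reverse ds))) ∷ [])
  incRevE ds l = cast (cong (λ u → incW u ∷ []) (sym (nb-val (reverse ds))))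
    (bind (tl var) (inc (revE ds (<⇒≤ l))
      (≤-trans (length-inc-≤ (reverse ds)) (≤-trans (s≤s (≤-reflexive (length-reverse ds))) l))))


  numE : ∀ v → length v ≤ N → Num z ρ v (parseNum v)
  numE {z = z} {ρ = ρ} v le with scan v [] | scanIter {z = z} {ρ = ρ} v v [] le
  ... | nothing | [] , it , l         = _ , bind (loop (var ⊗ nil) it) (case[] var (nil ⊗ var))
  ... | nothing | (false ∷ _) , it , l = _ , bind (loop (var ⊗ nil) it) (case₀ var (nil ⊗ nil))
  ... | nothing | (true ∷ ds) , it , l = _ , bind (loop (var ⊗ nil) it) (case₁ var (incRevE ds l ⊗ var))
  ... | just ([] , r) | it , l = bind (loop (var ⊗ nil) it) (case[] var (nil ⊗ var))
  ... | just (false ∷ _ , r) | it , l = _ , bind (loop (var ⊗ nil) it) (case₀ var (nil ⊗ nil))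
  ... | just (true ∷ ds , r) | it , l = bind (loop (var ⊗ nil) it) (case₁ var (incRevE ds l ⊗ var))

-- Decoding and checking of gate lists by terms

operand₁ operand₂ : Gate Ops ℕ → Word
operand₁ (input m)        = nb m
operand₁ (complement _ p) = nb p
operand₁ (binary _ _ p q) = nb p
operand₂ (input _)        = []
operand₂ (complement _ _) = []
operand₂ (binary _ _ p q) = nb q

parseNum-length : ∀ v {m r} → parseNum v ≡ just (m , r) → length r ≤ length v
parseNum-length v {m} {r} e rewrite parseNum-sound v e | length-++ (encodeℕ m) {r} = m≤n+m _ _

parsePred-length : ∀ v {m r} → parsePred v ≡ just (m , r) → length r ≤ length v
parsePred-length (true ∷ v) e = m≤n⇒m≤1+n (parseNum-length v e)

parseRaw-length : ∀ v {g r} → parseRaw v ≡ just (g , r) → length r ≤ length v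
parseRaw-length v {g} {r} e rewrite parseRaw-sound v e | length-++ (encodeRaw g) {r} = m≤n+m _ _

module Decoding (w : Word) where
  open Evaluation w
  open Semantics N memT

  DecodePred : ∀ {n} → ℕ → Vec Word n → Term n 2 → Maybe (ℕ × Word) → Set
  DecodePred z ρ t (just (p , r)) = Ev z ρ t (nb p ∷ r ∷ [])
  DecodePred z ρ t nothing        = ∃[ u ] Ev z ρ t (u ∷ [] ∷ [])

  predE : ∀ v → length v ≤ N → DecodePred z (v ∷ ρ) predT (parsePred v)
  predE []          le = _ , case[] var (nil ⊗ nil)
  predE (false ∷ v) le = _ , case₀ var (nil ⊗ nil)
  predE {z = z} {ρ = ρ} (true ∷ v) le with parseNum v | numE {z = z} {ρ = (true ∷ v) ∷ ρ} v (<⇒≤ le)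
  ... | nothing      | u , e = u , case₁ var (bind (tl var) (bind e (var ⊗ tl var)))
  ... | just (p , r) | e     = case₁ var (bind (tl var) (bind e (var ⊗ tl var)))

  endW : Maybe Word → Word
  endW (just r) = r
  endW nothing  = []

  endE : ∀ v → Ev z (v ∷ ρ) endT (endW (parseEnd v) ∷ [])
  endE []          = case[] var nil
  endE (false ∷ v) = case₀ var (tl var)
  endE (true ∷ v)  = case₁ var nil

  Body : ∀ {n} → ℕ → Vec Word n → Term n 3 → Maybe (Gate Ops ℕ × Word) → Set
  Body z ρ t (just (x , r)) = Ev z ρ t (operand₁ x ∷ operand₂ x ∷ r ∷ [])
  Body z ρ t nothing        = ∃[ a ] ∃[ b ] Ev z ρ t (a ∷ b ∷ [] ∷ [])

  inputE : ∀ v → length v ≤ N → Body z (v ∷ ρ) inputT (parse₀ v >>= λ (m , r) → just (input m , r))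
  inputE {z = z} {ρ = ρ} v le with parseNum v | numE {z = z} {ρ = ρ} v le
  ... | nothing      | u , e = _ , _ , bind e (var ⊗ nil ⊗ bind (tl var) (endE []))
  -- `endE` is abstracted for all environments, because the term is evaluated below the variables
  -- bound in between.
  ... | just (m , r) | e with parseEnd r | (λ {n} {ρ : Vec Word n} → endE {z = z} {ρ = ρ} r)
  ...   | nothing | f = _ , _ , bind e (var ⊗ nil ⊗ bind (tl var) f)
  ...   | just r′ | f = bind e (var ⊗ nil ⊗ bind (tl var) f)

  complE : ∀ v → length v ≤ N → Body z (v ∷ ρ) complT (parse₁ v >>= λ (p , r) → just (complement compl∈ p , r))
  complE {z = z} {ρ = ρ} v le with parsePred v | predE {z = z} {ρ = ρ} v le
  ... | nothing      | u , e = _ , _ , bind e (var ⊗ nil ⊗ bind var (endE []))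
  ... | just (m , r) | e with parseEnd r | (λ {n} {ρ : Vec Word n} → endE {z = z} {ρ = ρ} r)
  ...   | nothing | f = _ , _ , bind e (var ⊗ nil ⊗ bind var f)
  ...   | just r′ | f = bind e (var ⊗ nil ⊗ bind var f)

  binE : ∀ σ σ∈ v → length v ≤ N → Body z (v ∷ ρ) binT (parseBin σ σ∈ v)
  binE {z = z} {ρ = ρ} σ σ∈ v le with parsePred v in eq | predE {z = z} {ρ = ρ} v le
  ... | nothing | u , e = _ , _ , bind e (bind (bind var (case[] var (nil ⊗ nil)))
          (var ⊗ var ⊗ bind var (endE [])))
  ... | just (p , r) | e with parsePred r | (λ {n} {ρ : Vec Word n} → predE {z = z} {ρ = ρ} r (≤-trans (parsePred-length v eq) le))
  ...   | nothing | f = _ , _ , bind e (bind (bind var (proj₂ f))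
          (var ⊗ var ⊗ bind var (endE [])))
  ...   | just (q , r′) | f with parseEnd r′ | (λ {n} {ρ : Vec Word n} → endE {z = z} {ρ = ρ} r′)
  ...     | nothing | g = _ , _ , bind e (bind (bind var f) (var ⊗ var ⊗ bind var g))
  ...     | just r″ | g = bind e (bind (bind var f) (var ⊗ var ⊗ bind var g))

  choose : Bool → Bool → Bool → (d a b c e f g : Term n k) → Term n k
  choose false false false d a b c e f g = a
  choose false false true  d a b c e f g = b
  choose false true  false d a b c e f g = c
  choose false true  true  d a b c e f g = e
  choose true  false false d a b c e f g = f
  choose true  false true  d a b c e f g = d
  choose true  true  false d a b c e f g = g
  choose true  true  true  d a b c e f g = d

  switchE : ∀ b₁ b₂ b₃ {l : Term n 1} {d a b c e f g : Term n k} {v r} → Ev z ρ l ((b₁ ∷ b₂ ∷ b₃ ∷ v) ∷ []) →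
            Ev z ρ (choose b₁ b₂ b₃ d a b c e f g) r → Ev z ρ (switch l d a b c e f g) r
  switchE false false false l e = case₀ l (case₀ (tl l) (case₀ (tl (tl l)) e))
  switchE false false true  l e = case₀ l (case₀ (tl l) (case₁ (tl (tl l)) e))
  switchE false true  false l e = case₀ l (case₁ (tl l) (case₀ (tl (tl l)) e))
  switchE false true  true  l e = case₀ l (case₁ (tl l) (case₁ (tl (tl l)) e))
  switchE true  false false l e = case₁ l (case₀ (tl l) (case₀ (tl (tl l)) e))
  switchE true  false true  l e = case₁ l (case₀ (tl l) (case₁ (tl (tl l)) e))
  switchE true  true  false l e = case₁ l (case₁ (tl l) (case₀ (tl (tl l)) e))
  switchE true  true  true  l e = case₁ l (case₁ (tl l) (case₁ (tl (tl l)) e))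

  switchShort : ∀ v {l : Term n 1} {d a b c e f g : Term n k} {r} → length v < 3 → Ev z ρ l (v ∷ []) →
                Ev z ρ d r → Ev z ρ (switch l d a b c e f g) r
  switchShort []               le l e = case[] l e
  switchShort (false ∷ [])     le l e = case₀ l (case[] (tl l) e)
  switchShort (true ∷ [])      le l e = case₁ l (case[] (tl l) e)
  switchShort (false ∷ false ∷ []) le l e = case₀ l (case₀ (tl l) (case[] (tl (tl l)) e))
  switchShort (false ∷ true ∷ [])  le l e = case₀ l (case₁ (tl l) (case[] (tl (tl l)) e))
  switchShort (true ∷ false ∷ [])  le l e = case₁ l (case₀ (tl l) (case[] (tl (tl l)) e))
  switchShort (true ∷ true ∷ [])   le l e = case₁ l (case₁ (tl l) (case[] (tl (tl l)) e))
  switchShort (_ ∷ _ ∷ _ ∷ _) (s≤s (s≤s (s≤s ()))) l e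

  Body-map : ∀ {n m} {ρ : Vec Word n} {σ : Vec Word m} {t u} →
             (∀ {r} → Ev z ρ t r → Ev z σ u r) → ∀ m → Body z ρ t m → Body z σ u m
  Body-map f (just _) e           = f e
  Body-map f nothing  (a , b , e) = a , b , f e

  noBody : Ev z ρ (nil ⊗ nil ⊗ nil) ([] ∷ [] ∷ [] ∷ [])
  noBody = nil ⊗ nil ⊗ nil

  bodyE : ∀ v → length v ≤ N → Body z (v ∷ ρ) bodyT (parseBody v)
  bodyE v@(false ∷ false ∷ false ∷ r) le =
    Body-map (switchE _ _ _ var ∘ bind (tl (tl (tl var)))) (parse₀ r >>= λ (m , r) → just (input m , r)) (inputE r (<⇒≤ (<⇒≤ (<⇒≤ le))))
  bodyE v@(false ∷ false ∷ true ∷ r)  le =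
    Body-map (switchE _ _ _ var ∘ bind (tl (tl (tl var)))) (parse₁ r >>= λ (p , r) → just (complement compl∈ p , r)) (complE r (<⇒≤ (<⇒≤ (<⇒≤ le))))
  bodyE v@(false ∷ true ∷ false ∷ r)  le =
    Body-map (switchE _ _ _ var ∘ bind (tl (tl (tl var)))) (parseBin cup cup∈ r) (binE cup cup∈ r (<⇒≤ (<⇒≤ (<⇒≤ le))))
  bodyE v@(false ∷ true ∷ true ∷ r)   le =
    Body-map (switchE _ _ _ var ∘ bind (tl (tl (tl var)))) (parseBin cap cap∈ r) (binE cap cap∈ r (<⇒≤ (<⇒≤ (<⇒≤ le))))
  bodyE v@(true ∷ false ∷ false ∷ r)  le =
    Body-map (switchE _ _ _ var ∘ bind (tl (tl (tl var)))) (parseBin plus plus∈ r) (binE plus plus∈ r (<⇒≤ (<⇒≤ (<⇒≤ le))))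
  bodyE v@(true ∷ true ∷ false ∷ r)   le =
    Body-map (switchE _ _ _ var ∘ bind (tl (tl (tl var)))) (parseBin div div∈ r) (binE div div∈ r (<⇒≤ (<⇒≤ (<⇒≤ le))))
  bodyE (true ∷ false ∷ true ∷ r)  le = _ , _ , switchE true false true var noBody
  bodyE (true ∷ true ∷ true ∷ r)   le = _ , _ , switchE true true true var noBody
  bodyE []                         le = _ , _ , switchShort [] (s≤s z≤n) var noBody
  bodyE (false ∷ [])               le = _ , _ , switchShort (false ∷ []) (s≤s (s≤s z≤n)) var noBody
  bodyE (true ∷ [])                le = _ , _ , switchShort (true ∷ []) (s≤s (s≤s z≤n)) var noBody
  bodyE (false ∷ false ∷ [])       le = _ , _ , switchShort (false ∷ false ∷ []) (s≤s (s≤s (s≤s z≤n))) var noBody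
  bodyE (false ∷ true ∷ [])        le = _ , _ , switchShort (false ∷ true ∷ []) (s≤s (s≤s (s≤s z≤n))) var noBody
  bodyE (true ∷ false ∷ [])        le = _ , _ , switchShort (true ∷ false ∷ []) (s≤s (s≤s (s≤s z≤n))) var noBody
  bodyE (true ∷ true ∷ [])         le = _ , _ , switchShort (true ∷ true ∷ []) (s≤s (s≤s (s≤s z≤n))) var noBody

  Fields : Raw → Word → Vec Word 5
  Fields (m , x) r = nb m ∷ (encodeBody x ++ r) ∷ operand₁ x ∷ operand₂ x ∷ r ∷ []

  Decode : ∀ {n} → ℕ → Vec Word n → Word → Maybe (Raw × Word) → Set
  Decode z ρ v (just (g , r)) = Ev z (v ∷ ρ) gateT (Fields g r)
  Decode z ρ v nothing        = ∃[ a ] ∃[ b ] ∃[ c ] ∃[ d ] Ev z (v ∷ ρ) gateT (a ∷ b ∷ c ∷ d ∷ [] ∷ [])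

  fieldsE : ∀ {v m l r₀ a b c} → Ev z (v ∷ ρ) numT (m ∷ l ∷ []) → r₀ ≡ tailW l →
            (∀ {n} {ρ : Vec Word n} → Ev z (r₀ ∷ ρ) bodyT (a ∷ b ∷ c ∷ [])) → Ev z (v ∷ ρ) gateT (m ∷ r₀ ∷ a ∷ b ∷ c ∷ [])
  fieldsE e refl f = bind e (bind (tl var) (bind f
    (var ⊗ var ⊗ var ⊗ var ⊗ var)))

  gateE : ∀ v → length v ≤ N → Decode z ρ v (parseRaw v)
  gateE {z = z} {ρ = ρ} v le with parseNum v in eq | numE {z = z} {ρ = ρ} v le
  ... | nothing | u , e = _ , _ , _ , _ , bind e (bind (tl var) (bind (proj₂ (proj₂ (bodyE [] z≤n)))
    (var ⊗ var ⊗ var ⊗ var ⊗ var)))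
  ... | just (m , r₀) | e with parseBody r₀ in eq′ | (λ {n} {ρ : Vec Word n} → bodyE {z = z} {ρ = ρ} r₀ (≤-trans (parseNum-length v eq) le))
  ...   | nothing | f = _ , _ , _ , _ , bind e (bind (tl var) (bind (proj₂ (proj₂ f))
    (var ⊗ var ⊗ var ⊗ var ⊗ var)))
  ...   | just (x , r) | f = subst (λ l → Ev z (v ∷ ρ) gateT (nb m ∷ l ∷ operand₁ x ∷ operand₂ x ∷ r ∷ []))
    (parseBody-sound r₀ eq′) (fieldsE e refl f)

  gate! : ∀ g r → length (encodeRaw g ++ r) ≤ N → Ev z ((encodeRaw g ++ r) ∷ ρ) gateT (Fields g r)
  gate! {z = z} {ρ = ρ} g r le = subst (Decode z ρ (encodeRaw g ++ r)) (parseRaw-complete g r) (gateE (encodeRaw g ++ r) le)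

  Skip : ∀ {n} → ℕ → Vec Word n → Word → Maybe (List Raw × Word) → Set
  Skip z ρ v (just (gs , r)) = Iter z ρ one (bind (tl x₀) (bind gateT x₄)) (v ∷ []) ((false ∷ r) ∷ [])
  Skip z ρ v nothing         = Iter z ρ one (bind (tl x₀) (bind gateT x₄)) (v ∷ []) ([] ∷ [])

  skipIter : ∀ k v → length v ≤ k → length v ≤ N → Skip z ρ v (parseRaws k v)
  skipIter zero    []          le le′ = done refl
  skipIter (suc k) []          le le′ = done refl
  skipIter (suc k) (false ∷ v) le le′ = done refl
  skipIter {z = z} {ρ = ρ} (suc k) (true ∷ v) (s≤s le) le′ with parseRaw v in eq | gateE {z = z} {ρ = (true ∷ v) ∷ ρ} v (<⇒≤ le′)
  ... | nothing | _ , _ , _ , _ , e = more refl (bind (tl var) (bind e var)) (done refl)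
  ... | just (g , r) | e with parseRaws k r | skipIter {z = z} {ρ = ρ} k r (≤-trans (parseRaw-length v eq) le) (≤-trans (parseRaw-length v eq) (<⇒≤ le′))
  ...   | nothing       | it = more refl (bind (tl var) (bind e var)) it
  ...   | just (gs , _) | it = more refl (bind (tl var) (bind e var)) it

  gates-length : ∀ g gs r → length (encodeRaws (g ∷ gs) ++ r) ≤ N → length (encodeRaw g ++ encodeRaws gs ++ r) ≤ N
  gates-length g gs r le = ≤-trans (n≤1+n _) (≤-trans (≤-reflexive (cong length (sym (encodeRaws-∷ g gs r)))) le)

  rest-length : ∀ g gs r → length (encodeRaws (g ∷ gs) ++ r) ≤ N → length (encodeRaws gs ++ r) ≤ N
  rest-length g gs r le = ≤-trans (m≤n+m _ (length (encodeRaw g)))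
    (≤-trans (≤-reflexive (sym (length-++ (encodeRaw g)))) (gates-length g gs r le))

  isinIter : ∀ gs {r u} b m → length (encodeRaws gs ++ r) ≤ N →
             Iter z (nb m ∷ u ∷ ρ) one isinBody ((encodeRaws gs ++ r) ∷ rep b ∷ []) ((false ∷ r) ∷ rep (b ∨ hasName m gs) ∷ [])
  isinIter []       b m le rewrite ∨-identityʳ b = done refl
  isinIter {z = z} {ρ = ρ} (g@(l , x) ∷ gs) {r} {u} b m le =
    subst₂ (λ v b′ → Iter z (nb m ∷ u ∷ ρ) one isinBody (v ∷ rep b ∷ []) ((false ∷ r) ∷ rep b′ ∷ []))
      (sym (encodeRaws-∷ g gs r)) (trans (cong (_∨ hasName m gs) (∨-comm (l ≡ᵇ m) b)) (∨-assoc b (l ≡ᵇ m) (hasName m gs)))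
      (more refl (bind (bind (tl var) (gate! g (encodeRaws gs ++ r) (gates-length g gs r le)))
         (var ⊗ orE (l ≡ᵇ m)
           (bind (var ⊗ var) (eqE l m))
           (λ _ → var)))
        (isinIter gs ((l ≡ᵇ m) ∨ b) m (rest-length g gs r le)))

  isinE : ∀ gs r m → length (encodeRaws gs ++ r) ≤ N → Ev z (nb m ∷ (encodeRaws gs ++ r) ∷ ρ) isinT (rep (hasName m gs) ∷ [])
  isinE gs r m le = bind (loop (var ⊗ nil) (isinIter gs false m le)) var

  select : Gate Ops ℕ → (d a b c e f g : Term n k) → Term n k
  select (input _)            d a b c e f g = a
  select (complement _ _)     d a b c e f g = b
  select (binary cup _ _ _)   d a b c e f g = c
  select (binary cap _ _ _)   d a b c e f g = e
  select (binary plus _ _ _)  d a b c e f g = f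
  select (binary times _ _ _) d a b c e f g = d
  select (binary div _ _ _)   d a b c e f g = g

  switch! : ∀ x {l : Term n 1} {d a b c e f g : Term n k} {v r} → Ev z ρ l ((encodeBody x ++ v) ∷ []) →
            Ev z ρ (select x d a b c e f g) r → Ev z ρ (switch l d a b c e f g) r
  switch! (input _)            l e = switchE false false false l e
  switch! (complement _ _)     l e = switchE false false true l e
  switch! (binary cup _ _ _)   l e = switchE false true false l e
  switch! (binary cap _ _ _)   l e = switchE false true true l e
  switch! (binary plus _ _ _)  l e = switchE true false false l e
  switch! (binary times _ _ _) l e = switchE true false true l e
  switch! (binary div _ _ _)   l e = switchE true true false l e

  linkE : ∀ m x gs r → length (encodeRaws gs ++ r) ≤ N →
          Ev z (nb m ∷ (encodeBody x ++ encodeRaws gs ++ r) ∷ operand₁ x ∷ operand₂ x ∷ (encodeRaws gs ++ r) ∷ ρ) linkT (rep (okB gs x) ∷ [])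
  linkE {z = z} {ρ = ρ} m x gs r le = switch! x var (chosen x)
    where
    has : ∀ {n} {ρ : Vec Word n} p → Ev z (nb p ∷ (encodeRaws gs ++ r) ∷ ρ) isinT (rep (hasName p gs) ∷ [])
    has p = isinE gs r p le
    both : ∀ {σ : Vec Word 2} p q → Ev z (lookup σ zero ∷ lookup σ (suc zero) ∷ nb p ∷ nb q ∷ (encodeRaws gs ++ r) ∷ ρ) bothT (rep (hasName p gs ∧ (hasName q gs ∧ (p ≤ᵇ q))) ∷ [])
    both p q = andE (hasName p gs) (bind (var ⊗ var) (has p))
      (λ _ → andE (hasName q gs) (bind (var ⊗ var) (has q))
        (λ _ → bind (var ⊗ var) (leE p q)))
    chosen : ∀ x {u v} → Ev z (u ∷ v ∷ operand₁ x ∷ operand₂ x ∷ (encodeRaws gs ++ r) ∷ ρ) (select x noT yesT (bind (x₂ ⊗ x₄) isinT) bothT bothT bothT bothT) (rep (okB gs x) ∷ [])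
    chosen (input _)            = yesE
    chosen (complement _ p)     = bind (var ⊗ var) (has p)
    chosen (binary cup _ p q) {u} {v}  = both {u ∷ v ∷ []} p q
    chosen (binary cap _ p q) {u} {v}  = both {u ∷ v ∷ []} p q
    chosen (binary plus _ p q) {u} {v} = both {u ∷ v ∷ []} p q
    chosen (binary times (there (there (there (there (there ()))))) p q)
    chosen (binary div _ p q) {u} {v}  = both {u ∷ v ∷ []} p q

  validIter : ∀ gs {r u} b → length (encodeRaws gs ++ r) ≤ N →
              Iter z (u ∷ ρ) one validBody ((encodeRaws gs ++ r) ∷ rep b ∷ []) ((false ∷ r) ∷ rep (b ∧ validB gs) ∷ [])
  validIter []       b le rewrite ∧-identityʳ b = done refl
  validIter {z = z} {ρ = ρ} (g@(l , x) ∷ gs) {r} {u} b le =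
    subst₂ (λ v b′ → Iter z (u ∷ ρ) one validBody (v ∷ rep b ∷ []) ((false ∷ r) ∷ rep b′ ∷ []))
      (sym (encodeRaws-∷ g gs r)) (trans (∧-assoc b _ (validB gs)) (cong (b ∧_) (∧-assoc (not (hasName l gs)) (okB gs x) (validB gs))))
      (more refl (bind (bind (tl var) (gate! g (encodeRaws gs ++ r) (gates-length g gs r le)))
         (var ⊗ andE b var
           (λ _ → andE (not (hasName l gs))
             (notE (hasName l gs) (bind (var ⊗ var) (isinE gs r l le′)))
             (λ _ → linkE l x gs r le′))))
        (validIter gs (b ∧ (not (hasName l gs) ∧ okB gs x)) le′))
    where le′ = rest-length g gs r le

  validE : ∀ gs r → length (encodeRaws gs ++ r) ≤ N → Ev z ((encodeRaws gs ++ r) ∷ ρ) validT (rep (validB gs) ∷ [])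
  validE gs r le = bind (loop (var ⊗ yesE) (validIter gs true le)) var

  -- `gate` belongs to the first entry named `n`, and `later` lists the entries after it. The field
  -- `member` reduces membership to this gate, and `shorter` is what limits the depth of the
  -- recursion by the number of gates.
  record Found (z : ℕ) {k} (ρ : Vec Word (2 + k)) (gs : List Raw) (r : Word) (n : ℕ) : Set where
    constructor found
    field
      gate    : Gate Ops ℕ
      later   : List Raw
      search  : Iter z ρ one findBody (rep true ∷ (encodeRaws gs ++ r) ∷ []) ([] ∷ (encodeRaws ((n , gate) ∷ later) ++ r) ∷ [])
      member  : ∀ M y → memB M gs n y ≡ gateB M gate (memB M later) y
      linked  : T (okB later gate)
      valid   : T (validB later)
      shorter : length later < length gs
      fits-N  : length (encodeRaws ((n , gate) ∷ later) ++ r) ≤ N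

  find : ∀ gs r n {u} → length (encodeRaws gs ++ r) ≤ N → T (hasName n gs) → T (validB gs) → Found z (u ∷ nb n ∷ ρ) gs r n
  find {z = z} {ρ = ρ} (g@(l , x) ∷ gs) r n {u} le t v = go (l ≡ᵇ n) refl
    where
    test : ∀ {σ : Vec Word 3} → Ev z (nb l ∷ lookup σ zero ∷ lookup σ (suc zero) ∷ lookup σ (suc (suc zero)) ∷ (encodeRaws gs ++ r) ∷
             rep true ∷ (true ∷ encodeRaw g ++ encodeRaws gs ++ r) ∷ u ∷ nb n ∷ ρ) (bind (x₀ ⊗ x₈) eqT) (rep (l ≡ᵇ n) ∷ [])
    test = bind (var ⊗ var) (eqE l n)
    fields : Ev z (rep true ∷ (true ∷ encodeRaw g ++ encodeRaws gs ++ r) ∷ u ∷ nb n ∷ ρ) (bind (tl x₁) gateT) (Fields g (encodeRaws gs ++ r))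
    fields = bind (tl var) (gate! g (encodeRaws gs ++ r) (gates-length g gs r le))
    go : ∀ b → (l ≡ᵇ n) ≡ b → Found z (u ∷ nb n ∷ ρ) (g ∷ gs) r n
    go true eq with refl ← ≡ᵇ⇒≡ l n (subst T (sym eq) tt) = found x gs
      (subst (λ v → Iter z (u ∷ nb l ∷ ρ) one findBody (rep true ∷ v ∷ []) ([] ∷ v ∷ [])) (sym (encodeRaws-∷ g gs r))
        (more refl (bind fields (ifE (l ≡ᵇ l) (test {_ ∷ _ ∷ _ ∷ []}) (λ _ → nil ⊗ var)
           (λ f → ⊥-elim (T-not-elim {l ≡ᵇ l} f (subst T (sym eq) tt))))) (done refl)))
      member (proj₁ (proj₂ (valid-∷ l x gs v))) (proj₂ (proj₂ (valid-∷ l x gs v))) ≤-refl le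
      where
      member : ∀ M y → memB M (g ∷ gs) l y ≡ gateB M x (memB M gs) y
      member M y rewrite eq = refl
    go false eq with found x′ gs′ it mem li va sh le″ ← find {z = z} {ρ = ρ} gs r n {u} (rest-length g gs r le) (subst (λ b → T (b ∨ hasName n gs)) eq t) (proj₂ (proj₂ (valid-∷ l x gs v))) =
      found x′ gs′
        (subst (λ v → Iter z (u ∷ nb n ∷ ρ) one findBody (rep true ∷ v ∷ []) ([] ∷ (encodeRaws ((n , x′) ∷ gs′) ++ r) ∷ [])) (sym (encodeRaws-∷ g gs r))
          (more refl (bind fields (ifE (l ≡ᵇ n) (test {_ ∷ _ ∷ _ ∷ []}) (λ f → ⊥-elim (subst T eq f))
             (λ _ → yesE ⊗ var))) it))
        member li va (m≤n⇒m≤1+n sh) le″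
      where
      member : ∀ M y → memB M (g ∷ gs) n y ≡ gateB M x′ (memB M gs′) y
      member M y = trans (cong (λ b → if b then gateB M x (memB M gs) y else memB M gs n y) eq) (mem M y)

  -- The recursion along the gates

  module _ {M : ℕ} (M≤ : M ≤ W) where

    -- The induction hypothesis as an object: the procedure answers correctly on the list `gs`, and
    -- whenever a call is legitimate, a level of nesting is left for it. The single kinds of gates
    -- can thus be treated apart from the recursion.
    record Oracle (z : ℕ) (gs : List Raw) (r : Word) : Set where
      constructor oracle
      field
        answer : ∀ p {y} → T (hasName p gs) → y ≤ M →
          ∃[ z′ ] (z ≡ suc z′ × Ev z′ ((encodeRaws gs ++ r) ∷ nb p ∷ nb y ∷ nb M ∷ []) memT (rep (memB M gs p y) ∷ []))

    callE : ∀ {gs r p y} {t : Term n 4} → Oracle z gs r → T (hasName p gs) → y ≤ M →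
            Ev z ρ t ((encodeRaws gs ++ r) ∷ nb p ∷ nb y ∷ nb M ∷ []) → Ev z ρ (call t) (rep (memB M gs p y) ∷ [])
    callE {p = p} (oracle o) t y≤ e with z′ , eq , f ← o p t y≤ = call eq e f

    module _ {z : ℕ} {gs : List Raw} {r : Word} (o : Oracle z gs r) (p q : ℕ) (p∈ : T (hasName p gs)) (q∈ : T (hasName q gs))
             {a b c d e f : Word} {y : ℕ} (y≤ : y ≤ M) where

      env : Vec Word 11
      env = a ∷ b ∷ nb p ∷ nb q ∷ (encodeRaws gs ++ r) ∷ c ∷ d ∷ e ∷ f ∷ nb y ∷ nb M ∷ []

      plusTest divTest : ℕ → Bool
      plusTest i = memB M gs p i ∧ memB M gs q (y ∸ i)
      divTest i = memB M gs q i ∧ memB M gs p (i * y ⊓ M)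

      -- Invariant: `b` is the answer for the summands below `i`, `j` of them remain, and their
      -- number together with `i` is constant. Once the answer is positive, the loop goes on
      -- counting without further calls.
      plusIter : ∀ j i b → i + j ≤ suc y →
                 Iter z env some plusBody (nb j ∷ nb i ∷ rep b ∷ []) ([] ∷ nb (i + j) ∷ rep (b ∨ anyFrom i j plusTest) ∷ [])
      plusIter zero    i b le rewrite +-identityʳ i | ∨-identityʳ b = done refl
      plusIter (suc j) i b le =
        subst₂ (λ m b′ → Iter z env some plusBody (nb (suc j) ∷ nb i ∷ rep b ∷ []) ([] ∷ nb m ∷ rep b′ ∷ []))
          (sym (+-suc i j)) (∨-assoc b (plusTest i) (anyFrom (suc i) j plusTest))
          (more (some-inc (nb j))
            (dec= j var ⊗ inc= i (≤-trans i≤y (≤-trans y≤ M≤)) var ⊗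
             orE b var (λ _ → andE (memB M gs p i)
               (callE o p∈ (≤-trans i≤y y≤) (var ⊗ var ⊗ var ⊗ var))
               (λ _ → callE o q∈ (≤-trans (m∸n≤m y i) y≤)
                 (var ⊗ var ⊗ bind (var ⊗ var) (monusE y i) ⊗ var))))
            (plusIter j (suc i) (b ∨ plusTest i) le′))
        where
        le′ : suc i + j ≤ suc y
        le′ = ≤-trans (≤-reflexive (sym (+-suc i j))) le
        i≤y : i ≤ y
        i≤y = ≤-pred (≤-trans (s≤s (m≤m+n i j)) le′)

      divIter : ∀ j i b → i + j ≤ suc M →
                Iter z env some divBody (nb j ∷ nb i ∷ rep b ∷ []) ([] ∷ nb (i + j) ∷ rep (b ∨ anyFrom i j divTest) ∷ [])
      divIter zero    i b le rewrite +-identityʳ i | ∨-identityʳ b = done refl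
      divIter (suc j) i b le =
        subst₂ (λ m b′ → Iter z env some divBody (nb (suc j) ∷ nb i ∷ rep b ∷ []) ([] ∷ nb m ∷ rep b′ ∷ []))
          (sym (+-suc i j)) (∨-assoc b (divTest i) (anyFrom (suc i) j divTest))
          (more (some-inc (nb j))
            (dec= j var ⊗ inc= i (≤-trans i≤M M≤) var ⊗
             orE b var (λ _ → andE (memB M gs q i)
               (callE o q∈ i≤M (var ⊗ var ⊗ var ⊗ var))
               (λ _ → callE o p∈ (m⊓n≤n (i * y) M)
                 (var ⊗ var ⊗ bind (var ⊗ var ⊗ var)
                   (mulE M≤ i y y≤) ⊗ var))))
            (divIter j (suc i) (b ∨ divTest i) le′))
        where
        le′ : suc i + j ≤ suc M
        le′ = ≤-trans (≤-reflexive (sym (+-suc i j))) le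
        i≤M : i ≤ M
        i≤M = ≤-pred (≤-trans (s≤s (m≤m+n i j)) le′)

      plusE : Ev z env plusT (rep (anyFrom 0 (suc y) plusTest) ∷ [])
      plusE = bind (loop (inc= y (≤-trans y≤ M≤) var ⊗ nil ⊗ nil)
                (plusIter (suc y) 0 false ≤-refl)) var

      divE : Ev z env divT (rep (anyFrom 1 M divTest) ∷ [])
      divE = bind (loop (var ⊗ cons nil (s≤s z≤n) ⊗ nil)
               (divIter M 1 false ≤-refl)) var

    gateMemE : ∀ x {gs r} {a c d e f y} → Oracle z gs r → T (okB gs x) → y ≤ M →
               Ev z (a ∷ (encodeBody x ++ encodeRaws gs ++ r) ∷ operand₁ x ∷ operand₂ x ∷ (encodeRaws gs ++ r) ∷ c ∷ d ∷ e ∷ f ∷ nb y ∷ nb M ∷ [])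
                 gateMemT (rep (gateB M x (memB M gs) y) ∷ [])
    gateMemE {z = z} x {gs} {r} {y = y} o ok y≤ = switch! x var (chosen x ok)
      where
      chosen : ∀ x {a b c d e f} → T (okB gs x) → Ev z (a ∷ b ∷ operand₁ x ∷ operand₂ x ∷ (encodeRaws gs ++ r) ∷ c ∷ d ∷ e ∷ f ∷ nb y ∷ nb M ∷ [])
               (select x noT (bind (x₂ ⊗ x₉) eqT) (ifT′ (askT x₂) noT yesT) (ifT′ (askT x₂) yesT (askT x₃)) (ifT′ (askT x₂) (askT x₃) noT) plusT divT)
               (rep (gateB M x (memB M gs) y) ∷ [])
      chosen (input m) ok = bind (var ⊗ var) (eqE m y)
      chosen (complement _ p) ok = notE (memB M gs p y) (callE o ok y≤ (var ⊗ var ⊗ var ⊗ var))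
      chosen (binary cup _ p q) ok = orE (memB M gs p y) (callE o (proj₁ ok′) y≤ (var ⊗ var ⊗ var ⊗ var))
        (λ _ → callE o (proj₁ (split-∧ (hasName q gs) (proj₂ ok′))) y≤ (var ⊗ var ⊗ var ⊗ var))
        where ok′ = split-∧ (hasName p gs) ok
      chosen (binary cap _ p q) ok = andE (memB M gs p y) (callE o (proj₁ ok′) y≤ (var ⊗ var ⊗ var ⊗ var))
        (λ _ → callE o (proj₁ (split-∧ (hasName q gs) (proj₂ ok′))) y≤ (var ⊗ var ⊗ var ⊗ var))
        where ok′ = split-∧ (hasName p gs) ok
      chosen (binary plus _ p q) ok = plusE o p q (proj₁ ok′) (proj₁ (split-∧ (hasName q gs) (proj₂ ok′))) y≤
        where ok′ = split-∧ (hasName p gs) ok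
      chosen (binary times (there (there (there (there (there ()))))) p q) ok
      chosen (binary div _ p q) ok = divE o p q (proj₁ ok′) (proj₁ (split-∧ (hasName q gs) (proj₂ ok′))) y≤
        where ok′ = split-∧ (hasName p gs) ok

    -- Calls made for a gate receive only the gates after it, so each level of nesting shortens the
    -- list. The outermost evaluation happens inside a call already, whence `suc z` gates for `z`
    -- levels.
    memE : ∀ z gs r n {y} → length gs ≤ suc z → length (encodeRaws gs ++ r) ≤ N → T (hasName n gs) → T (validB gs) → y ≤ M →
           Ev z ((encodeRaws gs ++ r) ∷ nb n ∷ nb y ∷ nb M ∷ []) memT (rep (memB M gs n y) ∷ [])
    memE z gs r n {y} gs≤ le t v y≤ with found x gs′ it mem li va sh le′ ← find {z = z} {ρ = nb y ∷ nb M ∷ []} gs r n {encodeRaws gs ++ r} le t v =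
      bind (loop (yesE ⊗ var) it)
        (bind (subst (λ u → Ev z ([] ∷ u ∷ (encodeRaws gs ++ r) ∷ nb n ∷ nb y ∷ nb M ∷ []) (bind (tl x₁) gateT) (Fields (n , x) (encodeRaws gs′ ++ r)))
                 (sym (encodeRaws-∷ (n , x) gs′ r))
                 (bind (tl var) (gate! (n , x) (encodeRaws gs′ ++ r) (gates-length (n , x) gs′ r le′))))
          (cast (cong (λ b → rep b ∷ []) (sym (mem M y))) (gateMemE x (oracle (ask z (≤-pred (≤-trans sh gs≤)))) li y≤)))
      where
      ask : ∀ z → length gs′ ≤ z → ∀ p {y} → T (hasName p gs′) → y ≤ M →
            ∃[ z′ ] (z ≡ suc z′ × Ev z′ ((encodeRaws gs′ ++ r) ∷ nb p ∷ nb y ∷ nb M ∷ []) memT (rep (memB M gs′ p y) ∷ []))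
      ask (suc z) le p p∈ q≤ = z , refl , memE z gs′ r p le (rest-length (n , x) gs′ r le′) p∈ va q≤
      -- Without levels left there are no later gates, hence no predecessor to ask about.
      ask zero    le p p∈ q≤ = contradiction p∈ (empty gs′ le)
        where
        empty : ∀ gs → length gs ≤ 0 → ¬ T (hasName p gs)
        empty [] _ ()

-- Parsing and deciding whole input words

parseLast : Word → Maybe ℕ
parseLast v = parseNum v >>= λ { (b , []) → just b ; (_ , _ ∷ _) → nothing }

parseAll : Word → Maybe Decoded
parseAll w = parseNum w >>= λ (o , v) → parseRaws (length v) v >>= λ (gs , r) → parseLast r >>= λ b → just (o , gs , b)

parseLast-complete : ∀ b → parseLast (encodeℕ b) ≡ just b
parseLast-complete b with e ← parseNum-complete b [] rewrite ++-identityʳ (encodeℕ b) | e = refl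

parseLast-sound : ∀ v {b} → parseLast v ≡ just b → v ≡ encodeℕ b
parseLast-sound v e with parseNum v in eq
... | just (b , []) with refl ← e = trans (parseNum-sound v eq) (++-identityʳ (encodeℕ b))

parseAll-complete : ∀ d → parseAll (encodeAll d) ≡ just d
parseAll-complete (o , gs , b)
  rewrite parseNum-complete o (encodeRaws gs ++ encodeℕ b)
        | parseRaws-complete gs (encodeℕ b) {length (encodeRaws gs ++ encodeℕ b)}
            (≤-trans (length-encodeRaws gs) (≤-trans (m≤m+n _ _) (≤-reflexive (sym (length-++ (encodeRaws gs))))))
        | parseLast-complete b = refl

parseAll-sound : ∀ w {d} → parseAll w ≡ just d → w ≡ encodeAll d
parseAll-sound w e with parseNum w in eq₁
... | just (o , v) with parseRaws (length v) v in eq₂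
...   | just (gs , r) with parseLast r in eq₃
...     | just b with refl ← e = trans (parseNum-sound w eq₁) (cong (encodeℕ o ++_)
            (trans (parseRaws-sound (length v) v eq₂) (cong (encodeRaws gs ++_) (parseLast-sound r eq₃))))

decide : Word → Maybe Decoded → Bool
decide w nothing              = false
decide w (just (o , gs , b)) = validB gs ∧ (hasName o gs ∧ memB (val w) gs o (b ⊓ val w))

-- Soundness and completeness of the parser together say that a word encodes at most one triple, so
-- testing the parsed triple settles the existential statement of `MC-raws`.
decide-correct : ∀ w → w ∈ MC Ops ⇔ T (decide w (parseAll w))
decide-correct w = mk⇔ (λ w∈ → complete (to (MC-raws w) w∈)) (λ t → from (MC-raws w) (sound (parseAll w) refl t))
  where
  bound : ∀ o gs b → w ≡ encodeAll (o , gs , b) → threshold gs ≤ val w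
  bound o gs b refl = threshold-≤-val (encodeℕ o) gs (encodeℕ b)
    (≤-trans (m≤n+m 1 (length (spread (binaryDigits o)))) (≤-reflexive (sym (length-++ (spread (binaryDigits o))))))
  mem : ∀ o gs b → w ≡ encodeAll (o , gs , b) → T (memB (val w) gs o (b ⊓ val w)) ⇔ Mem gs o (b ⊓ val w)
  mem o gs b e = mem-correct (val w) gs o (b ⊓ val w) (bound o gs b e) (m⊓n≤n b (val w))
  complete : ∃[ o ] ∃[ gs ] ∃[ b ] (w ≡ encodeAll (o , gs , b) × T (validB gs) × T (hasName o gs) × Mem gs o b) → T (decide w (parseAll w))
  complete (o , gs , b , e , v , t , b∈) =
    subst (λ d → T (decide w d)) (sym (trans (cong parseAll e) (parseAll-complete (o , gs , b))))
      (from (T-∧ {validB gs} T-id (T-∧ {hasName o gs} T-id (mem o gs b e)))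
        (v , t , to (stable-cap b (mem-stable gs o) (bound o gs b e)) b∈))
  sound : ∀ d → parseAll w ≡ d → T (decide w d) →
          ∃[ o ] ∃[ gs ] ∃[ b ] (w ≡ encodeAll (o , gs , b) × T (validB gs) × T (hasName o gs) × Mem gs o b)
  sound (just (o , gs , b)) eq t
    with e ← parseAll-sound w eq
    with v , n , m ← to (T-∧ {validB gs} T-id (T-∧ {hasName o gs} T-id (mem o gs b e))) t
    = o , gs , b , e , v , n , from (stable-cap b (mem-stable gs o) (bound o gs b e)) m

-- Evaluation of the main term

module Main (w : Word) where
  open Evaluation w
  open Decoding w
  open Semantics N memT

  Last : ∀ {n} → ℕ → Vec Word n → Word → Maybe ℕ → Set
  Last z ρ v (just b) = Ev z (v ∷ ρ) numT (nb b ∷ (false ∷ []) ∷ [])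
  Last z ρ v nothing  = ∀ {t} → Ev z (v ∷ ρ) (bind numT (caseOf x₁ noT (caseOf (tl x₁) t noT noT) noT)) ([] ∷ [])

  lastE : ∀ {z n} {ρ : Vec Word n} v → length v ≤ N → Last z ρ v (parseLast v)
  lastE {z} {ρ = ρ} v le with parseNum v | numE {z = z} {ρ = ρ} v le
  ... | nothing                | u , e = bind e (case[] var nil)
  ... | just (b , [])          | e = e
  ... | just (b , false ∷ _)   | e = bind e (case₀ var (case₀ (tl var) nil))
  ... | just (b , true ∷ _)    | e = bind e (case₀ var (case₁ (tl var) nil))

  monus-cap : ∀ b → W ∸ (W ∸ b) ≡ b ⊓ W
  monus-cap b with ≤-total b W
  ... | inj₁ b≤W = trans (m∸[m∸n]≡n b≤W) (sym (m≤n⇒m⊓n≡m b≤W))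
  ... | inj₂ W≤b = trans (cong (W ∸_) (m≤n⇒m∸n≡0 W≤b)) (sym (m≥n⇒m⊓n≡n W≤b))

  checkE : ∀ {z} o gs r b {a c d e} → length gs ≤ suc z → length (encodeRaws gs ++ r) ≤ N →
           Ev (suc z) (nb b ∷ a ∷ c ∷ d ∷ (encodeRaws gs ++ r) ∷ nb o ∷ e ∷ nb W ∷ []) checkT
             (rep (validB gs ∧ (hasName o gs ∧ memB W gs o (b ⊓ W))) ∷ [])
  checkE {z} o gs r b gs≤ le = andE (validB gs) (bind var (validE gs r le))
    (λ v → andE (hasName o gs) (bind (var ⊗ var) (isinE gs r o le))
      (λ t → call refl
        (var ⊗ var ⊗
         cast (cong (λ m → nb m ∷ []) (monus-cap b))
           (bind (var ⊗ bind (var ⊗ var) (monusE W b))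
             (monusE W (W ∸ b))) ⊗
         var)
        (memE ≤-refl z gs r o gs≤ le t v (m⊓n≤n b W))))

  nonempty : ∀ gs {r} → 1 ≤ length (encodeRaws gs ++ r)
  nonempty []      = s≤s z≤n
  nonempty (_ ∷ _) = s≤s z≤n

  positive : ∀ {m n} → suc m ≤ n → ∃[ z ] n ≡ suc z
  positive {n = suc z} _ = z , refl

  -- The call from the main term uses one level of nesting. `length w` is a successor because even
  -- the empty list of gates has an end marker, and the remaining levels suffice because there are
  -- at most `length w` gates. The cap is `w` itself, rewritten as `nb W`.
  checkWordE : ∀ o gs r b v {a c d e} → v ≡ encodeRaws gs ++ r → length v ≤ length w →
               Ev (length w) (nb b ∷ a ∷ c ∷ d ∷ v ∷ nb o ∷ e ∷ w ∷ []) checkT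
                 (rep (validB gs ∧ (hasName o gs ∧ memB W gs o (b ⊓ W))) ∷ [])
  checkWordE o gs r b _ {a} {c} {d} {e} refl v≤ with z , eq ← positive (≤-trans (nonempty gs) v≤) =
    subst₂ (λ z u → Ev z (nb b ∷ a ∷ c ∷ d ∷ (encodeRaws gs ++ r) ∷ nb o ∷ e ∷ u ∷ []) checkT
              (rep (validB gs ∧ (hasName o gs ∧ memB W gs o (b ⊓ W))) ∷ []))
      (sym eq) (nb-val w)
      (checkE o gs r b (≤-trans gates≤ (≤-trans v≤ (≤-reflexive eq))) (m≤n⇒m≤1+n v≤))
    where
    gates≤ : length gs ≤ length (encodeRaws gs ++ r)
    gates≤ = ≤-trans (length-encodeRaws gs) (≤-trans (m≤m+n _ _) (≤-reflexive (sym (length-++ (encodeRaws gs)))))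

  Answer : ∀ {n} → Vec Word n → Term n 1 → Maybe Decoded → Set
  Answer ρ t d = Ev (length w) ρ t (rep (decide w d) ∷ [])

  lastStage : ∀ {o v gs r a} m → Last (length w) (a ∷ v ∷ nb o ∷ (false ∷ v) ∷ w ∷ []) r m →
              v ≡ encodeRaws gs ++ r → length v ≤ length w →
              Answer (r ∷ a ∷ v ∷ nb o ∷ (false ∷ v) ∷ w ∷ []) lastT (m >>= λ b → just (o , gs , b))
  lastStage nothing                       f v≡ v≤ = f
  lastStage {o} {v} {gs} {r} (just b) f v≡ v≤ =
    bind f (case₀ var (case[] (tl var) (checkWordE o gs r b v v≡ v≤)))

  gatesStage : ∀ {o v} m → parseRaws (length v) v ≡ m → Skip (length w) (v ∷ nb o ∷ (false ∷ v) ∷ w ∷ []) v m →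
               length v ≤ length w →
               Answer (v ∷ nb o ∷ (false ∷ v) ∷ w ∷ []) gatesT (m >>= λ (gs , r) → parseLast r >>= λ b → just (o , gs , b))
  gatesStage nothing                  e it v≤ = bind (loop var it) (case[] var nil)
  gatesStage {o} {v} (just (gs , r)) e it v≤ = bind (loop var it) (case₀ var (bind (tl var)
    (lastStage (parseLast r) (lastE r (m≤n⇒m≤1+n r≤)) v≡ v≤)))
    where
    v≡ = parseRaws-sound (length v) v e
    r≤ : length r ≤ length w
    r≤ = ≤-trans (≤-trans (m≤n+m (length r) (length (encodeRaws gs)))
           (≤-reflexive (trans (sym (length-++ (encodeRaws gs))) (cong length (sym v≡))))) v≤

  numStage : ∀ m → parseNum w ≡ m → Num (length w) [] w m →
             Answer (w ∷ []) mainT (m >>= λ (o , v) → parseRaws (length v) v >>= λ (gs , r) → parseLast r >>= λ b → just (o , gs , b))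
  numStage nothing        eq (u , e) = bind e (bind (tl var) (bind (loop var (done refl)) (case[] var nil)))
  numStage (just (o , v)) eq e = bind e (bind (tl var)
    (gatesStage (parseRaws (length v) v) refl (skipIter (length v) v ≤-refl (m≤n⇒m≤1+n v≤)) v≤))
    where v≤ = parseNum-length w eq

  mainE : Answer (w ∷ []) mainT (parseAll w)
  mainE = numStage (parseNum w) refl (numE w (n≤1+n _))

theorem1 : MC (bin cup ∷ bin cap ∷ compl ∷ bin plus ∷ bin div ∷ []) ∈ PSPACE
theorem1 = term-PSPACE memT mainT λ w → length w , _ , ≤-refl , Main.mainE w , iff w
  where
  some-rep : ∀ b → T (some (top (rep b))) ⇔ T b
  some-rep true  = mk⇔ id id
  some-rep false = mk⇔ id id
  iff : ∀ w → w ∈ MC Ops ⇔ T (some (top (rep (decide w (parseAll w)))))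
  iff w = mk⇔ (from (some-rep _) ∘ to (decide-correct w)) (from (decide-correct w) ∘ to (some-rep _))
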